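{- Let $\lambda=(\lambda_1,\lambda_2)$ be a partition with two parts, $\lambda_1\ge\lambda_2\ge1$. Then the average case complexity of the Novelli--Pak--Stoyanovskii algorithm on $\lambda$ is given by $$C(\lambda)=\frac{\lambda_1(\lambda_1-1)}{4}+\frac{\lambda_2(\lambda_2-3)}{4}-2\sum_{k=1}^{\lambda_2}\binom{\lambda_2}{k}\frac{(-1)^k(2k-2)!}{(\lambda_1-\lambda_2+2)_{2k-1}}.$$
   Context: $(x)_k$ denotes the Pochhammer symbol: $(x)_0=1$ and $(x)_k=x(x+1)\cdots(x+k-1)$ for positive integers $k$. A partition $\lambda$ of $n$ is identified with its Young diagram $\{(i,j):1\le i\le l(\lambda),\ 1\le j\le\lambda_i\}$ ($l(\lambda)$ is the number of parts), whose elements are called cells. A cell $(i,j)$ is a corner of $\lambda$ if neither $(i+1,j)$ nor $(i,j+1)$ belongs to $\lambda$. A tableau of shape $\lambda$ is a bijection $T:\lambda\to\{1,\dots,n\}$; the set of tableaux is $\mathrm{T}(\lambda)$. The (column-wise) Novelli--Pak--Stoyanovskii (NPS) algorithm applied to $T\in \mathrm{T}(\lambda)$: order cells by $(i,j)\preceq(i',j')$ if $j<j'$, or $j=j'$ and $i\le i'$. Let $(i_1,j_1)\succ\dots\succ(i_n,j_n)$ be the cells of $\lambda$ in decreasing order, put $k_r=T(i_r,j_r)$ (entries of the initial tableau) and $T_0=T$. For $r=1,\dots,n$ the tableau $T_r$ is obtained from $T_{r-1}$ as follows. Start with the current tableau equal to $T_{r-1}$ and repeat: let $(i,j)$ be the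 cell of the current tableau containing $k_r$. If $(i,j)$ is a corner of $\lambda$, stop. Otherwise let $m$ be the minimum of the entries of the current tableau in the cells of $\lambda\cap\{(i+1,j),(i,j+1)\}$. If $k_r<m$, stop. If $m<k_r$, exchange the entries $m$ and $k_r$ (one exchange) and repeat. When stopped, $T_r$ is the current tableau. $n(T)$ is the total number of exchanges performed during the construction of $T_1,\dots,T_n$, and $C(\lambda)=\frac1{n!}\sum_{T\in \mathrm{T}(\lambda)}n(T)$. -}

module Defs where

open import Data.Fin.Base using (Fin; fromℕ<; toℕ; punchIn)
import Data.Fin.Properties as Fin
open import Data.Fin.Permutation
  using (Permutation′; _⟨$⟩ʳ_; id; insert; remove; transpose; insert-remove; insert-punchIn)
  renaming (_≈_ to _≈ₚ_)
import Data.Fin.Permutation.Components as PC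
open import Data.Fin.Patterns using (0F)
open import Data.List.Base
  using (List; []; _∷_; [_]; map; mapMaybe; concatMap; cartesianProductWith; allFin; downFrom; foldl; length)
open import Data.List.Extrema using (min; argmin-sel)
open import Data.List.Membership.Propositional using (_∈_)
open import Data.List.Membership.Propositional.Properties using (∈-map⁻; ∈-allFin)
open import Data.List.Relation.Unary.All using (All; []; _∷_)
import Data.List.Relation.Unary.All as All
import Data.List.Relation.Unary.All.Properties as All
open import Data.List.Relation.Unary.AllPairs using (AllPairs; []; _∷_)
import Data.List.Relation.Unary.AllPairs as AllPairs
import Data.List.Relation.Unary.AllPairs.Properties as AllPairs
open import Data.List.Relation.Unary.Any using (Any; here; there)
import Data.List.Relation.Unary.Any as Any
import Data.List.Relation.Unary.Any.Properties as Any
open import Data.List.Relation.Unary.Linked using (Linked; [-]; _∷_)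
open import Data.List.Relation.Unary.Unique.Propositional.Properties using (allFin⁺)
import Data.Integer.Base as ℤ
open import Data.Maybe.Base using (Maybe; just; nothing)
open import Data.Nat.Base
open import Data.Nat.ListAction using (sum)
open import Data.Nat.Properties
open import Data.Product.Base using (Σ-syntax; _×_; _,_; proj₁; proj₂; map₁)
open import Data.Rational.Base as ℚ using (ℚ; 0ℚ)
open import Data.Sum.Base using (_⊎_; inj₁; inj₂)
open import Data.Sum.Function.Propositional using (_⊎-↔_)
open import Function.Base using (_∘_)
open import Function.Bundles using (_↔_; mk↔ₛ′; module Inverse)
open import Function.Construct.Composition using (_↔-∘_)
open import Function.Construct.Identity using (↔-id)
open import Function.Construct.Symmetry using (↔-sym)
open import Relation.Binary.PropositionalEquality hiding ([_])
open import Relation.Nullary using (¬_; yes; no; contradiction)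
open import Relation.Nullary.Decidable using (dec-true)

open Inverse using (to; from)

record Partition : Set where
  field
    parts      : List ℕ
    decreasing : Linked _≥_ parts
    positive   : All (_≥ 1) parts

  size : ℕ
  size = sum parts

open Partition public

twoRows : (a b : ℕ) → a ≥ b → b ≥ 1 → Partition
twoRows a b a≥b b≥1 = record
  { parts      = a ∷ b ∷ []
  ; decreasing = a≥b ∷ [-]
  ; positive   = ≤-trans b≥1 a≥b ∷ b≥1 ∷ []
  }

-- Rows and columns are numbered from 0, and a row beyond the last has
-- length 0.
rowLength : List ℕ → ℕ → ℕ
rowLength []       _       = 0
rowLength (x ∷ _)  zero    = x
rowLength (_ ∷ xs) (suc i) = rowLength xs i

Cells : List ℕ → Set
Cells xs = Σ[ (i , j) ∈ ℕ × ℕ ] j < rowLength xs i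

Cell : Partition → Set
Cell Λ = Cells (parts Λ)

cell? : ∀ Λ → ℕ × ℕ → Maybe (Cell Λ)
cell? Λ (i , j) with j <? rowLength (parts Λ) i
... | yes p = just ((i , j) , p)
... | no  _ = nothing

-- From the last column to the first, and upwards within each column.
cellsDecreasing : ∀ Λ → List (Cell Λ)
cellsDecreasing Λ =
  mapMaybe (cell? Λ)
    (cartesianProductWith (λ j i → i , j)
      (downFrom (rowLength (parts Λ) 0)) (downFrom (length (parts Λ))))

-- The entries 1, …, n are represented by 0, …, n - 1.
Tableau : Partition → Set
Tableau Λ = Cell Λ ↔ Fin (size Λ)

rowLength≤sum : ∀ xs i → rowLength xs i ≤ sum xs
rowLength≤sum []       _       = z≤n
rowLength≤sum (x ∷ xs) zero    = m≤m+n x (sum xs)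
rowLength≤sum (x ∷ xs) (suc i) = ≤-trans (rowLength≤sum xs i) (m≤n+m (sum xs) x)

row<length : ∀ xs {i j} → j < rowLength xs i → i < length xs
row<length (_ ∷ _)  {zero}  _ = z<s
row<length (_ ∷ xs) {suc i} p = s<s (row<length xs p)

module _ (Λ : Partition) where

  -- Cells below and to the right; empty exactly for the corners.
  neighbours : Cell Λ → List (Cell Λ)
  neighbours ((i , j) , _) = mapMaybe (cell? Λ) ((suc i , j) ∷ (i , suc j) ∷ [])

  -- The entry with which k has to be exchanged, if any.
  exchangePartner : Tableau Λ → Fin (size Λ) → Maybe (Fin (size Λ))
  exchangePartner T k with map (to T) (neighbours (from T k))
  ... | []     = nothing
  ... | x ∷ xs with min (Fin.≤-totalOrder _) x xs
  ...   | m with m Fin.<? k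
  ...     | yes _ = just m
  ...     | no  _ = nothing

  exchange : Fin (size Λ) → Fin (size Λ) → Tableau Λ → Tableau Λ
  exchange m k T = transpose m k ↔-∘ T

  -- The number of exchanges and the final tableau.  The first argument
  -- bounds the number of exchanges; see settle-stops.
  settle : ℕ → Fin (size Λ) → Tableau Λ → ℕ × Tableau Λ
  settle zero       k T = 0 , T
  settle (suc fuel) k T with exchangePartner T k
  ... | nothing = 0 , T
  ... | just m  = map₁ suc (settle fuel k (exchange m k T))

  enoughFuel : ℕ
  enoughFuel = length (parts Λ) + size Λ

  -- One round for the cell c, whose entry is read off the initial tableau T₀.
  round : Tableau Λ → ℕ × Tableau Λ → Cell Λ → ℕ × Tableau Λ
  round T₀ (e , T) c = map₁ (e +_) (settle enoughFuel (to T₀ c) T)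

  exchanges : Tableau Λ → ℕ
  exchanges T₀ = proj₁ (foldl (round T₀) (0 , T₀) (cellsDecreasing Λ))

  depth : Cell Λ → ℕ
  depth ((i , j) , _) = i + j

  transpose-first : ∀ {n} (i j : Fin n) → PC.transpose i j i ≡ j
  transpose-first i j rewrite dec-true (i Fin.≟ i) refl = refl

  depth< : (c : Cell Λ) → depth c < enoughFuel
  depth< ((i , j) , p) =
    +-mono-<-≤ (row<length (parts Λ) p) (≤-trans (<⇒≤ p) (rowLength≤sum (parts Λ) i))

  ∈-neighbours : ∀ c {d} → d ∈ neighbours c → depth d ≡ suc (depth c)
  ∈-neighbours ((i , j) , _) d∈
    with j <? rowLength (parts Λ) (suc i) | suc j <? rowLength (parts Λ) i
  ∈-neighbours _             (here refl)         | yes _ | _     = refl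
  ∈-neighbours ((i , j) , _) (there (here refl)) | yes _ | yes _ = +-suc i j
  ∈-neighbours ((i , j) , _) (here refl)         | no _  | yes _ = +-suc i j

  partner∈ : ∀ (T : Tableau Λ) k {m} → exchangePartner T k ≡ just m →
             m ∈ map (to T) (neighbours (from T k))
  partner∈ T k eq with map (to T) (neighbours (from T k))
  ... | x ∷ xs with min (Fin.≤-totalOrder _) x xs | argmin-sel (Fin.≤-totalOrder _) (λ y → y) x xs
  ...   | m | sel with m Fin.<? k
  partner∈ T k refl | x ∷ xs | m | inj₁ m≡x  | yes _ = here m≡x
  partner∈ T k refl | x ∷ xs | m | inj₂ m∈xs | yes _ = there m∈xs

  depth-exchange : ∀ (T : Tableau Λ) k {m} → exchangePartner T k ≡ just m →
                   depth (from (exchange m k T) k) ≡ suc (depth (from T k))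
  depth-exchange T k {m} eq with ∈-map⁻ (to T) (partner∈ T k eq)
  ... | d , d∈ , refl = begin
    depth (from T (PC.transpose k (to T d) k)) ≡⟨ cong (depth ∘ from T) (transpose-first k (to T d)) ⟩
    depth (from T (to T d))                    ≡⟨ cong depth (Inverse.strictlyInverseʳ T d) ⟩
    depth d                                    ≡⟨ ∈-neighbours (from T k) d∈ ⟩
    suc (depth (from T k))                     ∎
    where open ≡-Reasoning

  stops : ∀ fuel k (T : Tableau Λ) → enoughFuel ≤ fuel + depth (from T k) →
          exchangePartner (proj₂ (settle fuel k T)) k ≡ nothing
  stops zero       k T le = contradiction (depth< (from T k)) (≤⇒≯ le)
  stops (suc fuel) k T le with exchangePartner T k in eq
  ... | nothing = eq
  ... | just m  = stops fuel k (exchange m k T)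
    (subst (enoughFuel ≤_)
      (sym (trans (cong (fuel +_) (depth-exchange T k eq)) (+-suc fuel _))) le)

  settle-stops : ∀ k (T : Tableau Λ) →
                 exchangePartner (proj₂ (settle enoughFuel k T)) k ≡ nothing
  settle-stops k T = stops enoughFuel k T (m≤m+n _ _)

permutations : ∀ n → List (Permutation′ n)
permutations zero    = [ id ]
permutations (suc n) = concatMap (λ j → map (insert 0F j) (permutations n)) (allFin (suc n))

splitCells : ∀ x xs → Cells (x ∷ xs) ↔ (Fin x ⊎ Cells xs)
splitCells x xs = mk↔ₛ′ f g f∘g g∘f
  where
  f : Cells (x ∷ xs) → Fin x ⊎ Cells xs
  f ((zero  , j) , p) = inj₁ (fromℕ< p)
  f ((suc i , j) , p) = inj₂ ((i , j) , p)

  g : Fin x ⊎ Cells xs → Cells (x ∷ xs)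
  g (inj₁ j)             = (0 , toℕ j) , Fin.toℕ<n j
  g (inj₂ ((i , j) , p)) = (suc i , j) , p

  f∘g : ∀ y → f (g y) ≡ y
  f∘g (inj₁ j) = cong inj₁ (Fin.fromℕ<-toℕ j (Fin.toℕ<n j))
  f∘g (inj₂ _) = refl

  cell-≡ : ∀ {j j′} {p : j < x} {p′ : j′ < x} → j ≡ j′ →
           _≡_ {A = Cells (x ∷ xs)} ((0 , j) , p) ((0 , j′) , p′)
  cell-≡ {p = p} {p′} refl = cong (_ ,_) (<-irrelevant p p′)

  g∘f : ∀ c → g (f c) ≡ c
  g∘f ((zero  , j) , p) = cell-≡ (Fin.toℕ-fromℕ< p)
  g∘f ((suc i , j) , p) = refl

numbering : ∀ xs → Cells xs ↔ Fin (sum xs)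
numbering []       = mk↔ₛ′ (λ ()) (λ ()) (λ ()) (λ ())
numbering (x ∷ xs) = ↔-sym Fin.+↔⊎ ↔-∘ ((↔-id _ ⊎-↔ numbering xs) ↔-∘ splitCells x xs)

-- Every tableau exactly once, up to pointwise equality; see
-- tableaux-complete and tableaux-distinct.
tableaux : ∀ Λ → List (Tableau Λ)
tableaux Λ = map (_↔-∘ numbering (parts Λ)) (permutations (size Λ))

averageComplexity : Partition → ℚ
averageComplexity Λ = (ℤ.+ sum (map (exchanges Λ) (tableaux Λ))) ℚ./ (size Λ !)
  where instance _ = size Λ !≢0

_≈ₜ_ : {A B : Set} → A ↔ B → A ↔ B → Set
S ≈ₜ T = ∀ c → to S c ≡ to T c

insert-cong : ∀ {n} j {π ρ : Permutation′ n} → π ≈ₚ ρ → insert 0F j π ≈ₚ insert 0F j ρ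
insert-cong j         π≈ρ 0F          = refl
insert-cong j {π} {ρ} π≈ρ (Fin.suc i) = begin
  insert 0F j π ⟨$⟩ʳ Fin.suc i ≡⟨ insert-punchIn 0F j π i ⟩
  punchIn j (π ⟨$⟩ʳ i)         ≡⟨ cong (punchIn j) (π≈ρ i) ⟩
  punchIn j (ρ ⟨$⟩ʳ i)         ≡⟨ insert-punchIn 0F j ρ i ⟨
  insert 0F j ρ ⟨$⟩ʳ Fin.suc i ∎
  where open ≡-Reasoning

insert-injective : ∀ {n} j {π ρ : Permutation′ n} → insert 0F j π ≈ₚ insert 0F j ρ → π ≈ₚ ρ
insert-injective j {π} {ρ} eq i = Fin.punchIn-injective j _ _ (begin
  punchIn j (π ⟨$⟩ʳ i)         ≡⟨ insert-punchIn 0F j π i ⟨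
  insert 0F j π ⟨$⟩ʳ Fin.suc i ≡⟨ eq (Fin.suc i) ⟩
  insert 0F j ρ ⟨$⟩ʳ Fin.suc i ≡⟨ insert-punchIn 0F j ρ i ⟩
  punchIn j (ρ ⟨$⟩ʳ i)         ∎)
  where open ≡-Reasoning

permutations-complete : ∀ n (π : Permutation′ n) → Any (π ≈ₚ_) (permutations n)
permutations-complete zero    π = here (λ ())
permutations-complete (suc n) π = Any.concatMap⁺ _ (Any.map step (∈-allFin (π ⟨$⟩ʳ 0F)))
  where
  step : ∀ {j} → π ⟨$⟩ʳ 0F ≡ j → Any (π ≈ₚ_) (map (insert 0F j) (permutations n))
  step refl = Any.map⁺ (Any.map
    (λ {ρ} eq i → trans (sym (insert-remove 0F π i))
                        (insert-cong (π ⟨$⟩ʳ 0F) {remove 0F π} {ρ} eq i))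
    (permutations-complete n (remove 0F π)))

permutations-distinct : ∀ n → AllPairs (λ π ρ → ¬ π ≈ₚ ρ) (permutations n)
permutations-distinct zero    = [] ∷ []
permutations-distinct (suc n) = AllPairs.concat⁺
  (All.map⁺ (All.universal
    (λ j → AllPairs.map⁺ (AllPairs.map
      (λ {π} {ρ} π≉ρ eq → π≉ρ (insert-injective j {π} {ρ} eq))
      (permutations-distinct n)))
    (allFin (suc n))))
  (AllPairs.map⁺ (AllPairs.map
    (λ i≢j → All.map⁺ (All.universal
      (λ _ → All.map⁺ (All.universal (λ _ eq → i≢j (eq 0F)) (permutations n)))
      (permutations n)))
    (allFin⁺ (suc n))))

tableaux-complete : ∀ Λ (T : Tableau Λ) → Any (T ≈ₜ_) (tableaux Λ)
tableaux-complete Λ T = Any.map⁺ (Any.map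
  (λ eq c → trans (cong (to T) (sym (Inverse.strictlyInverseʳ ν c))) (eq (to ν c)))
  (permutations-complete (size Λ) (T ↔-∘ ↔-sym ν)))
  where ν = numbering (parts Λ)

tableaux-distinct : ∀ Λ → AllPairs (λ S T → ¬ S ≈ₜ T) (tableaux Λ)
tableaux-distinct Λ = AllPairs.map⁺ (AllPairs.map
  (λ {π} {ρ} π≉ρ eq → π≉ρ (λ i →
    subst (λ x → π ⟨$⟩ʳ x ≡ ρ ⟨$⟩ʳ x) (Inverse.strictlyInverseˡ ν i) (eq (from ν i))))
  (permutations-distinct (size Λ)))
  where ν = numbering (parts Λ)

pochhammer : ℕ → ℕ → ℕ
pochhammer x zero    = 1
pochhammer x (suc k) = pochhammer x k * (x + k)

pochhammer≢0 : ∀ x k .{{_ : NonZero x}} → NonZero (pochhammer x k)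
pochhammer≢0 x       zero    = _
pochhammer≢0 (suc x) (suc k) =
  m*n≢0 (pochhammer (suc x) k) (suc x + k) {{pochhammer≢0 (suc x) k}}

∑₁ : ℕ → (ℕ → ℚ) → ℚ
∑₁ zero    f = 0ℚ
∑₁ (suc n) f = ∑₁ n f ℚ.+ f (suc n)

infix 5 ∑₁
syntax ∑₁ n (λ k → t) = ∑[1≤ k ≤ n ] t

{-# OPTIONS --safe #-}
module Submission where

-- Once some columns are processed, their entries, read in increasing order and marked up (top
-- row) or down (bottom row), form a ballot word.  Inserting an entry into the bottom row inserts
-- a down anywhere; inserting one into the top row then inserts an up or, past the first
-- passage below 0, inserts a down and turns that passage into an up.  Each ballot word with a
-- ups and b downs is the result of exactly b (a + 1) such pairs of insertions, so ballot words
-- remain equidistributed, and the exchanges of these pairs add up to a polynomial in a and b minus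
-- the squared half-lengths of the segments of the word between visits to 0.  Reading words letter
-- by letter, the sum of these squares over all ballot words becomes a sum of binomial
-- coefficients, and a column costs (a + b - 3) / 2 + 2 H exchanges on average, where
-- H = (C(a+b,0) + ... + C(a+b,b-1)) / (b C(a+b,b)) is the integral of (1-t²)ᵇ⁻¹ (1-t)ᵃ⁻ᵇ⁺¹ over
-- [0,1].  Expanding (1-t²)ᵇ⁻¹ turns H into an alternating sum, and the sum in the theorem into
-- a b-th difference.

-- The algorithm only compares entries, so the processed ones can be renumbered by rank after every
-- insertion; a uniformly random tableau then amounts to independent, uniformly random ranks of the
-- successive entries. The obstacle is that a single insertion destroys uniformity: after the bottom
-- entry of a column, a word that dips to -1 arises in as many ways as it has downs up to that dip.
-- The insertion into the top row evens this out, so the induction runs over columns, not over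
-- cells. The factor b (a + 1) is the product of the two hook lengths in the column, and the
-- resulting multiplicity of every word is the hook product of the shape. No inverse of the
-- insertions is constructed. Fibres are described by equalities of sums with an arbitrary function
-- of the number of exchanges and of the resulting word: a function of the word alone gives
-- uniformity, the number of exchanges itself gives the cost.

module LatticePaths where

  open import Data.Fin.Base as Fin using (Fin; toℕ)
  open import Data.Nat.Base
  open import Data.Nat.Properties
  open import Data.Nat.Tactic.RingSolver using (solve-∀)
  open import Data.Vec.Base using (Vec; []; _∷_)
  open import Relation.Binary.PropositionalEquality
  open import Algebra.Properties.CommutativeSemigroup +-commutativeSemigroup using (x∙yz≈y∙xz)
  open import Algebra.Properties.Semiring.Sum +-*-semiring
    using (sum; sum-cong-≗; ∑-distrib-+; ∑-comm)

  open ≡-Reasoning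

  -- Sums over lattice paths, and the fibres of the two insertions

  data Step : Set where
    up down : Step

  Word : ℕ → Set
  Word = Vec Step

  -- The lattice path w leads from height h to height δ without going below 0.
  data Path (δ : ℕ) : ∀ {n} → ℕ → Word n → Set where
    stop    : Path δ δ []
    climb   : ∀ {n h} {w : Word n} → Path δ (suc h) w → Path δ h (up ∷ w)
    descend : ∀ {n h} {w : Word n} → Path δ h w → Path δ (suc h) (down ∷ w)

  -- Kronecker's delta times x, by recursion on both heights: no decision has to be unfolded, and
  -- recursions such as `advance-at-suc` hold by computation.
  indicator : ℕ → ℕ → ℕ → ℕ
  indicator zero    zero    x = x
  indicator zero    (suc _) x = 0
  indicator (suc _) zero    x = 0
  indicator (suc m) (suc n) x = indicator m n x

  indicator-0 : ∀ m n → indicator m n 0 ≡ 0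
  indicator-0 zero    zero    = refl
  indicator-0 zero    (suc n) = refl
  indicator-0 (suc m) zero    = refl
  indicator-0 (suc m) (suc n) = indicator-0 m n

  indicator-+ : ∀ m n x y → indicator m n (x + y) ≡ indicator m n x + indicator m n y
  indicator-+ zero    zero    x y = refl
  indicator-+ zero    (suc n) x y = refl
  indicator-+ (suc m) zero    x y = refl
  indicator-+ (suc m) (suc n) x y = indicator-+ m n x y

  indicator-* : ∀ m n x y → indicator m n (x * y) ≡ x * indicator m n y
  indicator-* zero    zero    x y = refl
  indicator-* zero    (suc n) x y = sym (*-zeroʳ x)
  indicator-* (suc m) zero    x y = sym (*-zeroʳ x)
  indicator-* (suc m) (suc n) x y = indicator-* m n x y

  indicator-cong : ∀ m n {x y} → (m ≡ n → x ≡ y) → indicator m n x ≡ indicator m n y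
  indicator-cong zero    zero    eq = eq refl
  indicator-cong zero    (suc n) eq = refl
  indicator-cong (suc m) zero    eq = refl
  indicator-cong (suc m) (suc n) eq = indicator-cong m n (λ m≡n → eq (cong suc m≡n))

  pathSum : (δ h n : ℕ) → (Word n → ℕ) → ℕ
  pathSum δ h       zero    F = indicator h δ (F [])
  pathSum δ zero    (suc n) F = pathSum δ 1 n (λ w → F (up ∷ w))
  pathSum δ (suc h) (suc n) F =
    pathSum δ (2 + h) n (λ w → F (up ∷ w)) + pathSum δ h n (λ w → F (down ∷ w))

  pathSum-cong-Path : ∀ δ h n {F G : Word n → ℕ} → (∀ w → Path δ h w → F w ≡ G w) →
                      pathSum δ h n F ≡ pathSum δ h n G
  pathSum-cong-Path δ h       zero    eq = indicator-cong h δ λ { refl → eq [] stop }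
  pathSum-cong-Path δ zero    (suc n) eq = pathSum-cong-Path δ 1 n λ w p → eq _ (climb p)
  pathSum-cong-Path δ (suc h) (suc n) eq = cong₂ _+_
    (pathSum-cong-Path δ (2 + h) n λ w p → eq _ (climb p))
    (pathSum-cong-Path δ h n λ w p → eq _ (descend p))

  pathSum-cong : ∀ δ h n {F G : Word n → ℕ} → (∀ w → F w ≡ G w) →
                 pathSum δ h n F ≡ pathSum δ h n G
  pathSum-cong δ h n eq = pathSum-cong-Path δ h n λ w _ → eq w

  +-interchange : ∀ a b c d → (a + b) + (c + d) ≡ (a + c) + (b + d)
  +-interchange = solve-∀

  pathSum-+ : ∀ δ h n (F G : Word n → ℕ) →
              pathSum δ h n (λ w → F w + G w) ≡ pathSum δ h n F + pathSum δ h n G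
  pathSum-+ δ h       zero    F G = indicator-+ h δ _ _
  pathSum-+ δ zero    (suc n) F G = pathSum-+ δ 1 n _ _
  pathSum-+ δ (suc h) (suc n) F G = trans
    (cong₂ _+_ (pathSum-+ δ (2 + h) n _ _) (pathSum-+ δ h n _ _))
    (+-interchange (pathSum δ (2 + h) n (λ w → F (up ∷ w))) _ _ _)

  pathSum-* : ∀ δ h n x (F : Word n → ℕ) →
              pathSum δ h n (λ w → x * F w) ≡ x * pathSum δ h n F
  pathSum-* δ h       zero    x F = indicator-* h δ x _
  pathSum-* δ zero    (suc n) x F = pathSum-* δ 1 n x _
  pathSum-* δ (suc h) (suc n) x F = trans
    (cong₂ _+_ (pathSum-* δ (2 + h) n x _) (pathSum-* δ h n x _))
    (sym (*-distribˡ-+ x (pathSum δ (2 + h) n (λ w → F (up ∷ w))) _))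

  ∑< : ℕ → (ℕ → ℕ) → ℕ
  ∑< m f = sum {m} (λ i → f (toℕ i))

  insertDown : ∀ {n} → Fin (suc n) → Word n → Word (suc n)
  insertDown Fin.zero    w       = down ∷ w
  insertDown (Fin.suc k) (s ∷ w) = s ∷ insertDown k w

  downsBefore : ∀ {n} → Fin (suc n) → Word n → ℕ
  downsBefore Fin.zero    w          = 0
  downsBefore (Fin.suc k) (up ∷ w)   = downsBefore k w
  downsBefore (Fin.suc k) (down ∷ w) = suc (downsBefore k w)

  -- The number of downs until the path, started at height h, reaches 0.
  descents : ∀ {n} → ℕ → Word n → ℕ
  descents zero    _          = 0
  descents (suc h) []         = 0
  descents (suc h) (up ∷ w)   = descents (2 + h) w
  descents (suc h) (down ∷ w) = suc (descents h w)

  descents-[] : ∀ h → descents h [] ≡ 0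
  descents-[] zero    = refl
  descents-[] (suc h) = refl

  -- A path from h that receives an extra down is read as a path from h + 1: it stays at 1 or above
  -- before the new letter and at 0 or above after it. Conversely, any down up to the first arrival
  -- at 0 may be the new one, and the i-th of these, counted from 0, has i downs before it.
  insertDown-fibres : ∀ δ h n (F : ℕ → Word (suc n) → ℕ) →
    pathSum δ h n (λ w → sum (λ k → F (downsBefore k w) (insertDown k w)))
      ≡ pathSum δ (suc h) (suc n) (λ s → ∑< (descents (suc h) s) (λ i → F i s))
  insertDown-fibres δ h zero F rewrite descents-[] h | indicator-0 (2 + h) δ = refl
  insertDown-fibres δ zero (suc n) F = begin
    pathSum δ 1 n (λ w → F 0 (down ∷ up ∷ w) + sum (λ k → F (downsBefore k w) (up ∷ insertDown k w)))
      ≡⟨ pathSum-+ δ 1 n _ _ ⟩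
    pathSum δ 1 n (λ w → F 0 (down ∷ up ∷ w))
      + pathSum δ 1 n (λ w → sum (λ k → F (downsBefore k w) (up ∷ insertDown k w)))
      ≡⟨ cong₂ _+_ (pathSum-cong δ 1 n λ _ → sym (+-identityʳ _)) (insertDown-fibres δ 1 n (λ i s → F i (up ∷ s))) ⟩
    pathSum δ 0 (suc n) (λ s → F 0 (down ∷ s) + 0)
      + pathSum δ 2 (suc n) (λ s → ∑< (descents 2 s) (λ i → F i (up ∷ s)))
      ≡⟨ +-comm (pathSum δ 0 (suc n) (λ s → F 0 (down ∷ s) + 0)) _ ⟩
    pathSum δ 1 (2 + n) (λ s → ∑< (descents 1 s) (λ i → F i s))
      ∎
  insertDown-fibres δ (suc h) (suc n) F = begin
    pathSum δ (suc h) (suc n) (λ w → F 0 (down ∷ w) + sum (λ k → F (downsBefore (Fin.suc k) w) (insertDown (Fin.suc k) w)))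
      ≡⟨ pathSum-+ δ (suc h) (suc n) (λ w → F 0 (down ∷ w)) (λ w → sum (λ k → F (downsBefore (Fin.suc k) w) (insertDown (Fin.suc k) w))) ⟩
    pathSum δ (suc h) (suc n) (λ w → F 0 (down ∷ w))
      + (pathSum δ (2 + h) n (λ w → sum (λ k → F (downsBefore k w) (up ∷ insertDown k w)))
      + pathSum δ h n (λ w → sum (λ k → F (suc (downsBefore k w)) (down ∷ insertDown k w))))
      ≡⟨ cong (pathSum δ (suc h) (suc n) (λ w → F 0 (down ∷ w)) +_) (cong₂ _+_
        (insertDown-fibres δ (2 + h) n (λ i s → F i (up ∷ s)))
        (insertDown-fibres δ h n (λ i s → F (suc i) (down ∷ s)))) ⟩
    pathSum δ (suc h) (suc n) (λ w → F 0 (down ∷ w)) + (U + V)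
      ≡⟨ x∙yz≈y∙xz (pathSum δ (suc h) (suc n) (λ w → F 0 (down ∷ w))) U V ⟩
    U + (pathSum δ (suc h) (suc n) (λ w → F 0 (down ∷ w)) + V)
      ≡⟨ cong (U +_) (pathSum-+ δ (suc h) (suc n) (λ w → F 0 (down ∷ w)) (λ s → ∑< (descents (suc h) s) (λ i → F (suc i) (down ∷ s)))) ⟨
    pathSum δ (2 + h) (2 + n) (λ s → ∑< (descents (2 + h) s) (λ i → F i s))
      ∎
    where
    U V : ℕ
    U = pathSum δ (3 + h) (suc n) (λ s → ∑< (descents (3 + h) s) (λ i → F i (up ∷ s)))
    V = pathSum δ (suc h) (suc n) (λ s → ∑< (descents (suc h) s) (λ i → F (suc i) (down ∷ s)))

  -- Inserting k into the top row: a value before the first passage below 0 stays in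
  -- the top row; a later one turns that passage into an up and goes to the bottom.
  slide : ∀ {n} → ℕ → Fin (suc n) → Word n → Word (suc n)
  slide h       Fin.zero    w          = up ∷ w
  slide h       (Fin.suc k) (up ∷ w)   = up ∷ slide (suc h) k w
  slide zero    (Fin.suc k) (down ∷ w) = up ∷ insertDown k w
  slide (suc h) (Fin.suc k) (down ∷ w) = down ∷ slide h k w

  -- From height 0, an entry that stays in the top row passes every up before it, and their number
  -- is the height plus the downs read. An entry that leaves the top row makes one move per down
  -- read: to the right before the passage, downwards at the passage, to the right in the bottom row
  -- after it.
  slideLength : ∀ {n} → ℕ → Fin (suc n) → Word n → ℕ
  slideLength h       Fin.zero    w          = h
  slideLength h       (Fin.suc k) (up ∷ w)   = slideLength (suc h) k w
  slideLength zero    (Fin.suc k) (down ∷ w) = suc (downsBefore k w)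
  slideLength (suc h) (Fin.suc k) (down ∷ w) = suc (slideLength h k w)

  -- The sum of g over the numbers of exchanges of all pairs of insertions that result in w, where
  -- w is the rest of a word that reaches height h after c downs.
  fibreSum : ∀ {n} → ℕ → ℕ → Word n → (ℕ → ℕ) → ℕ
  fibreSum h       c []         g = 0
  fibreSum zero    c (up ∷ w)   g =
    ∑< (c + descents 1 w) (λ i → g (i + (c + 0)))
      + (fibreSum 1 c w g + ∑< (descents 1 w) (λ j → ∑< (suc c) (λ i → g (i + (c + suc j)))))
  fibreSum (suc h) c (up ∷ w)   g =
    ∑< (c + descents (2 + h) w) (λ i → g (i + (c + suc h))) + fibreSum (2 + h) c w g
  fibreSum zero    c (down ∷ w) g = 0
  fibreSum (suc h) c (down ∷ w) g = fibreSum h (suc c) w g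

  -- The word s that already contains the new down is read one level higher than the result, as in
  -- `insertDown-fibres`. The induction passes through prefixes with c downs, so the index i of the
  -- new down ranges over the c downs already read and those still to come before the passage below
  -- 0.
  slide-fibres : ∀ δ h c n (G : ℕ → Word (suc n) → ℕ) →
    pathSum δ (suc h) n (λ s → ∑< (c + descents (suc h) s) (λ i →
        sum (λ k → G (i + (c + slideLength h k s)) (slide h k s))))
      ≡ pathSum δ h (suc n) (λ w → fibreSum h c w (λ e → G e w))
  slide-fibres δ zero c zero G = indicator-cong 1 δ λ _ →
    trans (sum-cong-≗ {c + 0} λ _ → +-identityʳ _) (sym (+-identityʳ _))
  slide-fibres δ (suc h) c zero G = begin
    indicator (2 + h) δ (∑< (c + 0) (λ i → G (i + (c + suc h)) (up ∷ []) + 0))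
      ≡⟨ indicator-cong (2 + h) δ (λ _ → trans (sum-cong-≗ {c + 0} λ _ → +-identityʳ _) (sym (+-identityʳ _))) ⟩
    x
      ≡⟨ +-identityʳ x ⟨
    x + 0
      ≡⟨ cong (x +_) (indicator-0 h δ) ⟨
    x + indicator h δ 0 ∎
    where
    x = indicator (2 + h) δ (∑< (c + 0) (λ i → G (i + (c + suc h)) (up ∷ [])) + 0)
  slide-fibres δ h c (suc n) G = begin
    pathSum δ (suc h) (suc n) (λ s → ∑< (c + descents (suc h) s) (λ i →
        G (i + (c + h)) (up ∷ s)
          + sum (λ k → G (i + (c + slideLength h (Fin.suc k) s)) (slide h (Fin.suc k) s))))
      ≡⟨ pathSum-cong δ (suc h) (suc n) (λ s → ∑-distrib-+ {c + descents (suc h) s}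
        (λ i → G (toℕ i + (c + h)) (up ∷ s)) (λ i → later (toℕ i) s)) ⟩
    pathSum δ (suc h) (suc n) (λ s → ∑< (c + descents (suc h) s) (λ i → G (i + (c + h)) (up ∷ s))
          + ∑< (c + descents (suc h) s) (λ i → 
          sum (λ k → G (i + (c + slideLength h (Fin.suc k) s)) (slide h (Fin.suc k) s))))
      ≡⟨ pathSum-+ δ (suc h) (suc n) (λ s → ∑< (c + descents (suc h) s) (λ i → G (i + (c + h)) (up ∷ s)))
           (λ s → ∑< (c + descents (suc h) s) (λ i → later i s)) ⟩
    X + (pathSum δ (2 + h) n (λ s → ∑< (c + descents (2 + h) s) (λ i → 
          sum (λ k → G (i + (c + slideLength (suc h) k s)) (up ∷ slide (suc h) k s))))
      + V h)
      ≡⟨ cong (λ y → X + (y + V h)) (slide-fibres δ (suc h) c n (λ e s → G e (up ∷ s))) ⟩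
    X + (pathSum δ (suc h) (suc n) (λ w → fibreSum (suc h) c w (λ e → G e (up ∷ w))) + V h)
      ≡⟨ finish h ⟩
    pathSum δ h (2 + n) (λ w → fibreSum h c w (λ e → G e w)) ∎
    where
    later : ℕ → Word (suc n) → ℕ
    later i s = sum (λ k → G (i + (c + slideLength h (Fin.suc k) s)) (slide h (Fin.suc k) s))

    X = pathSum δ (suc h) (suc n) (λ s → ∑< (c + descents (suc h) s) (λ i → G (i + (c + h)) (up ∷ s)))

    V : ℕ → ℕ
    V h = pathSum δ h n (λ s → ∑< (c + suc (descents h s)) (λ i → 
          sum (λ k → G (i + (c + slideLength h (Fin.suc k) (down ∷ s))) (slide h (Fin.suc k) (down ∷ s)))))

    finish : ∀ h → pathSum δ (suc h) (suc n) (λ s → ∑< (c + descents (suc h) s) (λ i → G (i + (c + h)) (up ∷ s)))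
        + (pathSum δ (suc h) (suc n) (λ w → fibreSum (suc h) c w (λ e → G e (up ∷ w))) + V h)
      ≡ pathSum δ h (2 + n) (λ w → fibreSum h c w (λ e → G e w))
    -- At height 0 an up of the result has a third possible origin, the passage below 0 that was
    -- turned. What follows it is a word with a down inserted, so `insertDown-fibres` describes the
    -- rest.
    finish zero = sym (begin
      pathSum δ 1 (suc n) (λ w → fibreSum 0 c (up ∷ w) (λ e → G e (up ∷ w)))
        ≡⟨ trans (pathSum-+ δ 1 (suc n) a (λ w → b w + c′ w)) (cong (A +_) (pathSum-+ δ 1 (suc n) b c′)) ⟩
      A + (B + pathSum δ 1 (suc n) (λ w → ∑< (descents 1 w) (λ j → ∑< (suc c) (λ i → G (i + (c + suc j)) (up ∷ w)))))
        ≡⟨ cong (λ y → A + (B + y)) (insertDown-fibres δ 0 n (λ j w → ∑< (suc c) (λ i → G (i + (c + suc j)) (up ∷ w)))) ⟨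
      A + (B + pathSum δ 0 n (λ w → sum (λ k → ∑< (suc c) (λ i → G (i + (c + suc (downsBefore k w))) (up ∷ insertDown k w)))))
        ≡⟨ cong (λ y → A + (B + y)) (pathSum-cong δ 0 n λ w → trans
             (∑-comm {suc n} {suc c} λ k i → G (toℕ i + (c + suc (downsBefore k w))) (up ∷ insertDown k w))
             (cong (λ m → ∑< m λ i → sum λ k → G (i + (c + suc (downsBefore k w))) (up ∷ insertDown k w)) (+-comm 1 c))) ⟩
      A + (B + V 0) ∎)
      where
      a b c′ : Word (suc n) → ℕ
      a s  = ∑< (c + descents 1 s) (λ i → G (i + (c + 0)) (up ∷ s))
      b w  = fibreSum 1 c w (λ e → G e (up ∷ w))
      c′ w = ∑< (descents 1 w) (λ j → ∑< (suc c) (λ i → G (i + (c + suc j)) (up ∷ w)))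
      A = pathSum δ 1 (suc n) a
      B = pathSum δ 1 (suc n) b
    finish (suc h) = begin
      A + (B + V (suc h))
        ≡⟨ cong (λ y → A + (B + y)) (pathSum-cong δ (suc h) n λ s → trans
             (cong (λ m → ∑< m λ i → sum λ k → G (i + (c + suc (slideLength h k s))) (down ∷ slide h k s)) (+-suc c (descents (suc h) s)))
             (sum-cong-≗ {suc c + descents (suc h) s} λ i → sum-cong-≗ λ k →
               cong (λ m → G (toℕ i + m) (down ∷ slide h k s)) (+-suc c (slideLength h k s)))) ⟩
      A + (B + pathSum δ (suc h) n (λ s → ∑< (suc c + descents (suc h) s) (λ i → sum (λ k → G (i + (suc c + slideLength h k s)) (down ∷ slide h k s)))))
        ≡⟨ cong (λ y → A + (B + y)) (slide-fibres δ h (suc c) n (λ e s → G e (down ∷ s))) ⟩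
      A + (B + C)
        ≡⟨ +-assoc A B C ⟨
      A + B + C
        ≡⟨ cong (_+ C) (pathSum-+ δ (2 + h) (suc n) a b) ⟨
      pathSum δ (suc h) (2 + n) (λ w → fibreSum (suc h) c w (λ e → G e w)) ∎
      where
      a b : Word (suc n) → ℕ
      a s = ∑< (c + descents (2 + h) s) (λ i → G (i + (c + suc h)) (up ∷ s))
      b w = fibreSum (2 + h) c w (λ e → G e (up ∷ w))
      A = pathSum δ (2 + h) (suc n) a
      B = pathSum δ (2 + h) (suc n) b
      C = pathSum δ h (suc n) (λ w → fibreSum h (suc c) w (λ e → G e (down ∷ w)))

-- Closed forms of the fibre sums

module Fibres where

  open LatticePaths
  open import Data.Fin.Base using (toℕ)
  open import Data.Nat.Base
  open import Data.Nat.Properties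
  open import Data.Nat.Tactic.RingSolver using (solve-∀)
  open import Data.Vec.Base using ([]; _∷_)
  open import Relation.Binary.PropositionalEquality
  open import Algebra.Properties.Semiring.Sum +-*-semiring
    using (sum-cong-≗)

  open ≡-Reasoning

  ups downs : ∀ {n} → Word n → ℕ
  ups []           = 0
  ups (up ∷ w)     = suc (ups w)
  ups (down ∷ w)   = ups w
  downs []         = 0
  downs (up ∷ w)   = downs w
  downs (down ∷ w) = suc (downs w)

  ups+downs : ∀ {n} (w : Word n) → ups w + downs w ≡ n
  ups+downs []         = refl
  ups+downs (up ∷ w)   = cong suc (ups+downs w)
  ups+downs (down ∷ w) = trans (+-suc (ups w) (downs w)) (cong suc (ups+downs w))

  Path-height : ∀ {δ n h} {w : Word n} → Path δ h w → h + ups w ≡ δ + downs w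
  Path-height stop = refl
  Path-height {h = h} (climb p) = trans (+-suc h _) (Path-height p)
  Path-height {δ} (descend p) = trans (cong suc (Path-height p)) (sym (+-suc δ _))

  -- The sum of the squared half-lengths of the segments between consecutive visits to
  -- height 0, except for the segment in which the path starts at height h.
  squares : ∀ {n} → ℕ → Word n → ℕ
  squares h       []         = 0
  squares zero    (up ∷ w)   = descents 1 w * descents 1 w + squares 1 w
  squares (suc h) (up ∷ w)   = squares (2 + h) w
  squares zero    (down ∷ w) = 0
  squares (suc h) (down ∷ w) = squares h w

  -- Brings a hypothesis l ≡ r into a ring identity over ℕ, where it cannot be subtracted: the
  -- solver proves L + r ≡ R + l. The inductive steps below have this form.
  cancel : ∀ {l r} L R → l ≡ r → L + r ≡ R + l → L ≡ R
  cancel {l} L R refl eq = +-cancelʳ-≡ l L R eq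

  ∑<-const : ∀ m x → ∑< m (λ _ → x) ≡ m * x
  ∑<-const zero    x = refl
  ∑<-const (suc m) x = cong (x +_) (∑<-const m x)

  ∑<-cong : ∀ m {f g : ℕ → ℕ} → (∀ i → f i ≡ g i) → ∑< m f ≡ ∑< m g
  ∑<-cong m eq = sum-cong-≗ {m} λ i → eq (toℕ i)

  ∑<-arithmetic : ∀ m x → 2 * ∑< m (λ i → i + x) + m ≡ m * m + 2 * (m * x)
  ∑<-arithmetic zero    x = refl
  ∑<-arithmetic (suc m) x = begin
    2 * (x + ∑< m (λ i → suc i + x)) + suc m
      ≡⟨ cong (λ s → 2 * (x + s) + suc m) (∑<-cong m λ i → sym (+-suc i x)) ⟩
    2 * (x + ∑< m (λ i → i + suc x)) + suc m
      ≡⟨ cancel _ _ (∑<-arithmetic m (suc x)) (step (∑< m (λ i → i + suc x)) m x) ⟩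
    suc m * suc m + 2 * (suc m * x) ∎
    where
    step : ∀ s m x → (2 * (x + s) + suc m) + (m * m + 2 * (m * suc x))
                   ≡ (suc m * suc m + 2 * (suc m * x)) + (2 * s + m)
    step = solve-∀

  ∑<-arithmetic₂ : ∀ m n x → 2 * ∑< n (λ j → ∑< m (λ i → i + (x + j))) + 2 * (m * n)
                            ≡ n * (m * m) + m * (n * n + 2 * (n * x))
  ∑<-arithmetic₂ m zero x = trans (cong (2 *_) (*-zeroʳ m)) (sym (*-zeroʳ m))
  ∑<-arithmetic₂ m (suc n) x = begin
    2 * (∑< m (λ i → i + (x + 0)) + ∑< n (λ j → ∑< m (λ i → i + (x + suc j)))) + 2 * (m * suc n)
      ≡⟨ cong₂ (λ s t → 2 * (s + t) + 2 * (m * suc n))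
           (∑<-cong m λ i → cong (i +_) (+-identityʳ x))
           (∑<-cong n λ j → ∑<-cong m λ i → cong (i +_) (+-suc x j)) ⟩
    2 * (s + t) + 2 * (m * suc n)
      ≡⟨ cancel _ _ (cong₂ _+_ (∑<-arithmetic m x) (∑<-arithmetic₂ m n (suc x))) (step s t m n x) ⟩
    suc n * (m * m) + m * (suc n * suc n + 2 * (suc n * x)) ∎
    where
    s = ∑< m (λ i → i + x)
    t = ∑< n (λ j → ∑< m (λ i → i + (suc x + j)))
    step : ∀ s t m n x →
      (2 * (s + t) + 2 * (m * suc n)) + (m * m + 2 * (m * x) + (n * (m * m) + m * (n * n + 2 * (n * suc x))))
        ≡ (suc n * (m * m) + m * (suc n * suc n + 2 * (suc n * x))) + (2 * s + m + (2 * t + 2 * (m * n)))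
    step = solve-∀

  -- A telescoping sum. With W = c + `descents h w`, the potential W (c + h + 1) is unchanged by a
  -- down and grows at each up by the number of pairs of insertions for which that letter is the new
  -- or the turned one. It starts from 0 at c = h = 0 and ends at b (a + 1) for a ups and b downs.
  fibreSum-const : ∀ {δ n h} c x {w : Word n} → Path δ h w →
    fibreSum h c w (λ _ → x) + x * ((c + descents h w) * (c + h + 1))
      ≡ x * ((c + downs w) * (c + 1 + ups w + h))
  fibreSum-const {h = h} c x {[]} stop rewrite descents-[] h = step x c h
    where
    step : ∀ x c h → x * ((c + 0) * (c + h + 1)) ≡ x * ((c + 0) * (c + 1 + 0 + h))
    step = solve-∀
  fibreSum-const {h = zero} c x {up ∷ w} (climb p) =
    trans (cong₂ (λ s t → s + (fibreSum 1 c w (λ _ → x) + t) + x * ((c + 0) * (c + 0 + 1)))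
                 (∑<-const (c + descents 1 w) x)
                 (trans (∑<-cong (descents 1 w) λ _ → ∑<-const (suc c) x) (∑<-const (descents 1 w) (suc c * x))))
          (cancel _ _ (fibreSum-const c x p) (step (fibreSum 1 c w (λ _ → x)) c x (descents 1 w) (ups w) (downs w)))
    where
    step : ∀ f c x d a b →
      ((c + d) * x + (f + d * (suc c * x)) + x * ((c + 0) * (c + 0 + 1))) + x * ((c + b) * (c + 1 + a + 1))
        ≡ x * ((c + b) * (c + 1 + suc a + 0)) + (f + x * ((c + d) * (c + 1 + 1)))
    step = solve-∀
  fibreSum-const {h = suc h} c x {up ∷ w} (climb p) =
    trans (cong (λ s → s + fibreSum (2 + h) c w (λ _ → x) + x * ((c + descents (2 + h) w) * (c + suc h + 1)))
                (∑<-const (c + descents (2 + h) w) x))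
          (cancel _ _ (fibreSum-const c x p) (step (fibreSum (2 + h) c w (λ _ → x)) c x h (descents (2 + h) w) (ups w) (downs w)))
    where
    step : ∀ f c x h d a b →
      ((c + d) * x + f + x * ((c + d) * (c + suc h + 1))) + x * ((c + b) * (c + 1 + a + (2 + h)))
        ≡ x * ((c + b) * (c + 1 + suc a + suc h)) + (f + x * ((c + d) * (c + (2 + h) + 1)))
    step = solve-∀
  fibreSum-const {h = suc h} c x {down ∷ w} (descend p) =
    cancel _ _ (fibreSum-const (suc c) x p) (step (fibreSum h (suc c) w (λ _ → x)) c x h (descents h w) (ups w) (downs w))
    where
    step : ∀ f c x h d a b →
      (f + x * ((c + suc d) * (c + suc h + 1))) + x * ((suc c + b) * (suc c + 1 + a + h))
        ≡ x * ((c + suc b) * (c + 1 + a + suc h)) + (f + x * ((suc c + d) * (suc c + h + 1)))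
    step = solve-∀

  -- Telescoping again, now with the potential P(x, y) = 3x² + x + xy (x + y) - 2xy: twice the sum
  -- is P(B, N) - P(W, m) minus twice the squares, with negative terms moved across. Downs leave W
  -- and m unchanged. An up at positive height raises m by one, and P by twice its cost. An up at
  -- height 0 also raises W by the number d of downs in the segment it opens, and there P grows by 2
  -- d² more than twice the cost; this is the origin of the squares.
  fibreSum-id : ∀ {δ n h} c {w : Word n} → Path δ h w →
    let W = c + descents h w; B = c + downs w; m = c + h; N = c + h + ups w in
    2 * fibreSum h c w (λ e → e) + 2 * squares h w + (3 * (W * W) + W) + m * (W * (W + m)) + 2 * (B * N)
      ≡ (3 * (B * B) + B) + B * (N * (N + B)) + 2 * (m * W)
  fibreSum-id {h = h} c {[]} stop rewrite descents-[] h = step c h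
    where
    step : ∀ c h → 3 * ((c + 0) * (c + 0)) + (c + 0) + (c + h) * ((c + 0) * (c + 0 + (c + h))) + 2 * ((c + 0) * (c + h + 0))
      ≡ (3 * ((c + 0) * (c + 0)) + (c + 0)) + (c + 0) * ((c + h + 0) * (c + h + 0 + (c + 0))) + 2 * ((c + h) * (c + 0))
    step = solve-∀
  fibreSum-id {h = zero} c {up ∷ w} (climb p) = cancel _ _
    (cong₂ _+_ (cong₂ _+_ (∑<-arithmetic (c + descents 1 w) (c + 0)) twice) (fibreSum-id c p))
    (step s (fibreSum 1 c w (λ e → e)) t (squares 1 w) c (descents 1 w) (ups w) (downs w))
    where
    s = ∑< (c + descents 1 w) (λ i → i + (c + 0))
    t = ∑< (descents 1 w) (λ j → ∑< (suc c) (λ i → i + (c + suc j)))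
    twice : 2 * t + 2 * (suc c * descents 1 w)
      ≡ descents 1 w * (suc c * suc c) + suc c * (descents 1 w * descents 1 w + 2 * (descents 1 w * suc c))
    twice = trans (cong (λ y → 2 * y + 2 * (suc c * descents 1 w))
                    (∑<-cong (descents 1 w) λ j → ∑<-cong (suc c) λ i → cong (i +_) (+-suc c j)))
                  (∑<-arithmetic₂ (suc c) (descents 1 w) (suc c))
    step : ∀ s f t q c d a b →
      (2 * (s + (f + t)) + 2 * (d * d + q) + (3 * ((c + 0) * (c + 0)) + (c + 0)) + (c + 0) * ((c + 0) * (c + 0 + (c + 0))) + 2 * ((c + b) * (c + 0 + suc a)))
        + ((c + d) * (c + d) + 2 * ((c + d) * (c + 0)) + (d * (suc c * suc c) + suc c * (d * d + 2 * (d * suc c)))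
          + ((3 * ((c + b) * (c + b)) + (c + b)) + (c + b) * ((c + 1 + a) * (c + 1 + a + (c + b))) + 2 * ((c + 1) * (c + d))))
      ≡ ((3 * ((c + b) * (c + b)) + (c + b)) + (c + b) * ((c + 0 + suc a) * (c + 0 + suc a + (c + b))) + 2 * ((c + 0) * (c + 0)))
        + (2 * s + (c + d) + (2 * t + 2 * (suc c * d))
          + (2 * f + 2 * q + (3 * ((c + d) * (c + d)) + (c + d)) + (c + 1) * ((c + d) * (c + d + (c + 1))) + 2 * ((c + b) * (c + 1 + a))))
    step = solve-∀
  fibreSum-id {h = suc h} c {up ∷ w} (climb p) = cancel _ _
    (cong₂ _+_ (∑<-arithmetic (c + descents (2 + h) w) (c + suc h)) (fibreSum-id c p))
    (step (∑< (c + descents (2 + h) w) (λ i → i + (c + suc h))) (fibreSum (2 + h) c w (λ e → e))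
          (squares (2 + h) w) c h (descents (2 + h) w) (ups w) (downs w))
    where
    step : ∀ s f q c h d a b →
      (2 * (s + f) + 2 * q + (3 * ((c + d) * (c + d)) + (c + d)) + (c + suc h) * ((c + d) * (c + d + (c + suc h))) + 2 * ((c + b) * (c + suc h + suc a)))
        + ((c + d) * (c + d) + 2 * ((c + d) * (c + suc h))
          + ((3 * ((c + b) * (c + b)) + (c + b)) + (c + b) * ((c + (2 + h) + a) * (c + (2 + h) + a + (c + b))) + 2 * ((c + (2 + h)) * (c + d))))
      ≡ ((3 * ((c + b) * (c + b)) + (c + b)) + (c + b) * ((c + suc h + suc a) * (c + suc h + suc a + (c + b))) + 2 * ((c + suc h) * (c + d)))
        + (2 * s + (c + d)
          + (2 * f + 2 * q + (3 * ((c + d) * (c + d)) + (c + d)) + (c + (2 + h)) * ((c + d) * (c + d + (c + (2 + h)))) + 2 * ((c + b) * (c + (2 + h) + a))))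
    step = solve-∀
  fibreSum-id {h = suc h} c {down ∷ w} (descend p) = cancel _ _ (fibreSum-id (suc c) p)
    (step (fibreSum h (suc c) w (λ e → e)) (squares h w) c h (descents h w) (ups w) (downs w))
    where
    step : ∀ f q c h d a b →
      (2 * f + 2 * q + (3 * ((c + suc d) * (c + suc d)) + (c + suc d)) + (c + suc h) * ((c + suc d) * (c + suc d + (c + suc h))) + 2 * ((c + suc b) * (c + suc h + a)))
        + ((3 * ((suc c + b) * (suc c + b)) + (suc c + b)) + (suc c + b) * ((suc c + h + a) * (suc c + h + a + (suc c + b))) + 2 * ((suc c + h) * (suc c + d)))
      ≡ ((3 * ((c + suc b) * (c + suc b)) + (c + suc b)) + (c + suc b) * ((c + suc h + a) * (c + suc h + a + (c + suc b))) + 2 * ((c + suc h) * (c + suc d)))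
        + (2 * f + 2 * q + (3 * ((suc c + d) * (suc c + d)) + (suc c + d)) + (suc c + h) * ((suc c + d) * (suc c + d + (suc c + h))) + 2 * ((suc c + b) * (suc c + h + a)))
    step = solve-∀

-- Ballot numbers and the sum of squared segment lengths

module PathCounts where

  open LatticePaths
  open Fibres
  open import Data.Nat.Base
  open import Data.Nat.Combinatorics using (_C_; nCk≡n!/k![n-k]!; nCk+nC[k+1]≡[n+1]C[k+1]; k![n∸k]!∣n!)
  open import Data.Nat.DivMod using (m/n*n≡m)
  open import Data.Nat.Properties
  open import Data.Nat.Tactic.RingSolver using (solve-∀)
  open import Relation.Binary.PropositionalEquality

  open ≡-Reasoning

  C*factorials : ∀ {n k} → k ≤ n → (n C k) * (k ! * (n ∸ k) !) ≡ n !
  C*factorials {n} {k} k≤n = trans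
    (cong (_* (k ! * (n ∸ k) !)) (nCk≡n!/k![n-k]! k≤n))
    (m/n*n≡m (k![n∸k]!∣n! k≤n))
    where instance _ = k !* (n ∸ k) !≢0

  C-absorb : ∀ a b → suc a * ((a + suc b) C b) ≡ suc b * ((a + suc b) C suc b)
  C-absorb a b = *-cancelʳ-≡ _ _ (b ! * a !) {{b !* a !≢0}} (begin
    suc a * x * (b ! * a !)      ≡⟨ step (suc a) x (b !) (a !) ⟩
    x * (b ! * (suc a) !)        ≡⟨ cong (λ m → x * (b ! * m !)) n∸b ⟨
    x * (b ! * (n ∸ b) !)        ≡⟨ C*factorials (≤-trans (n≤1+n b) (m≤n+m (suc b) a)) ⟩
    n !                          ≡⟨ C*factorials (m≤n+m (suc b) a) ⟨
    y * (suc b ! * (n ∸ suc b)!) ≡⟨ cong (λ m → y * (suc b ! * m !)) (m+n∸n≡m a (suc b)) ⟩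
    y * (suc b ! * a !)          ≡⟨ step′ (suc b) y (b !) (a !) ⟩
    suc b * y * (b ! * a !)      ∎)
    where
    n = a + suc b
    x = n C b
    y = n C suc b
    n∸b : n ∸ b ≡ suc a
    n∸b = trans (cong (_∸ b) (+-suc a b)) (m+n∸n≡m (suc a) b)
    step : ∀ s x f g → s * x * (f * g) ≡ x * (f * (s * g))
    step = solve-∀
    step′ : ∀ s y f g → y * ((s * f) * g) ≡ s * y * (f * g)
    step′ = solve-∀

  -- The binomial coefficient at b - 1; the value 0 at b = 0 gives Pascal's rule for all b.
  prevC : ℕ → ℕ → ℕ
  prevC n zero    = 0
  prevC n (suc b) = n C b

  pascal : ∀ n b → suc n C b ≡ n C b + prevC n b
  pascal n zero    = refl
  pascal n (suc b) = trans (sym (nCk+nC[k+1]≡[n+1]C[k+1] n b)) (+-comm (n C b) _)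

  lowerSum : ℕ → ℕ → ℕ
  lowerSum n zero    = 0
  lowerSum n (suc b) = lowerSum n b + n C b

  lowerSum-pascal : ∀ n b → lowerSum (suc n) (suc b) ≡ lowerSum n (suc b) + lowerSum n b
  lowerSum-pascal n zero    = refl
  lowerSum-pascal n (suc b) = begin
    lowerSum (suc n) (suc b) + suc n C suc b
      ≡⟨ cong₂ _+_ (lowerSum-pascal n b) (pascal n (suc b)) ⟩
    (lowerSum n (suc b) + lowerSum n b) + (n C suc b + n C b)
      ≡⟨ +-interchange (lowerSum n (suc b)) _ _ _ ⟩
    lowerSum n (2 + b) + lowerSum n (suc b) ∎

  -- While a path is read letter by letter: h is its height, l the half-length of the
  -- segment since the last visit to 0, t the sum of the squared half-lengths of all segments.
  Observable : Set
  Observable = (h l t : ℕ) → ℕ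

  reset : ℕ → ℕ → ℕ
  reset zero    l = 0
  reset (suc h) l = l

  -- A down lengthens the current segment from l to l + 1 and so adds (l + 1)² - l² = 2 l + 1 to t.
  -- Arrival at 0 closes the segment.
  advance : Observable → Observable
  advance φ zero    l t = φ 1 l t
  advance φ (suc h) l t = φ (2 + h) l t + φ h (reset h (suc l)) (t + 2 * l + 1)

  evolve : ℕ → Observable → Observable
  evolve zero    φ = φ
  evolve (suc n) φ = advance (evolve n φ)

  _≗₃_ : Observable → Observable → Set
  φ ≗₃ ψ = ∀ h l t → φ h l t ≡ ψ h l t

  advance-cong : ∀ {φ ψ} → φ ≗₃ ψ → advance φ ≗₃ advance ψ
  advance-cong eq zero    l t = eq 1 l t
  advance-cong eq (suc h) l t = cong₂ _+_ (eq (2 + h) l t) (eq h _ _)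

  evolve-cong : ∀ n {φ ψ} → φ ≗₃ ψ → evolve n φ ≗₃ evolve n ψ
  evolve-cong zero    eq = eq
  evolve-cong (suc n) eq = advance-cong (evolve-cong n eq)

  -- Splitting off the last letter instead of the first keeps the start fixed at height 0 with l = t
  -- = 0, so that the recursions below involve the final height alone.
  evolve-snoc : ∀ n φ → evolve (suc n) φ ≗₃ evolve n (advance φ)
  evolve-snoc zero    φ h l t = refl
  evolve-snoc (suc n) φ = advance-cong (evolve-snoc n φ)

  evolve-+ : ∀ n φ ψ h l t →
    evolve n (λ h l t → φ h l t + ψ h l t) h l t ≡ evolve n φ h l t + evolve n ψ h l t
  evolve-+ zero    φ ψ h       l t = refl
  evolve-+ (suc n) φ ψ zero    l t = evolve-+ n φ ψ 1 l t
  evolve-+ (suc n) φ ψ (suc h) l t = trans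
    (cong₂ _+_ (evolve-+ n φ ψ (2 + h) l t) (evolve-+ n φ ψ h _ _))
    (+-interchange (evolve n φ (2 + h) l t) _ _ _)

  evolve-* : ∀ n x φ h l t →
    evolve n (λ h l t → x * φ h l t) h l t ≡ x * evolve n φ h l t
  evolve-* zero    x φ h       l t = refl
  evolve-* (suc n) x φ zero    l t = evolve-* n x φ 1 l t
  evolve-* (suc n) x φ (suc h) l t = trans
    (cong₂ _+_ (evolve-* n x φ (2 + h) l t) (evolve-* n x φ h _ _))
    (sym (*-distribˡ-+ x (evolve n φ (2 + h) l t) _))

  at : ℕ → (ℕ → ℕ → ℕ) → Observable
  at δ f h l t = indicator h δ (f l t)

  advance-at-0 : ∀ f → advance (at 0 f) ≗₃ at 1 (λ l t → f 0 (t + 2 * l + 1))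
  advance-at-0 f zero          l t = refl
  advance-at-0 f (suc zero)    l t = refl
  advance-at-0 f (suc (suc h)) l t = refl

  -- The last letter of a path to δ + 1 is an up from δ, which changes neither l nor t, or a down
  -- from δ + 2, which ends above 0 and so does not reset l.
  advance-at-suc : ∀ δ f → advance (at (suc δ) f)
    ≗₃ (λ h l t → at δ f h l t + at (2 + δ) (λ l t → f (suc l) (t + 2 * l + 1)) h l t)
  advance-at-suc δ f zero          l t = sym (+-identityʳ _)
  advance-at-suc δ f (suc zero)    l t = refl
  advance-at-suc δ f (suc (suc h)) l t = refl

  pathTotal : ℕ → ℕ → (ℕ → ℕ → ℕ) → ℕ
  pathTotal δ n f = evolve n (at δ f) 0 0 0

  pathTotal-0 : ∀ n f → pathTotal 0 (suc n) f ≡ pathTotal 1 n (λ l t → f 0 (t + 2 * l + 1))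
  pathTotal-0 n f = trans (evolve-snoc n (at 0 f) 0 0 0) (evolve-cong n (advance-at-0 f) 0 0 0)

  pathTotal-suc : ∀ δ n f → pathTotal (suc δ) (suc n) f
    ≡ pathTotal δ n f + pathTotal (2 + δ) n (λ l t → f (suc l) (t + 2 * l + 1))
  pathTotal-suc δ n f = trans (evolve-snoc n (at (suc δ) f) 0 0 0)
    (trans (evolve-cong n (advance-at-suc δ f) 0 0 0)
           (evolve-+ n (at δ f) _ 0 0 0))

  pathTotal-+ : ∀ δ n f g → pathTotal δ n (λ l t → f l t + g l t) ≡ pathTotal δ n f + pathTotal δ n g
  pathTotal-+ δ n f g = trans
    (evolve-cong n (λ h l t → indicator-+ h δ (f l t) (g l t)) 0 0 0)
    (evolve-+ n (at δ f) (at δ g) 0 0 0)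

  pathTotal-* : ∀ δ n x f → pathTotal δ n (λ l t → x * f l t) ≡ x * pathTotal δ n f
  pathTotal-* δ n x f = trans
    (evolve-cong n (λ h l t → indicator-* h δ x (f l t)) 0 0 0)
    (evolve-* n x (at δ f) 0 0 0)

  pathTotal-beyond : ∀ δ n f → n < δ → pathTotal δ n f ≡ 0
  pathTotal-beyond (suc δ) zero    f _         = refl
  pathTotal-beyond (suc δ) (suc n) f (s<s n<δ) = trans (pathTotal-suc δ n f)
    (cong₂ _+_ (pathTotal-beyond δ n f n<δ) (pathTotal-beyond (2 + δ) n _ (m≤n⇒m≤1+n (m≤n⇒m≤1+n n<δ))))

  pathTotal-straight : ∀ δ n f → suc n ≡ suc δ + 0 → pathTotal (2 + δ) n f ≡ 0
  pathTotal-straight δ n f eq = pathTotal-beyond (2 + δ) n f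
    (s≤s (≤-trans (≤-reflexive (trans (suc-injective eq) (+-identityʳ δ))) (n≤1+n δ)))

  count lastSum squareSum : ℕ → ℕ → ℕ
  count     δ n = pathTotal δ n (λ _ _ → 1)
  lastSum   δ n = pathTotal δ n (λ l _ → l)
  squareSum δ n = pathTotal δ n (λ _ t → t)

  lastSum-0 : ∀ n → lastSum 0 (suc n) ≡ 0
  lastSum-0 n = trans (pathTotal-0 n (λ l _ → l)) (pathTotal-* 1 n 0 (λ _ _ → 0))

  lastSum-suc : ∀ δ n → lastSum (suc δ) (suc n) ≡ lastSum δ n + (count (2 + δ) n + lastSum (2 + δ) n)
  lastSum-suc δ n = trans (pathTotal-suc δ n (λ l _ → l))
    (cong (lastSum δ n +_) (pathTotal-+ (2 + δ) n (λ _ _ → 1) (λ l _ → l)))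

  squares-step : ∀ δ n → pathTotal δ n (λ l t → t + 2 * l + 1) ≡ squareSum δ n + 2 * lastSum δ n + count δ n
  squares-step δ n = trans (pathTotal-+ δ n (λ l t → t + 2 * l) (λ _ _ → 1)) (cong (_+ count δ n)
    (trans (pathTotal-+ δ n (λ _ t → t) (λ l _ → 2 * l)) (cong (squareSum δ n +_) (pathTotal-* δ n 2 (λ l _ → l)))))

  squareSum-0 : ∀ n → squareSum 0 (suc n) ≡ squareSum 1 n + 2 * lastSum 1 n + count 1 n
  squareSum-0 n = trans (pathTotal-0 n (λ _ t → t)) (squares-step 1 n)

  squareSum-suc : ∀ δ n → squareSum (suc δ) (suc n)
    ≡ squareSum δ n + (squareSum (2 + δ) n + 2 * lastSum (2 + δ) n + count (2 + δ) n)
  squareSum-suc δ n = trans (pathTotal-suc δ n (λ _ t → t)) (cong (squareSum δ n +_) (squares-step (2 + δ) n))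

  size-0 : ∀ b → 2 * suc b ≡ suc (1 + 2 * b)
  size-0 = solve-∀

  size-suc : ∀ δ b → suc δ + 2 * suc b ≡ suc (2 + δ + 2 * b)
  size-suc = solve-∀

  -- The ballot numbers of the reflection principle: the recursion over the last letter is Pascal's
  -- rule for both coefficients. At δ = 0 only the step from height 1 exists, and the symmetry C(n,
  -- b) = C(n, b + 1) for n = 2 b + 1 makes up for the other.
  count-closed : ∀ n δ b → n ≡ δ + 2 * b → count δ n + prevC n b ≡ n C b
  count-closed zero zero zero eq = refl
  count-closed (suc n) (suc δ) zero eq = begin
    count (suc δ) (suc n) + 0
      ≡⟨ +-identityʳ _ ⟩
    count (suc δ) (suc n)
      ≡⟨ pathTotal-suc δ n _ ⟩
    count δ n + count (2 + δ) n
      ≡⟨ cong₂ _+_ (trans (sym (+-identityʳ _)) (count-closed n δ 0 (suc-injective eq)))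
           (pathTotal-straight δ n _ eq) ⟩
    1 ∎
  count-closed (suc n) zero (suc b) eq with suc-injective (trans eq (size-0 b))
  ... | refl = begin
    count 0 (suc n) + suc n C b
      ≡⟨ cong₂ _+_ (pathTotal-0 n _) (pascal n b) ⟩
    count 1 n + (n C b + prevC n b)
      ≡⟨ x∙yz≈y∙xz (count 1 n) (n C b) _ ⟩
    n C b + (count 1 n + prevC n b)
      ≡⟨ cong (n C b +_) (count-closed n 1 b refl) ⟩
    n C b + n C b
      ≡⟨ cong (_+ n C b) middle ⟩
    n C suc b + n C b
      ≡⟨ pascal n (suc b) ⟨
    suc n C suc b ∎
    where
    open import Algebra.Properties.CommutativeSemigroup +-commutativeSemigroup using (x∙yz≈y∙xz)
    middle : n C b ≡ n C suc b
    middle = *-cancelˡ-≡ _ _ (suc b)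
      (subst (λ m → suc b * (m C b) ≡ suc b * (m C suc b)) (size b) (C-absorb b b))
      where
      size : ∀ b → b + suc b ≡ 1 + 2 * b
      size = solve-∀
  count-closed (suc n) (suc δ) (suc b) eq with suc-injective (trans eq (size-suc δ b))
  ... | n≡ = begin
    count (suc δ) (suc n) + suc n C b
      ≡⟨ cong₂ _+_ (pathTotal-suc δ n _) (pascal n b) ⟩
    (count δ n + count (2 + δ) n) + (n C b + prevC n b)
      ≡⟨ +-interchange (count δ n) _ _ _ ⟩
    (count δ n + n C b) + (count (2 + δ) n + prevC n b)
      ≡⟨ cong₂ _+_ (count-closed n δ (suc b) (suc-injective eq)) (count-closed n (2 + δ) b n≡) ⟩
    n C suc b + n C b
      ≡⟨ pascal n (suc b) ⟨
    suc n C suc b ∎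

  -- The product form of the ballot numbers, by absorption. Through it the number of words
  -- disappears from the average cost of a column, leaving the denominator b C(a + b, b) of H.
  count-binomial : ∀ n δ b → n ≡ δ + 2 * b → suc (δ + b) * count δ n ≡ suc δ * (n C b)
  count-binomial n δ b refl = cancel _ _ (sym (absorb b)) (begin
    suc (δ + b) * count δ n + suc (δ + b) * prevC n b
      ≡⟨ *-distribˡ-+ (suc (δ + b)) (count δ n) _ ⟨
    suc (δ + b) * (count δ n + prevC n b)
      ≡⟨ cong (suc (δ + b) *_) (count-closed n δ b refl) ⟩
    suc (δ + b) * (n C b)
      ≡⟨ *-distribʳ-+ (n C b) (suc δ) b ⟩
    suc δ * (n C b) + b * (n C b) ∎)
    where
    absorb : ∀ b → suc (δ + b) * prevC (δ + 2 * b) b ≡ b * ((δ + 2 * b) C b)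
    absorb zero    = *-zeroʳ (suc (δ + 0))
    absorb (suc b) = subst (λ m → suc (δ + suc b) * (m C b) ≡ suc b * (m C suc b)) (size δ b) (C-absorb (δ + suc b) b)
      where
      size : ∀ δ b → δ + suc b + suc b ≡ δ + 2 * suc b
      size = solve-∀

  -- Of the b downs, b - l precede the last visit to 0. For each half-length m, unrestricted paths
  -- from 0 to 0 are m + 1 times as many as those that stay nonnegative, so the sum of b - l + 1
  -- over the paths to δ counts all unrestricted ones, which are C(n, b) many. The proof itself is
  -- an induction over the last letter.
  lastSum-closed : ∀ n δ b → n ≡ δ + 2 * b → lastSum δ n + (n C b) ≡ suc b * count δ n
  lastSum-closed zero zero zero eq = refl
  lastSum-closed (suc n) (suc δ) zero eq = begin
    lastSum (suc δ) (suc n) + 1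
      ≡⟨ cong (_+ 1) (trans (lastSum-suc δ n) (cong (lastSum δ n +_) (cong₂ _+_ (pathTotal-straight δ n _ eq) (pathTotal-straight δ n _ eq)))) ⟩
    lastSum δ n + 0 + 1
      ≡⟨ cong (_+ 1) (+-identityʳ _) ⟩
    lastSum δ n + 1
      ≡⟨ lastSum-closed n δ 0 (suc-injective eq) ⟩
    1 * count δ n
      ≡⟨ cong (1 *_) (sym (trans (pathTotal-suc δ n _) (trans (cong (count δ n +_) (pathTotal-straight δ n _ eq)) (+-identityʳ _)))) ⟩
    1 * count (suc δ) (suc n) ∎
  lastSum-closed (suc n) zero (suc b) eq = begin
    lastSum 0 (suc n) + (suc n C suc b)
      ≡⟨ cong (_+ (suc n C suc b)) (lastSum-0 n) ⟩
    suc n C suc b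
      ≡⟨ *-identityˡ _ ⟨
    1 * (suc n C suc b)
      ≡⟨ count-binomial (suc n) 0 (suc b) eq ⟨
    suc (suc b) * count 0 (suc n) ∎
  lastSum-closed (suc n) (suc δ) (suc b) eq = begin
    lastSum (suc δ) (suc n) + (suc n C suc b)
      ≡⟨ cong₂ _+_ (lastSum-suc δ n) (pascal n (suc b)) ⟩
    (lastSum δ n + (c′ + lastSum (2 + δ) n)) + ((n C suc b) + (n C b))
      ≡⟨ rearrange (lastSum δ n) c′ (lastSum (2 + δ) n) (n C suc b) (n C b) ⟩
    (lastSum δ n + (n C suc b)) + (c′ + (lastSum (2 + δ) n + (n C b)))
      ≡⟨ cong₂ (λ x y → x + (c′ + y)) (lastSum-closed n δ (suc b) (suc-injective eq))
           (lastSum-closed n (2 + δ) b (suc-injective (trans eq (size-suc δ b)))) ⟩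
    suc (suc b) * count δ n + suc (suc b) * c′
      ≡⟨ *-distribˡ-+ (2 + b) (count δ n) c′ ⟨
    suc (suc b) * (count δ n + c′)
      ≡⟨ cong (suc (suc b) *_) (pathTotal-suc δ n _) ⟨
    suc (suc b) * count (suc δ) (suc n) ∎
    where
    c′ = count (2 + δ) n
    rearrange : ∀ r c r′ x y → (r + (c + r′)) + (x + y) ≡ (r + x) + (c + (r′ + y))
    rearrange = solve-∀

  -- A final down adds 2 l + 1, so `lastSum-closed` contributes C(n, b) at each step, which Pascal's
  -- rule accumulates into `lowerSum`. The factor δ + 1 fits: δ + 1 times the sum up to C(n, b),
  -- plus δ + 3 times the sum without it, plus that extra C(n, b), is δ + 2 times the sum for n + 1.
  squareSum-closed : ∀ n δ b → n ≡ δ + 2 * b →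
    squareSum δ n + 2 * (suc δ * lowerSum n b) ≡ b * (b + 2) * count δ n
  squareSum-closed zero zero zero eq = refl
  squareSum-closed (suc n) (suc δ) zero eq = begin
    squareSum (suc δ) (suc n) + 2 * (suc (suc δ) * 0)
      ≡⟨ cong₂ _+_ (trans (squareSum-suc δ n) (cong (squareSum δ n +_)
           (cong₂ _+_ (cong₂ _+_ (pathTotal-straight δ n _ eq) (cong (2 *_) (pathTotal-straight δ n _ eq)))
               (pathTotal-straight δ n _ eq)))) (cong (2 *_) (*-zeroʳ (suc δ))) ⟩
    squareSum δ n + 0 + 0
      ≡⟨ +-assoc (squareSum δ n) 0 0 ⟩
    squareSum δ n + 0
      ≡⟨ cong (λ x → squareSum δ n + 2 * x) (*-zeroʳ (suc δ)) ⟨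
    squareSum δ n + 2 * (suc δ * 0)
      ≡⟨ squareSum-closed n δ 0 (suc-injective eq) ⟩
    0 ∎
  squareSum-closed (suc n) zero (suc b) eq = trans
    (cong₂ (λ x y → x + 2 * (1 * y)) (squareSum-0 n) (lowerSum-pascal n b))
    (trans
      (cancel _ _ (cong₂ _+_ (squareSum-closed n 1 b n≡) (cong (2 *_) (lastSum-closed n 1 b n≡)))
        (step (squareSum 1 n) (lastSum 1 n) (count 1 n) b (lowerSum n b) (n C b)))
      (cong (suc b * (suc b + 2) *_) (sym (pathTotal-0 n _))))
    where
    n≡ : n ≡ 1 + 2 * b
    n≡ = suc-injective (trans eq (size-0 b))
    step : ∀ q r c b σ x →
      (q + 2 * r + c + 2 * (1 * ((σ + x) + σ))) + (b * (b + 2) * c + 2 * (suc b * c))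
        ≡ suc b * (suc b + 2) * c + ((q + 2 * (2 * σ)) + 2 * (r + x))
    step = solve-∀
  squareSum-closed (suc n) (suc δ) (suc b) eq = trans
    (cong₂ (λ x y → x + 2 * (suc (suc δ) * y)) (squareSum-suc δ n) (lowerSum-pascal n b))
    (trans
      (cancel _ _ (cong₂ _+_ (squareSum-closed n δ (suc b) (suc-injective eq))
                     (cong₂ _+_ (squareSum-closed n (2 + δ) b n≡) (cong (2 *_) (lastSum-closed n (2 + δ) b n≡))))
        (step (squareSum δ n) (count δ n) (squareSum (2 + δ) n) (lastSum (2 + δ) n) (count (2 + δ) n) b δ (lowerSum n b) (n C b)))
      (cong (suc b * (suc b + 2) *_) (sym (pathTotal-suc δ n _))))
    where
    n≡ : n ≡ 2 + δ + 2 * b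
    n≡ = suc-injective (trans eq (size-suc δ b))
    step : ∀ q₀ c₀ q r c b δ σ x →
      (q₀ + (q + 2 * r + c) + 2 * (suc (suc δ) * ((σ + x) + σ)))
          + (suc b * (suc b + 2) * c₀ + (b * (b + 2) * c + 2 * (suc b * c)))
        ≡ suc b * (suc b + 2) * (c₀ + c)
          + ((q₀ + 2 * (suc δ * (σ + x))) + ((q + 2 * (suc (2 + δ) * σ)) + 2 * (r + x)))
    step = solve-∀

  pathSum-1 : ∀ δ h n l t → pathSum δ h n (λ _ → 1) ≡ evolve n (at δ (λ _ _ → 1)) h l t
  pathSum-1 δ h       zero    l t = refl
  pathSum-1 δ zero    (suc n) l t = pathSum-1 δ 1 n l t
  pathSum-1 δ (suc h) (suc n) l t = cong₂ _+_ (pathSum-1 δ (2 + h) n l t) (pathSum-1 δ h n _ _)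

  -- `squares` looks ahead to the end of a segment, `evolve` looks back. Inside a segment with l
  -- downs read and d to come, t already contains l², and (l + d)² leaves 2 l d + d² to be added.
  pathSum-squares₀ : ∀ δ n t → pathSum δ 0 n (λ w → t + squares 0 w) ≡ evolve n (at δ (λ _ t → t)) 0 0 t
  pathSum-squares₊ : ∀ δ h n l t →
    pathSum δ (suc h) n (λ w → t + (2 * (l * descents (suc h) w) + descents (suc h) w * descents (suc h) w) + squares (suc h) w)
      ≡ evolve n (at δ (λ _ t → t)) (suc h) l t

  pathSum-squares₀ δ zero    t = cong (indicator 0 δ) (+-identityʳ t)
  pathSum-squares₀ δ (suc n) t = trans
    (pathSum-cong δ 1 n λ w → sym (+-assoc t (descents 1 w * descents 1 w) (squares 1 w)))
    (pathSum-squares₊ δ 0 n 0 t)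

  pathSum-squares₊ δ h zero l t = cong (indicator (suc h) δ) (step t l)
    where
    step : ∀ t l → t + (2 * (l * 0) + 0 * 0) + 0 ≡ t
    step = solve-∀
  pathSum-squares₊ δ zero (suc n) l t = cong₂ _+_ (pathSum-squares₊ δ 1 n l t)
    (trans (pathSum-cong δ 0 n λ w → cong (_+ squares 0 w) (step t l)) (pathSum-squares₀ δ n (t + 2 * l + 1)))
    where
    step : ∀ t l → t + (2 * (l * 1) + 1 * 1) ≡ t + 2 * l + 1
    step = solve-∀
  pathSum-squares₊ δ (suc h) (suc n) l t = cong₂ _+_ (pathSum-squares₊ δ (2 + h) n l t)
    (trans (pathSum-cong δ (suc h) n λ w → cong (_+ squares (suc h) w) (step t l (descents (suc h) w)))
           (pathSum-squares₊ δ h n (suc l) (t + 2 * l + 1)))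
    where
    step : ∀ t l d → t + (2 * (l * suc d) + suc d * suc d) ≡ t + 2 * l + 1 + (2 * (suc l * d) + d * d)
    step = solve-∀

-- Uniformity, the hook length formula, and the cost of a column

module Outcomes where

  open LatticePaths
  open Fibres
  open PathCounts
  open import Data.Fin.Base as Fin using (Fin; toℕ)
  open import Data.Nat.Base
  open import Data.Nat.Properties
  open import Data.Nat.Tactic.RingSolver using (solve-∀)
  open import Data.Product.Base using (_×_; _,_)
  open import Data.Vec.Base using ([]; _∷_; replicate)
  open import Relation.Binary.PropositionalEquality
  open import Algebra.Properties.Semiring.Sum +-*-semiring
    using (sum; sum-cong-≗; ∑-distrib-+)

  open ≡-Reasoning

  -- δ + 2 b in a form where `len δ (suc b)` reduces to `2 + len δ b`, as the types of the words
  -- before and after a column require.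
  len : ℕ → ℕ → ℕ
  len δ zero    = δ
  len δ (suc b) = 2 + len δ b

  len≡ : ∀ δ b → len δ b ≡ δ + 2 * b
  len≡ δ zero    = sym (+-identityʳ δ)
  len≡ δ (suc b) = trans (cong (2 +_) (len≡ δ b)) (step δ b)
    where
    step : ∀ δ b → 2 + (δ + 2 * b) ≡ δ + 2 * suc b
    step = solve-∀

  Path-counts : ∀ {δ b n} {w : Word n} → n ≡ δ + 2 * b → Path δ 0 w → ups w ≡ δ + b × downs w ≡ b
  Path-counts {δ} {b} {n} {w} n≡ p = trans (Path-height p) (cong (δ +_) downs≡) , downs≡
    where
    downs≡ : downs w ≡ b
    downs≡ = *-cancelˡ-≡ _ _ 2 (+-cancelˡ-≡ δ _ _ (begin
      δ + 2 * downs w       ≡⟨ step δ (downs w) ⟩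
      δ + downs w + downs w ≡⟨ cong (_+ downs w) (Path-height p) ⟨
      ups w + downs w       ≡⟨ ups+downs w ⟩
      n                     ≡⟨ n≡ ⟩
      δ + 2 * b             ∎))
      where
      step : ∀ δ d → δ + 2 * d ≡ δ + d + d
      step = solve-∀

  columnSum : ∀ {n} → (ℕ → Word (2 + n) → ℕ) → Word n → ℕ
  columnSum G w = sum λ k₁ → sum λ k₂ →
    G (downsBefore k₁ w + slideLength 0 k₂ (insertDown k₁ w)) (slide 0 k₂ (insertDown k₁ w))

  column-fibres : ∀ δ n (G : ℕ → Word (2 + n) → ℕ) →
    pathSum δ 0 n (columnSum G) ≡ pathSum δ 0 (2 + n) (λ w → fibreSum 0 0 w (λ e → G e w))
  column-fibres δ n G = trans
    (insertDown-fibres δ 0 n (λ i s → sum λ k → G (i + slideLength 0 k s) (slide 0 k s)))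
    (slide-fibres δ 0 0 (suc n) G)

  column-uniform : ∀ δ b (g : Word (len δ (suc b)) → ℕ) →
    pathSum δ 0 (len δ b) (columnSum (λ _ → g)) ≡ suc b * (2 + δ + b) * pathSum δ 0 (len δ (suc b)) g
  column-uniform δ b g = begin
    pathSum δ 0 n (columnSum (λ _ → g))
      ≡⟨ column-fibres δ n (λ _ → g) ⟩
    pathSum δ 0 (2 + n) (λ w → fibreSum 0 0 w (λ _ → g w))
      ≡⟨ pathSum-cong-Path δ 0 (2 + n) fibre ⟩
    pathSum δ 0 (2 + n) (λ w → suc b * (2 + δ + b) * g w)
      ≡⟨ pathSum-* δ 0 (2 + n) (suc b * (2 + δ + b)) g ⟩
    suc b * (2 + δ + b) * pathSum δ 0 (2 + n) g ∎
    where
    n = len δ b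
    fibre : ∀ w → Path δ 0 w → fibreSum 0 0 w (λ _ → g w) ≡ suc b * (2 + δ + b) * g w
    fibre w p with Path-counts {b = suc b} (len≡ δ (suc b)) p
    ... | ups≡ , downs≡ = begin
      fibreSum 0 0 w (λ _ → g w)
        ≡⟨ +-identityʳ _ ⟨
      fibreSum 0 0 w (λ _ → g w) + 0
        ≡⟨ cong (fibreSum 0 0 w (λ _ → g w) +_) (*-zeroʳ (g w)) ⟨
      fibreSum 0 0 w (λ _ → g w) + g w * 0
        ≡⟨ fibreSum-const 0 (g w) p ⟩
      g w * (downs w * (1 + ups w + 0))
        ≡⟨ cong₂ (λ x y → g w * (x * (1 + y + 0))) downs≡ ups≡ ⟩
      g w * (suc b * (1 + (δ + suc b) + 0))
        ≡⟨ step (g w) b δ ⟩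
      suc b * (2 + δ + b) * g w ∎
      where
      step : ∀ x b δ → x * (suc b * (1 + (δ + suc b) + 0)) ≡ suc b * (2 + δ + b) * x
      step = solve-∀

  columnCost : ℕ → ℕ → ℕ
  columnCost δ b = pathSum δ 0 (len δ b) (columnSum (λ e _ → e))

  -- Each of the f words has B (A + 1) pairs of insertions in its fibre. Division by 2 B (A + 1) f
  -- gives the average (A + B - 3) / 2 plus 2 (δ + 1) `lowerSum n B` / (B (A + 1) f), and by
  -- `count-binomial` the last fraction is 2 H.
  columnCost-closed : ∀ δ b → let B = suc b; A = δ + suc b; n = len δ (suc b); f = count δ n in
    2 * columnCost δ b + 3 * (B * suc A * f) ≡ B * suc A * f * (A + B) + 4 * (suc δ * lowerSum n B)
  columnCost-closed δ b = cancel _ _ (cong₂ _+_ total (cong (2 *_) (sym (squareSum-closed n δ B (len≡ δ B)))))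
    (step K Q f A B (suc δ * lowerSum n B))
    where
    n = len δ (suc b)
    B = suc b
    A = δ + suc b
    f = count δ n
    Q = squareSum δ n
    K = columnCost δ b
    total : 2 * K + 2 * Q + 2 * (B * A) * f ≡ ((3 * (B * B) + B) + B * (A * (A + B))) * f
    total = begin
      2 * K + 2 * Q + 2 * (B * A) * f
        ≡⟨ cong₂ _+_ (cong₂ _+_ (cong (2 *_) (column-fibres δ (len δ b) (λ e _ → e)))
             (cong (2 *_) (sym (pathSum-squares₀ δ n 0)))) (cong (2 * (B * A) *_) (sym (pathSum-1 δ 0 n 0 0))) ⟩
      2 * pathSum δ 0 n (λ w → fibreSum 0 0 w (λ e → e)) + 2 * pathSum δ 0 n (squares 0) + 2 * (B * A) * pathSum δ 0 n (λ _ → 1)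
        ≡⟨ cong₂ _+_ (cong₂ _+_ (pathSum-* δ 0 n 2 (λ w → fibreSum 0 0 w (λ e → e))) (pathSum-* δ 0 n 2 (squares 0)))
             (pathSum-* δ 0 n (2 * (B * A)) (λ _ → 1)) ⟨
      pathSum δ 0 n (λ w → 2 * fibreSum 0 0 w (λ e → e)) + pathSum δ 0 n (λ w → 2 * squares 0 w) + pathSum δ 0 n (λ _ → 2 * (B * A) * 1)
        ≡⟨ cong (_+ pathSum δ 0 n (λ _ → 2 * (B * A) * 1)) (pathSum-+ δ 0 n (λ w → 2 * fibreSum 0 0 w (λ e → e)) (λ w → 2 * squares 0 w)) ⟨
      pathSum δ 0 n (λ w → 2 * fibreSum 0 0 w (λ e → e) + 2 * squares 0 w) + pathSum δ 0 n (λ _ → 2 * (B * A) * 1)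
        ≡⟨ pathSum-+ δ 0 n (λ w → 2 * fibreSum 0 0 w (λ e → e) + 2 * squares 0 w) (λ _ → 2 * (B * A) * 1) ⟨
      pathSum δ 0 n (λ w → 2 * fibreSum 0 0 w (λ e → e) + 2 * squares 0 w + 2 * (B * A) * 1)
        ≡⟨ pathSum-cong-Path δ 0 n fibre ⟩
      pathSum δ 0 n (λ _ → ((3 * (B * B) + B) + B * (A * (A + B))) * 1)
        ≡⟨ pathSum-* δ 0 n ((3 * (B * B) + B) + B * (A * (A + B))) (λ _ → 1) ⟩
      ((3 * (B * B) + B) + B * (A * (A + B))) * pathSum δ 0 n (λ _ → 1)
        ≡⟨ cong (((3 * (B * B) + B) + B * (A * (A + B))) *_) (pathSum-1 δ 0 n 0 0) ⟩
      ((3 * (B * B) + B) + B * (A * (A + B))) * f ∎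
      where
      fibre : ∀ w → Path δ 0 w → 2 * fibreSum 0 0 w (λ e → e) + 2 * squares 0 w + 2 * (B * A) * 1
        ≡ ((3 * (B * B) + B) + B * (A * (A + B))) * 1
      fibre w p with Path-counts {b = suc b} (len≡ δ (suc b)) p
      ... | ups≡ , downs≡ = trans (simplify (fibreSum 0 0 w (λ e → e)) (squares 0 w) A B)
        (trans (subst₂ (λ A B → 2 * fibreSum 0 0 w (λ e → e) + 2 * squares 0 w + 0 + 0 + 2 * (B * A)
                          ≡ (3 * (B * B) + B) + B * (A * (A + B)) + 0) ups≡ downs≡ (fibreSum-id 0 p))
               (simplify′ A B))
        where
        simplify : ∀ x q A B → 2 * x + 2 * q + 2 * (B * A) * 1 ≡ 2 * x + 2 * q + 0 + 0 + 2 * (B * A)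
        simplify = solve-∀
        simplify′ : ∀ A B → (3 * (B * B) + B) + B * (A * (A + B)) + 0 ≡ ((3 * (B * B) + B) + B * (A * (A + B))) * 1
        simplify′ = solve-∀
    step : ∀ K Q f A B s →
      (2 * K + 3 * (B * suc A * f)) + (((3 * (B * B) + B) + B * (A * (A + B))) * f + 2 * (Q + 2 * s))
        ≡ (B * suc A * f * (A + B) + 4 * s) + ((2 * K + 2 * Q + 2 * (B * A) * f) + 2 * (B * (B + 2) * f))
    step = solve-∀

  -- Summation over all values inserted, in the order of the algorithm; e is the number of
  -- exchanges and w the resulting tableau, as a lattice word.
  outcomes : ∀ δ b → (ℕ → Word (len δ b) → ℕ) → ℕ
  outcomes δ       (suc b) G = outcomes δ b (λ e w → columnSum (λ e′ → G (e + e′)) w)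
  outcomes zero    zero    G = G 0 []
  outcomes (suc δ) zero    G = outcomes δ zero (λ e w → sum λ k → G (e + slideLength 0 k w) (slide 0 k w))

  columnSum-cong : ∀ {n} {F G : ℕ → Word (2 + n) → ℕ} → (∀ e v → F e v ≡ G e v) →
                   ∀ w → columnSum F w ≡ columnSum G w
  columnSum-cong {n} eq w = sum-cong-≗ {suc n} λ k₁ → sum-cong-≗ {2 + n} λ k₂ →
    eq (downsBefore k₁ w + slideLength 0 k₂ (insertDown k₁ w)) (slide 0 k₂ (insertDown k₁ w))

  outcomes-cong : ∀ δ b {F G : ℕ → Word (len δ b) → ℕ} → (∀ e w → F e w ≡ G e w) → outcomes δ b F ≡ outcomes δ b G
  outcomes-cong δ       (suc b) eq = outcomes-cong δ b λ e → columnSum-cong λ e′ → eq (e + e′)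
  outcomes-cong zero    zero    eq = eq 0 []
  outcomes-cong (suc δ) zero    eq = outcomes-cong δ zero λ e w → sum-cong-≗ {suc δ} λ k → eq (e + slideLength 0 k w) (slide 0 k w)

  columnSum-+ : ∀ {n} (F G : ℕ → Word (2 + n) → ℕ) w →
    columnSum (λ e v → F e v + G e v) w ≡ columnSum F w + columnSum G w
  columnSum-+ {n} F G w = trans
    (sum-cong-≗ λ k₁ → ∑-distrib-+ {2 + n} (λ k₂ → f F k₁ k₂) (λ k₂ → f G k₁ k₂))
    (∑-distrib-+ {suc n} (λ k₁ → sum (f F k₁)) (λ k₁ → sum (f G k₁)))
    where
    f : (ℕ → Word (2 + n) → ℕ) → Fin (suc n) → Fin (2 + n) → ℕ
    f G k₁ k₂ = G (downsBefore k₁ w + slideLength 0 k₂ (insertDown k₁ w)) (slide 0 k₂ (insertDown k₁ w))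

  outcomes-+ : ∀ δ b (F G : ℕ → Word (len δ b) → ℕ) →
    outcomes δ b (λ e w → F e w + G e w) ≡ outcomes δ b F + outcomes δ b G
  outcomes-+ δ       (suc b) F G = trans
    (outcomes-cong δ b λ e → columnSum-+ (λ e′ → F (e + e′)) (λ e′ → G (e + e′)))
    (outcomes-+ δ b _ _)
  outcomes-+ zero    zero    F G = refl
  outcomes-+ (suc δ) zero    F G = trans
    (outcomes-cong δ zero λ e w → ∑-distrib-+ (λ k → F (e + slideLength 0 k w) (slide 0 k w)) (λ k → G (e + slideLength 0 k w) (slide 0 k w)))
    (outcomes-+ δ zero _ _)

  sum-const : ∀ n x → sum {n} (λ _ → x) ≡ n * x
  sum-const = ∑<-const

  columnSum-const : ∀ {n} x (w : Word n) → columnSum (λ _ _ → x) w ≡ (1 + n) * ((2 + n) * x)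
  columnSum-const {n} x w = trans (sum-cong-≗ {suc n} λ _ → sum-const (2 + n) x) (sum-const (suc n) _)

  outcomes-* : ∀ δ b x (G : ℕ → Word (len δ b) → ℕ) →
    outcomes δ b (λ e w → x * G e w) ≡ x * outcomes δ b G
  outcomes-* δ b zero    G = zeros δ b
    where
    zeros : ∀ δ b → outcomes δ b (λ _ _ → 0) ≡ 0
    zeros δ       (suc b) = trans (outcomes-cong δ b λ e w → trans (columnSum-const 0 w) (step (len δ b))) (zeros δ b)
      where
      step : ∀ n → (1 + n) * ((2 + n) * 0) ≡ 0
      step = solve-∀
    zeros zero    zero    = refl
    zeros (suc δ) zero    = trans (outcomes-cong δ zero λ e w → trans (sum-const (suc δ) 0) (*-zeroʳ (suc δ))) (zeros δ zero)
  outcomes-* δ b (suc x) G = trans (outcomes-+ δ b G (λ e w → x * G e w))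
    (cong (outcomes δ b G +_) (outcomes-* δ b x G))

  -- For b = 0: a single row has only one word.
  pathSum-straight : ∀ δ h n (g : Word n → ℕ) → h + n ≡ δ → pathSum δ h n g ≡ g (replicate n up)
  pathSum-straight δ h zero g eq rewrite sym eq | +-identityʳ h = here h
    where
    here : ∀ h {x} → indicator h h x ≡ x
    here zero    = refl
    here (suc h) = here h
  pathSum-straight δ zero (suc n) g eq = pathSum-straight δ 1 n _ eq
  pathSum-straight δ (suc h) (suc n) g eq = trans
    (cong₂ _+_ (pathSum-straight δ (2 + h) n _ (trans (cong suc (sym (+-suc h n))) eq))
               (short h n (≤-trans (s≤s (+-monoʳ-≤ h (n≤1+n n))) (≤-reflexive eq))))
    (+-identityʳ _)
    where
    short : ∀ h n {F : Word n → ℕ} → h + n < δ → pathSum δ h n F ≡ 0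
    short h zero {F} lt = beyond h δ (subst (_< δ) (+-identityʳ h) lt)
      where
      beyond : ∀ h δ {x} → h < δ → indicator h δ x ≡ 0
      beyond zero    (suc δ) _        = refl
      beyond (suc h) (suc δ) (s<s lt) = beyond h δ lt
    short zero    (suc n) lt = short 1 n lt
    short (suc h) (suc n) lt = cong₂ _+_
      (short (2 + h) n (≤-trans (≤-reflexive (cong (2 +_) (sym (+-suc h n)))) lt))
      (short h n (≤-trans (s≤s (≤-trans (+-monoʳ-≤ h (n≤1+n n)) (n≤1+n _))) lt))

  slide-ups : ∀ h {n} (k : Fin (suc n)) → slide h k (replicate n up) ≡ replicate (suc n) up
  slide-ups h         Fin.zero    = refl
  slide-ups h {suc n} (Fin.suc k) = cong (up ∷_) (slide-ups (suc h) k)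

  slideLength-ups : ∀ h {n} (k : Fin (suc n)) → slideLength h k (replicate n up) ≡ h + toℕ k
  slideLength-ups h         Fin.zero    = sym (+-identityʳ h)
  slideLength-ups h {suc n} (Fin.suc k) = trans (slideLength-ups (suc h) k) (sym (+-suc h (toℕ k)))

  -- The product of the hook lengths of the shape (δ + b, b): a single row of δ cells has δ !, and a
  -- new first column adds the hooks b + 1 and δ + b + 2.
  weight : ℕ → ℕ → ℕ
  weight δ zero    = δ !
  weight δ (suc b) = suc b * (2 + δ + b) * weight δ b

  -- Each column multiplies the multiplicities of all ballot words by the same number, so they stay
  -- equal.
  outcomes-uniform : ∀ δ b (g : Word (len δ b) → ℕ) →
    outcomes δ b (λ _ → g) ≡ weight δ b * pathSum δ 0 (len δ b) g
  outcomes-uniform δ (suc b) g = trans (outcomes-uniform δ b (columnSum (λ _ → g)))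
    (trans (cong (weight δ b *_) (column-uniform δ b g)) (step (weight δ b) (suc b * (2 + δ + b)) _))
    where
    step : ∀ x y z → x * (y * z) ≡ y * x * z
    step = solve-∀
  outcomes-uniform zero zero g = sym (+-identityʳ _)
  outcomes-uniform (suc δ) zero g = begin
    outcomes δ zero (λ e w → sum λ k → g (slide 0 k w))
      ≡⟨ outcomes-uniform δ zero (λ w → sum λ k → g (slide 0 k w)) ⟩
    δ ! * pathSum δ 0 δ (λ w → sum λ k → g (slide 0 k w))
      ≡⟨ cong (δ ! *_) (pathSum-straight δ 0 δ (λ w → sum λ k → g (slide 0 k w)) refl) ⟩
    δ ! * sum (λ k → g (slide 0 k (replicate δ up)))
      ≡⟨ cong (δ ! *_) (trans (sum-cong-≗ λ k → cong g (slide-ups 0 {δ} k)) (sum-const (suc δ) _)) ⟩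
    δ ! * (suc δ * g (replicate (suc δ) up))
      ≡⟨ step (δ !) (suc δ) _ ⟩
    suc δ * δ ! * g (replicate (suc δ) up)
      ≡⟨ cong (suc δ * δ ! *_) (pathSum-straight (suc δ) 0 (suc δ) g refl) ⟨
    suc δ * δ ! * pathSum (suc δ) 0 (suc δ) g ∎
    where
    step : ∀ x y z → x * (y * z) ≡ y * x * z
    step = solve-∀

  outcomes-1 : ∀ δ b → outcomes δ b (λ _ _ → 1) ≡ len δ b !
  outcomes-1 δ (suc b) = begin
    outcomes δ b (λ _ → columnSum (λ _ _ → 1))
      ≡⟨ outcomes-cong δ b (λ _ w → trans (columnSum-const 1 w) (step n)) ⟩
    outcomes δ b (λ _ _ → (2 + n) * (1 + n) * 1)
      ≡⟨ outcomes-* δ b ((2 + n) * (1 + n)) (λ _ _ → 1) ⟩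
    (2 + n) * (1 + n) * outcomes δ b (λ _ _ → 1)
      ≡⟨ cong ((2 + n) * (1 + n) *_) (outcomes-1 δ b) ⟩
    (2 + n) * (1 + n) * n !
      ≡⟨ *-assoc (2 + n) (1 + n) (n !) ⟩
    (2 + n) ! ∎
    where
    n = len δ b
    step : ∀ n → (1 + n) * ((2 + n) * 1) ≡ (2 + n) * (1 + n) * 1
    step = solve-∀
  outcomes-1 zero zero = refl
  outcomes-1 (suc δ) zero = trans (outcomes-cong δ zero λ _ _ → sum-const (suc δ) 1)
    (trans (outcomes-* δ zero (suc δ) (λ _ _ → 1)) (cong (suc δ *_) (outcomes-1 δ zero)))

  -- The hook length formula for two rows, by counting all sequences of insertions in two ways.
  weight*count : ∀ δ b → weight δ b * count δ (len δ b) ≡ len δ b !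
  weight*count δ b = trans (cong (weight δ b *_) (sym (pathSum-1 δ 0 (len δ b) 0 0)))
    (trans (sym (outcomes-uniform δ b (λ _ → 1))) (outcomes-1 δ b))

  total : ℕ → ℕ → ℕ
  total δ b = outcomes δ b (λ e _ → e)

  -- Earlier exchanges are counted once for each choice of the two new ranks. The exchanges of the
  -- new column depend on the earlier insertions only through the word, so uniformity replaces the
  -- sum over histories by a sum over ballot words.
  total-suc : ∀ δ b → total δ (suc b) ≡ (2 + len δ b) * (1 + len δ b) * total δ b + weight δ b * columnCost δ b
  total-suc δ b = begin
    outcomes δ b (λ e → columnSum (λ e′ _ → e + e′))
      ≡⟨ outcomes-cong δ b (λ e w → columnSum-+ (λ _ _ → e) (λ e′ _ → e′) w) ⟩
    outcomes δ b (λ e w → columnSum (λ _ _ → e) w + columnSum (λ e′ _ → e′) w)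
      ≡⟨ outcomes-+ δ b (λ e → columnSum (λ _ _ → e)) (λ _ → columnSum (λ e′ _ → e′)) ⟩
    outcomes δ b (λ e → columnSum (λ _ _ → e)) + outcomes δ b (λ _ → columnSum (λ e′ _ → e′))
      ≡⟨ cong₂ _+_ (trans (outcomes-cong δ b λ e w → trans (columnSum-const e w) (step (len δ b) e))
                          (outcomes-* δ b ((2 + len δ b) * (1 + len δ b)) (λ e _ → e)))
                   (outcomes-uniform δ b (columnSum (λ e′ _ → e′))) ⟩
    (2 + len δ b) * (1 + len δ b) * total δ b + weight δ b * columnCost δ b ∎
    where
    step : ∀ n e → (1 + n) * ((2 + n) * e) ≡ (2 + n) * (1 + n) * e
    step = solve-∀

  -- With one row the algorithm is insertion sort, which makes δ (δ - 1) / 4 exchanges on average.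
  total-0 : ∀ δ → 4 * total δ 0 + δ ! * δ ≡ δ ! * (δ * δ)
  total-0 zero    = refl
  total-0 (suc δ) = trans (cong (λ x → 4 * x + suc δ ! * suc δ) (begin
    outcomes δ 0 (λ e w → sum λ k → e + slideLength 0 k w)
      ≡⟨ outcomes-cong δ 0 (λ e w → trans (∑-distrib-+ (λ _ → e) (λ k → slideLength 0 k w))
           (cong (_+ sum (λ k → slideLength 0 k w)) (sum-const (suc δ) e))) ⟩
    outcomes δ 0 (λ e w → suc δ * e + sum (λ k → slideLength 0 k w))
      ≡⟨ outcomes-+ δ 0 (λ e _ → suc δ * e) (λ _ w → sum (λ k → slideLength 0 k w)) ⟩
    outcomes δ 0 (λ e _ → suc δ * e) + outcomes δ 0 (λ _ w → sum (λ k → slideLength 0 k w))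
      ≡⟨ cong₂ _+_ (outcomes-* δ 0 (suc δ) (λ e _ → e)) (trans (outcomes-uniform δ 0 (λ w → sum (λ k → slideLength 0 k w)))
           (cong (δ ! *_) (trans (pathSum-straight δ 0 δ (λ w → sum (λ k → slideLength 0 k w)) refl)
             (sum-cong-≗ λ k → trans (slideLength-ups 0 {δ} k) (sym (+-identityʳ (toℕ k))))))) ⟩
    suc δ * total δ 0 + δ ! * ∑< (suc δ) (λ i → i + 0) ∎))
    (cancel _ _ (cong₂ _+_ (cong (suc δ *_) (total-0 δ)) (cong (2 * δ ! *_) (∑<-arithmetic (suc δ) 0)))
      (step (total δ 0) (δ !) δ (∑< (suc δ) (λ i → i + 0))))
    where
    step : ∀ t m δ s →
      (4 * (suc δ * t + m * s) + suc δ * m * suc δ) + (suc δ * (m * (δ * δ)) + 2 * m * (suc δ * suc δ + 2 * (suc δ * 0)))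
        ≡ (suc δ * m * (suc δ * suc δ)) + (suc δ * (4 * t + m * δ) + 2 * m * (2 * s + suc δ))
    step = solve-∀

-- The algorithm on rows of numbers, and its translation into words

module ListAlgorithm where

  open LatticePaths
  open Outcomes
  open import Data.Fin.Base as Fin using (Fin; toℕ)
  open import Data.List.Base using (List; []; _∷_; _++_; length; map)
  open import Data.List.Properties using (++-assoc; length-++)
  open import Data.List.Relation.Unary.All as All using (All; []; _∷_)
  import Data.List.Relation.Unary.All.Properties as All
  open import Data.Nat.Base
  open import Data.Nat.Properties
  open import Data.Product.Base as Product using (_×_; _,_; map₂)
  open import Data.Sum.Base using (inj₁; inj₂)
  open import Data.Vec.Base using ([]; _∷_)
  open import Relation.Binary.PropositionalEquality
  open import Relation.Nullary using (¬_; yes; no; contradiction)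
  open import Algebra.Properties.Semiring.Sum +-*-semiring
    using (sum; sum-cong-≗)

  open ≡-Reasoning

  Rows : Set
  Rows = ℕ × List ℕ × List ℕ

  insertRow : ℕ → List ℕ → ℕ × List ℕ
  insertRow k [] = 0 , k ∷ []
  insertRow k (y ∷ ys) with y <? k
  ... | yes _ = Product.map suc (y ∷_) (insertRow k ys)
  ... | no  _ = 0 , k ∷ y ∷ ys

  moveDown : ℕ → ℕ → List ℕ → List ℕ → Rows
  moveDown k y xs ys = Product.map suc (y ∷ xs ,_) (insertRow k ys)

  -- k is in the top row, ys starts below it and xs to the right of it.
  slideRows : ℕ → List ℕ → List ℕ → Rows
  slideRows k xs [] = map₂ (_, []) (insertRow k xs)
  slideRows k [] (y ∷ ys) with y <? k
  ... | yes _ = moveDown k y [] ys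
  ... | no  _ = 0 , k ∷ [] , y ∷ ys
  slideRows k (x ∷ xs) (y ∷ ys) with y <? x | y <? k | x <? k
  ... | yes _ | yes _ | _     = moveDown k y (x ∷ xs) ys
  ... | yes _ | no  _ | _     = 0 , k ∷ x ∷ xs , y ∷ ys
  ... | no  _ | _     | yes _ = Product.map suc (Product.map (x ∷_) (y ∷_)) (slideRows k xs ys)
  ... | no  _ | _     | no  _ = 0 , k ∷ x ∷ xs , y ∷ ys

  insertRow-< : ∀ {k y} ys → y < k → insertRow k (y ∷ ys) ≡ Product.map suc (y ∷_) (insertRow k ys)
  insertRow-< {k} {y} ys y<k with y <? k
  ... | yes _   = refl
  ... | no  y≮k = contradiction y<k y≮k

  insertRow-≮ : ∀ {k y} ys → ¬ y < k → insertRow k (y ∷ ys) ≡ (0 , k ∷ y ∷ ys)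
  insertRow-≮ {k} {y} ys y≮k with y <? k
  ... | yes y<k = contradiction y<k y≮k
  ... | no  _   = refl

  slideRows-down : ∀ {k x y} xs ys → y < x → y < k →
    slideRows k (x ∷ xs) (y ∷ ys) ≡ moveDown k y (x ∷ xs) ys
  slideRows-down {k} {x} {y} xs ys y<x y<k with y <? x | y <? k | x <? k
  ... | yes _   | yes _   | _ = refl
  ... | yes _   | no  y≮k | _ = contradiction y<k y≮k
  ... | no  y≮x | _       | _ = contradiction y<x y≮x

  slideRows-right : ∀ {k x y} xs ys → ¬ y < x → x < k →
    slideRows k (x ∷ xs) (y ∷ ys) ≡ Product.map suc (Product.map (x ∷_) (y ∷_)) (slideRows k xs ys)
  slideRows-right {k} {x} {y} xs ys y≮x x<k with y <? x | y <? k | x <? k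
  ... | yes y<x | _ | _       = contradiction y<x y≮x
  ... | no  _   | _ | yes _   = refl
  ... | no  _   | _ | no  x≮k = contradiction x<k x≮k

  slideRows-stop : ∀ {k x y} xs ys → ¬ y < k → ¬ x < k →
    slideRows k (x ∷ xs) (y ∷ ys) ≡ (0 , k ∷ x ∷ xs , y ∷ ys)
  slideRows-stop {k} {x} {y} xs ys y≮k x≮k with y <? x | y <? k | x <? k
  ... | yes _ | yes y<k | _       = contradiction y<k y≮k
  ... | yes _ | no  _   | _       = refl
  ... | no  _ | _       | yes x<k = contradiction x<k x≮k
  ... | no  _ | _       | no  _   = refl

  slideRows-down[] : ∀ {k y} ys → y < k → slideRows k [] (y ∷ ys) ≡ moveDown k y [] ys
  slideRows-down[] {k} {y} ys y<k with y <? k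
  ... | yes _   = refl
  ... | no  y≮k = contradiction y<k y≮k

  slideRows-stop[] : ∀ {k y} ys → ¬ y < k → slideRows k [] (y ∷ ys) ≡ (0 , k ∷ [] , y ∷ ys)
  slideRows-stop[] {k} {y} ys y≮k with y <? k
  ... | yes y<k = contradiction y<k y≮k
  ... | no  _   = refl

  insertBottom insertTop : ℕ → Rows → Rows
  insertBottom y (e , xs , ys) = Product.map (e +_) (xs ,_) (insertRow y ys)
  insertTop    x (e , xs , ys) = Product.map₁ (e +_) (slideRows x xs ys)

  -- The algorithm for a list of values in the order reverse to that in which they are
  -- inserted; b is the number of columns of height 2.
  run : ℕ → List ℕ → Rows
  run zero    (x ∷ w)     = insertTop x (run zero w)
  run (suc b) (x ∷ y ∷ w) = insertTop x (insertBottom y (run b w))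
  run _       _           = 0 , [] , []

  module _ (φ : ℕ → ℕ) (φ-< : ∀ {m n} → m < n → φ m < φ n) where

    φ-≮ : ∀ {m n} → ¬ m < n → ¬ φ m < φ n
    φ-≮ {m} {n} m≮n φm<φn with m≤n⇒m<n∨m≡n (≮⇒≥ m≮n)
    ... | inj₁ n<m  = <-asym φm<φn (φ-< n<m)
    ... | inj₂ refl = <-irrefl refl φm<φn

    mapRows : Rows → Rows
    mapRows = map₂ (Product.map (map φ) (map φ))

    insertRow-map : ∀ k ys → insertRow (φ k) (map φ ys) ≡ map₂ (map φ) (insertRow k ys)
    insertRow-map k [] = refl
    insertRow-map k (y ∷ ys) with y <? k
    ... | yes y<k = trans (insertRow-< (map φ ys) (φ-< y<k))
                          (cong (Product.map suc (φ y ∷_)) (insertRow-map k ys))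
    ... | no  y≮k = insertRow-≮ (map φ ys) (φ-≮ y≮k)

    slideRows-map : ∀ k xs ys → slideRows (φ k) (map φ xs) (map φ ys) ≡ mapRows (slideRows k xs ys)
    slideRows-map k xs [] = cong (map₂ (_, [])) (insertRow-map k xs)
    slideRows-map k [] (y ∷ ys) with y <? k
    ... | yes y<k = trans (slideRows-down[] (map φ ys) (φ-< y<k))
                          (cong (Product.map suc (φ y ∷ [] ,_)) (insertRow-map k ys))
    ... | no  y≮k = slideRows-stop[] (map φ ys) (φ-≮ y≮k)
    slideRows-map k (x ∷ xs) (y ∷ ys) with y <? x | y <? k | x <? k
    ... | yes y<x | yes y<k | _       = trans (slideRows-down (map φ xs) (map φ ys) (φ-< y<x) (φ-< y<k))
      (cong (Product.map suc (φ y ∷ φ x ∷ map φ xs ,_)) (insertRow-map k ys))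
    ... | yes y<x | no  y≮k | _       = slideRows-stop (map φ xs) (map φ ys) (φ-≮ y≮k)
      (φ-≮ λ x<k → y≮k (<-trans y<x x<k))
    ... | no  y≮x | _       | yes x<k = trans (slideRows-right (map φ xs) (map φ ys) (φ-≮ y≮x) (φ-< x<k))
      (cong (Product.map suc (Product.map (φ x ∷_) (φ y ∷_))) (slideRows-map k xs ys))
    ... | no  y≮x | _       | no  x≮k = slideRows-stop (map φ xs) (map φ ys)
      (φ-≮ λ y<k → x≮k (≤-<-trans (≮⇒≥ y≮x) y<k)) (φ-≮ x≮k)

    insertBottom-map : ∀ y s → insertBottom (φ y) (mapRows s) ≡ mapRows (insertBottom y s)
    insertBottom-map y (e , xs , ys) = cong (Product.map (e +_) (map φ xs ,_)) (insertRow-map y ys)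

    insertTop-map : ∀ x s → insertTop (φ x) (mapRows s) ≡ mapRows (insertTop x s)
    insertTop-map x (e , xs , ys) = cong (Product.map₁ (e +_)) (slideRows-map x xs ys)

    -- Strictly monotone relabelling preserves every comparison; this justifies ranks in place of
    -- entries.
    run-map : ∀ b w → run b (map φ w) ≡ mapRows (run b w)
    run-map zero    []          = refl
    run-map zero    (x ∷ w)     = trans (cong (insertTop (φ x)) (run-map zero w)) (insertTop-map x (run zero w))
    run-map (suc b) []          = refl
    run-map (suc b) (x ∷ [])    = refl
    run-map (suc b) (x ∷ y ∷ w) = trans
      (cong (insertTop (φ x)) (trans (cong (insertBottom (φ y)) (run-map b w)) (insertBottom-map y (run b w))))
      (insertTop-map x (insertBottom y (run b w)))

  -- `punchIn` on ℕ: entries from k on are raised to make room for a new entry of rank k.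
  skip : ℕ → ℕ → ℕ
  skip zero    x       = suc x
  skip (suc k) zero    = zero
  skip (suc k) (suc x) = suc (skip k x)

  skip-< : ∀ k {m n} → m < n → skip k m < skip k n
  skip-< zero    {n = suc n}         m<n       = s<s m<n
  skip-< (suc k) {zero}  {n = suc n} m<n       = z<s
  skip-< (suc k) {suc m} {n = suc n} (s<s m<n) = s<s (skip-< k m<n)

  -- The positions of a step in a word, counted from o.
  tops bottoms : ∀ {n} → ℕ → Word n → List ℕ
  tops o []             = []
  tops o (up ∷ w)       = o ∷ tops (suc o) w
  tops o (down ∷ w)     = tops (suc o) w
  bottoms o []          = []
  bottoms o (up ∷ w)    = bottoms (suc o) w
  bottoms o (down ∷ w)  = o ∷ bottoms (suc o) w

  -- The same with the position o + k left free.
  topsAround bottomsAround : ∀ {n} → ℕ → Fin (suc n) → Word n → List ℕ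
  topsAround o Fin.zero    w             = tops (suc o) w
  topsAround o (Fin.suc k) (up ∷ w)      = o ∷ topsAround (suc o) k w
  topsAround o (Fin.suc k) (down ∷ w)    = topsAround (suc o) k w
  bottomsAround o Fin.zero    w          = bottoms (suc o) w
  bottomsAround o (Fin.suc k) (up ∷ w)   = bottomsAround (suc o) k w
  bottomsAround o (Fin.suc k) (down ∷ w) = o ∷ bottomsAround (suc o) k w

  tops-suc : ∀ {n} o (w : Word n) → tops (suc o) w ≡ map suc (tops o w)
  tops-suc o []         = refl
  tops-suc o (up ∷ w)   = cong (suc o ∷_) (tops-suc (suc o) w)
  tops-suc o (down ∷ w) = tops-suc (suc o) w

  bottoms-suc : ∀ {n} o (w : Word n) → bottoms (suc o) w ≡ map suc (bottoms o w)
  bottoms-suc o []         = refl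
  bottoms-suc o (up ∷ w)   = bottoms-suc (suc o) w
  bottoms-suc o (down ∷ w) = cong (suc o ∷_) (bottoms-suc (suc o) w)

  topsAround-suc : ∀ {n} o k (w : Word n) → topsAround (suc o) k w ≡ map suc (topsAround o k w)
  topsAround-suc o Fin.zero    w          = tops-suc (suc o) w
  topsAround-suc o (Fin.suc k) (up ∷ w)   = cong (suc o ∷_) (topsAround-suc (suc o) k w)
  topsAround-suc o (Fin.suc k) (down ∷ w) = topsAround-suc (suc o) k w

  bottomsAround-suc : ∀ {n} o k (w : Word n) → bottomsAround (suc o) k w ≡ map suc (bottomsAround o k w)
  bottomsAround-suc o Fin.zero    w          = bottoms-suc (suc o) w
  bottomsAround-suc o (Fin.suc k) (up ∷ w)   = bottomsAround-suc (suc o) k w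
  bottomsAround-suc o (Fin.suc k) (down ∷ w) = cong (suc o ∷_) (bottomsAround-suc (suc o) k w)

  map-skip-suc : ∀ k (xs : List ℕ) → map (skip (suc k)) (map suc xs) ≡ map suc (map (skip k) xs)
  map-skip-suc k []       = refl
  map-skip-suc k (x ∷ xs) = cong (_ ∷_) (map-skip-suc k xs)

  skip-tops : ∀ {n} k (w : Word n) → map (skip (toℕ k)) (tops 0 w) ≡ topsAround 0 k w
  skip-tops-suc : ∀ {n} k (w : Word n) → map (skip (suc (toℕ k))) (tops 1 w) ≡ topsAround 1 k w

  skip-tops Fin.zero    w          = sym (tops-suc 0 w)
  skip-tops (Fin.suc k) (up ∷ w)   = cong (0 ∷_) (skip-tops-suc k w)
  skip-tops (Fin.suc k) (down ∷ w) = skip-tops-suc k w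

  skip-tops-suc k w = begin
    map (skip (suc (toℕ k))) (tops 1 w)             ≡⟨ cong (map (skip (suc (toℕ k)))) (tops-suc 0 w) ⟩
    map (skip (suc (toℕ k))) (map suc (tops 0 w))   ≡⟨ map-skip-suc (toℕ k) (tops 0 w) ⟩
    map suc (map (skip (toℕ k)) (tops 0 w))         ≡⟨ cong (map suc) (skip-tops k w) ⟩
    map suc (topsAround 0 k w)                      ≡⟨ topsAround-suc 0 k w ⟨
    topsAround 1 k w                                ∎

  skip-bottoms : ∀ {n} k (w : Word n) → map (skip (toℕ k)) (bottoms 0 w) ≡ bottomsAround 0 k w
  skip-bottoms-suc : ∀ {n} k (w : Word n) → map (skip (suc (toℕ k))) (bottoms 1 w) ≡ bottomsAround 1 k w

  skip-bottoms Fin.zero    w          = sym (bottoms-suc 0 w)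
  skip-bottoms (Fin.suc k) (up ∷ w)   = skip-bottoms-suc k w
  skip-bottoms (Fin.suc k) (down ∷ w) = cong (0 ∷_) (skip-bottoms-suc k w)

  skip-bottoms-suc k w = begin
    map (skip (suc (toℕ k))) (bottoms 1 w)             ≡⟨ cong (map (skip (suc (toℕ k)))) (bottoms-suc 0 w) ⟩
    map (skip (suc (toℕ k))) (map suc (bottoms 0 w))   ≡⟨ map-skip-suc (toℕ k) (bottoms 0 w) ⟩
    map suc (map (skip (toℕ k)) (bottoms 0 w))         ≡⟨ cong (map suc) (skip-bottoms k w) ⟩
    map suc (bottomsAround 0 k w)                      ≡⟨ bottomsAround-suc 0 k w ⟨
    bottomsAround 1 k w                                ∎

  tops-≥ : ∀ {n} o (w : Word n) {p} → p ≤ o → All (p ≤_) (tops o w)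
  tops-≥ o []         p≤o = []
  tops-≥ o (up ∷ w)   p≤o = p≤o ∷ tops-≥ (suc o) w (m≤n⇒m≤1+n p≤o)
  tops-≥ o (down ∷ w) p≤o = tops-≥ (suc o) w (m≤n⇒m≤1+n p≤o)

  bottoms-≥ : ∀ {n} o (w : Word n) {p} → p ≤ o → All (p ≤_) (bottoms o w)
  bottoms-≥ o []         p≤o = []
  bottoms-≥ o (up ∷ w)   p≤o = bottoms-≥ (suc o) w (m≤n⇒m≤1+n p≤o)
  bottoms-≥ o (down ∷ w) p≤o = p≤o ∷ bottoms-≥ (suc o) w (m≤n⇒m≤1+n p≤o)

  topsAround-≥ : ∀ {n} o k (w : Word n) {p} → p ≤ o → All (p ≤_) (topsAround o k w)
  topsAround-≥ o Fin.zero    w          p≤o = tops-≥ (suc o) w (m≤n⇒m≤1+n p≤o)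
  topsAround-≥ o (Fin.suc k) (up ∷ w)   p≤o = p≤o ∷ topsAround-≥ (suc o) k w (m≤n⇒m≤1+n p≤o)
  topsAround-≥ o (Fin.suc k) (down ∷ w) p≤o = topsAround-≥ (suc o) k w (m≤n⇒m≤1+n p≤o)

  topsAround-insertDown : ∀ {n} o k (w : Word n) → topsAround o k w ≡ tops o (insertDown k w)
  topsAround-insertDown o Fin.zero    w          = refl
  topsAround-insertDown o (Fin.suc k) (up ∷ w)   = cong (o ∷_) (topsAround-insertDown (suc o) k w)
  topsAround-insertDown o (Fin.suc k) (down ∷ w) = topsAround-insertDown (suc o) k w

  insertRow-first : ∀ {k ys} → All (k <_) ys → insertRow k ys ≡ (0 , k ∷ ys)
  insertRow-first []                      = refl
  insertRow-first {ys = y ∷ ys} (k<y ∷ _) = insertRow-≮ ys (<⇒≯ k<y)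

  insertRow-between : ∀ {k} q {xs} → All (_< k) q → All (k <_) xs → insertRow k (q ++ xs) ≡ (length q , q ++ k ∷ xs)
  insertRow-between []      []          k<xs = insertRow-first k<xs
  insertRow-between (y ∷ q) (y<k ∷ q<k) k<xs = trans (insertRow-< _ y<k)
    (cong (Product.map suc (y ∷_)) (insertRow-between q q<k k<xs))

  -- All of ys exceeds k, so while k passes the smaller entries q, its smaller neighbour is always
  -- the one to the right.
  slideRows-between : ∀ {k} q {xs ys} → All (_< k) q → All (k <_) xs → All (k <_) ys →
    slideRows k (q ++ xs) ys ≡ (length q , q ++ k ∷ xs , ys)
  slideRows-between q q<k k<xs [] = cong (map₂ (_, [])) (insertRow-between q q<k k<xs)
  slideRows-between [] {ys = y ∷ ys} [] [] (k<y ∷ _) = slideRows-stop[] ys (<⇒≯ k<y)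
  slideRows-between [] {x ∷ xs} {y ∷ ys} [] (k<x ∷ _) (k<y ∷ _) = slideRows-stop xs ys (<⇒≯ k<y) (<⇒≯ k<x)
  slideRows-between (z ∷ q) {ys = y ∷ ys} (z<k ∷ q<k) k<xs (k<y ∷ k<ys) = trans
    (slideRows-right _ ys (<⇒≯ (<-trans z<k k<y)) z<k)
    (cong (Product.map suc (Product.map (z ∷_) (y ∷_))) (slideRows-between q q<k k<xs k<ys))

  insertRow-word : ∀ {n} o k (w : Word n) →
    insertRow (o + toℕ k) (bottomsAround o k w) ≡ (downsBefore k w , bottoms o (insertDown k w))
  insertRow-word o Fin.zero w rewrite +-identityʳ o = insertRow-first (bottoms-≥ (suc o) w ≤-refl)
  insertRow-word o (Fin.suc k) (up ∷ w) rewrite +-suc o (toℕ k) = insertRow-word (suc o) k w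
  insertRow-word o (Fin.suc k) (down ∷ w) = trans
    (insertRow-< _ (m<m+n o z<s))
    (cong (Product.map suc (o ∷_)) (trans
      (cong (λ m → insertRow m (bottomsAround (suc o) k w)) (+-suc o (toℕ k))) (insertRow-word (suc o) k w)))

  -- q holds the entries of the top row that have been read but not yet matched by one below.
  slideRows-word : ∀ {n} o k (w : Word n) q → All (_< o) q → 
    let h = length q in
    slideRows (o + toℕ k) (q ++ topsAround o k w) (bottomsAround o k w)
      ≡ (slideLength h k w , q ++ tops o (slide h k w) , bottoms o (slide h k w))
  slideRows-word o Fin.zero w q q<o rewrite +-identityʳ o =
    slideRows-between q q<o (tops-≥ (suc o) w ≤-refl) (bottoms-≥ (suc o) w ≤-refl)
  slideRows-word o (Fin.suc k) (up ∷ w) q q<o = begin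
    slideRows (o + suc (toℕ k)) (q ++ o ∷ topsAround (suc o) k w) (bottomsAround (suc o) k w)
      ≡⟨ cong₂ (λ m xs → slideRows m xs (bottomsAround (suc o) k w)) (+-suc o (toℕ k)) (sym (++-assoc q (o ∷ []) _)) ⟩
    slideRows (suc o + toℕ k) ((q ++ o ∷ []) ++ topsAround (suc o) k w) (bottomsAround (suc o) k w)
      ≡⟨ slideRows-word (suc o) k w (q ++ o ∷ []) (All.++⁺ (All.map m<n⇒m<1+n q<o) (n<1+n o ∷ [])) ⟩
    (slideLength h k w , (q ++ o ∷ []) ++ tops (suc o) (slide h k w) , bottoms (suc o) (slide h k w))
      ≡⟨ cong₂ (λ h xs → slideLength h k w , xs , bottoms (suc o) (slide h k w)) h≡ (++-assoc q (o ∷ []) _) ⟩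
    (slideLength (suc (length q)) k w , q ++ o ∷ tops (suc o) (slide h k w) , bottoms (suc o) (slide (suc (length q)) k w))
      ≡⟨ cong (λ h → slideLength (suc (length q)) k w , q ++ o ∷ tops (suc o) (slide h k w) , bottoms (suc o) (slide (suc (length q)) k w)) h≡ ⟩
    (slideLength (suc (length q)) k w , q ++ o ∷ tops (suc o) (slide (suc (length q)) k w) , bottoms (suc o) (slide (suc (length q)) k w)) ∎
    where
    h = length (q ++ o ∷ [])
    h≡ : h ≡ suc (length q)
    h≡ = trans (length-++ q) (+-comm (length q) 1)
  -- No unmatched top entry is left, so this down is the passage below 0: o lies beneath k, and
  -- every top entry to the right is larger than o. Here k changes rows.
  slideRows-word o (Fin.suc k) (down ∷ w) [] [] = begin
    slideRows (o + suc (toℕ k)) (topsAround (suc o) k w) (o ∷ bottomsAround (suc o) k w)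
      ≡⟨ down′ (topsAround (suc o) k w) (topsAround-≥ (suc o) k w ≤-refl) ⟩
    moveDown (o + suc (toℕ k)) o (topsAround (suc o) k w) (bottomsAround (suc o) k w)
      ≡⟨ cong (λ m → moveDown m o (topsAround (suc o) k w) (bottomsAround (suc o) k w)) (+-suc o (toℕ k)) ⟩
    moveDown (suc o + toℕ k) o (topsAround (suc o) k w) (bottomsAround (suc o) k w)
      ≡⟨ cong₂ (λ xs r → Product.map suc (o ∷ xs ,_) r) (topsAround-insertDown (suc o) k w) (insertRow-word (suc o) k w) ⟩
    (suc (downsBefore k w) , o ∷ tops (suc o) (insertDown k w) , bottoms (suc o) (insertDown k w)) ∎
    where
    down′ : ∀ xs → All (o <_) xs → slideRows (o + suc (toℕ k)) xs (o ∷ bottomsAround (suc o) k w)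
      ≡ moveDown (o + suc (toℕ k)) o xs (bottomsAround (suc o) k w)
    down′ []       []        = slideRows-down[] _ (m<m+n o z<s)
    down′ (x ∷ xs) (o<x ∷ _) = slideRows-down xs _ o<x (m<m+n o z<s)
  -- Beneath k lies o, and to its right the first unmatched top entry z, which is smaller. So k
  -- moves right and leaves behind a column with z above o.
  slideRows-word o (Fin.suc k) (down ∷ w) (z ∷ q) (z<o ∷ q<o) = trans
    (slideRows-right _ _ (<⇒≯ z<o) (<-≤-trans z<o (m≤m+n o _)))
    (cong (Product.map suc (Product.map (z ∷_) (o ∷_))) (trans
      (cong (λ m → slideRows m (q ++ topsAround (suc o) k w) (bottomsAround (suc o) k w)) (+-suc o (toℕ k)))
      (slideRows-word (suc o) k w q (All.map m<n⇒m<1+n q<o))))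

  rows : ∀ {n} → ℕ → Word n → Rows
  rows e w = e , tops 0 w , bottoms 0 w

  insertColumn : ℕ → ℕ → Rows → Rows
  insertColumn k₁ k₂ s = insertTop k₂ (mapRows (skip k₂) (skip-< k₂) (insertBottom k₁ (mapRows (skip k₁) (skip-< k₁) s)))

  insertTop-rows : ∀ {n} e (k : Fin (suc n)) (w : Word n) →
    insertTop (toℕ k) (mapRows (skip (toℕ k)) (skip-< (toℕ k)) (rows e w)) ≡ rows (e + slideLength 0 k w) (slide 0 k w)
  insertTop-rows e k w = trans
    (cong₂ (λ xs ys → insertTop (toℕ k) (e , xs , ys)) (skip-tops k w) (skip-bottoms k w))
    (cong (Product.map₁ (e +_)) (slideRows-word 0 k w [] []))

  insertBottom-rows : ∀ {n} e (k : Fin (suc n)) (w : Word n) →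
    insertBottom (toℕ k) (mapRows (skip (toℕ k)) (skip-< (toℕ k)) (rows e w)) ≡ rows (e + downsBefore k w) (insertDown k w)
  insertBottom-rows e k w = trans
    (cong₂ (λ xs ys → insertBottom (toℕ k) (e , xs , ys)) (trans (skip-tops k w) (topsAround-insertDown 0 k w)) (skip-bottoms k w))
    (cong (Product.map (e +_) (tops 0 (insertDown k w) ,_)) (insertRow-word 0 k w))

  -- Summation over the permutations of 0, ..., n - 1, generated by ranks: the head is the entry
  -- inserted last. Its sum is the innermost one, as in `outcomes`.
  wordsSum : (n : ℕ) → (List ℕ → ℕ) → ℕ
  wordsSum zero    F = F []
  wordsSum (suc n) F = wordsSum n (λ w → sum {suc n} λ k → F (toℕ k ∷ map (skip (toℕ k)) w))

  wordsSum-cong : ∀ n {F G : List ℕ → ℕ} → (∀ w → F w ≡ G w) → wordsSum n F ≡ wordsSum n G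
  wordsSum-cong zero    eq = eq []
  wordsSum-cong (suc n) eq = wordsSum-cong n λ w → sum-cong-≗ {suc n} λ k → eq (toℕ k ∷ map (skip (toℕ k)) w)

  -- At every stage the renumbered rows are those of a word. F is arbitrary so that the induction
  -- hypothesis can absorb the sums over the new ranks.
  wordsSum-run : ∀ δ b (F : Rows → ℕ) →
    wordsSum (len δ b) (λ w → F (run b w)) ≡ outcomes δ b (λ e w → F (rows e w))
  wordsSum-run δ (suc b) F = begin
    wordsSum n (λ w → sum {suc n} λ k₁ → sum {2 + n} λ k₂ → F (run (suc b) (word k₁ k₂ w)))
      ≡⟨ wordsSum-cong n (λ w → sum-cong-≗ {suc n} λ k₁ → sum-cong-≗ {2 + n} λ k₂ → cong F (column w k₁ k₂)) ⟩
    wordsSum n (λ w → sum {suc n} λ k₁ → sum {2 + n} λ k₂ → F (insertColumn (toℕ k₁) (toℕ k₂) (run b w)))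
      ≡⟨ wordsSum-run δ b (λ s → sum {suc n} λ k₁ → sum {2 + n} λ k₂ → F (insertColumn (toℕ k₁) (toℕ k₂) s)) ⟩
    outcomes δ b (λ e w → sum {suc n} λ k₁ → sum {2 + n} λ k₂ → F (insertColumn (toℕ k₁) (toℕ k₂) (rows e w)))
      ≡⟨ outcomes-cong δ b (λ e w → sum-cong-≗ {suc n} λ k₁ → sum-cong-≗ {2 + n} λ k₂ → cong F (column-rows e w k₁ k₂)) ⟩
    outcomes δ b (λ e w → columnSum (λ e′ v → F (rows (e + e′) v)) w) ∎
    where
    n = len δ b
    word : Fin (suc n) → Fin (2 + n) → List ℕ → List ℕ
    word k₁ k₂ w = toℕ k₂ ∷ map (skip (toℕ k₂)) (toℕ k₁ ∷ map (skip (toℕ k₁)) w)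

    column : ∀ w k₁ k₂ → run (suc b) (word k₁ k₂ w) ≡ insertColumn (toℕ k₁) (toℕ k₂) (run b w)
    column w k₁ k₂ = cong (insertTop (toℕ k₂)) (trans
      (cong (insertBottom (skip (toℕ k₂) (toℕ k₁))) (trans (run-map _ (skip-< (toℕ k₂)) b (map (skip (toℕ k₁)) w))
        (cong (mapRows _ (skip-< (toℕ k₂))) (run-map _ (skip-< (toℕ k₁)) b w))))
      (insertBottom-map _ (skip-< (toℕ k₂)) (toℕ k₁) (mapRows _ (skip-< (toℕ k₁)) (run b w))))

    column-rows : ∀ e w k₁ k₂ → insertColumn (toℕ k₁) (toℕ k₂) (rows e w)
      ≡ rows (e + (downsBefore k₁ w + slideLength 0 k₂ (insertDown k₁ w))) (slide 0 k₂ (insertDown k₁ w))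
    column-rows e w k₁ k₂ = begin
      insertColumn (toℕ k₁) (toℕ k₂) (rows e w)
        ≡⟨ cong (λ s → insertTop (toℕ k₂) (mapRows _ (skip-< (toℕ k₂)) s)) (insertBottom-rows e k₁ w) ⟩
      insertTop (toℕ k₂) (mapRows _ (skip-< (toℕ k₂)) (rows (e + downsBefore k₁ w) (insertDown k₁ w)))
        ≡⟨ insertTop-rows (e + downsBefore k₁ w) k₂ (insertDown k₁ w) ⟩
      rows (e + downsBefore k₁ w + slideLength 0 k₂ (insertDown k₁ w)) (slide 0 k₂ (insertDown k₁ w))
        ≡⟨ cong (λ e → rows e (slide 0 k₂ (insertDown k₁ w))) (+-assoc e _ _) ⟩
      rows (e + (downsBefore k₁ w + slideLength 0 k₂ (insertDown k₁ w))) (slide 0 k₂ (insertDown k₁ w)) ∎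
  wordsSum-run zero zero F = refl
  wordsSum-run (suc δ) zero F = begin
    wordsSum δ (λ w → sum {suc δ} λ k → F (insertTop (toℕ k) (run 0 (map (skip (toℕ k)) w))))
      ≡⟨ wordsSum-cong δ (λ w → sum-cong-≗ {suc δ} λ k → cong (λ s → F (insertTop (toℕ k) s)) (run-map _ (skip-< (toℕ k)) 0 w)) ⟩
    wordsSum δ (λ w → sum {suc δ} λ k → F (insertTop (toℕ k) (mapRows _ (skip-< (toℕ k)) (run 0 w))))
      ≡⟨ wordsSum-run δ zero (λ s → sum {suc δ} λ k → F (insertTop (toℕ k) (mapRows _ (skip-< (toℕ k)) s))) ⟩
    outcomes δ zero (λ e w → sum {suc δ} λ k → F (insertTop (toℕ k) (mapRows _ (skip-< (toℕ k)) (rows e w))))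
      ≡⟨ outcomes-cong δ zero (λ e w → sum-cong-≗ {suc δ} λ k → cong F (insertTop-rows e k w)) ⟩
    outcomes δ zero (λ e w → sum {suc δ} λ k → F (rows (e + slideLength 0 k w) (slide 0 k w))) ∎

-- Summation over permutations in the order of insertion

module PermutationWords where

  open LatticePaths
  open Outcomes
  open ListAlgorithm
  open import Defs using (permutations; permutations-distinct)
  open import Data.Fin.Base as Fin using (Fin; toℕ; punchIn; punchOut)
  import Data.Fin.Properties as Fin
  open import Data.Fin.Patterns using (0F)
  open import Data.Fin.Permutation using (Permutation′; _⟨$⟩ʳ_; insert; insert-punchIn) renaming (_≈_ to _≈ₚ_)
  open import Data.List.Base using (List; []; _∷_; [_]; _++_; length; map; concatMap; allFin; tabulate; take; drop)
  open import Data.List.Properties using (∷-injective; ++-identityʳ; length-tabulate; map-++; length-take; length-drop;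
    take++drop≡id; tabulate-cong; map-tabulate; length-map; map-concatMap; map-∘; map-cong; concatMap-cong)
  open import Data.List.Membership.Propositional using (_∈_)
  open import Data.List.Membership.Propositional.Properties using (∈-map⁺; ∈-map⁻; ∈-∃++; ∈-allFin)
  open import Data.List.Relation.Binary.Permutation.Propositional using (_↭_; prep; ↭-refl; ↭-sym; ↭-trans; ↭⇒↭ₛ)
  open import Data.List.Relation.Binary.Permutation.Propositional.Properties using (shift; ↭-length; ∈-resp-↭) renaming (map⁺ to ↭-map⁺)
  open import Data.List.Relation.Binary.Subset.Propositional using (_⊆_)
  open import Data.List.Relation.Unary.All as All using (All; []; _∷_)
  import Data.List.Relation.Unary.All.Properties as All
  open import Data.List.Relation.Unary.AllPairs as AllPairs using (AllPairs; []; _∷_)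
  import Data.List.Relation.Unary.AllPairs.Properties as AllPairs
  open import Data.List.Relation.Unary.Any as Any using (here; there)
  import Data.List.Relation.Unary.Any.Properties as Any
  open import Data.List.Relation.Unary.Unique.Propositional using (Unique)
  import Data.List.Relation.Unary.Unique.Propositional.Properties as Unique
  open import Data.Nat.Base
  import Data.Nat.ListAction as List
  open import Data.Nat.ListAction.Properties using (sum-++; sum-↭)
  open import Data.Nat.Properties
  open import Data.Product.Base using (_×_; _,_; proj₁; proj₂; ∃-syntax)
  open import Function.Bundles using (module Injection)
  open import Function.Properties.Inverse using (↔⇒↣)
  open import Function.Base using (_∘_; id)
  open import Relation.Binary.PropositionalEquality hiding ([_])
  open import Relation.Nullary using (contradiction)
  open import Algebra.Properties.Semiring.Sum +-*-semiring
    using (sum; sum-cong-≗; ∑-distrib-+; sum-replicate-zero)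

  open ≡-Reasoning

  private variable
    A B : Set
    n : ℕ

  -- Column by column, the upper entry first.
  interleave : List A → List A → List A
  interleave []       ys       = ys
  interleave (x ∷ xs) []       = x ∷ xs
  interleave (x ∷ xs) (y ∷ ys) = x ∷ y ∷ interleave xs ys

  interleave-↭ : ∀ (xs ys : List A) → interleave xs ys ↭ xs ++ ys
  interleave-↭ []       ys       = ↭-refl
  interleave-↭ (x ∷ xs) []       = prep x (subst (xs ↭_) (sym (++-identityʳ xs)) ↭-refl)
  interleave-↭ (x ∷ xs) (y ∷ ys) = prep x (↭-trans (prep y (interleave-↭ xs ys)) (↭-sym (shift y xs ys)))

  interleave-injective : ∀ (xs xs′ ys ys′ : List A) → length xs ≡ length xs′ → length ys ≡ length ys′ →
    interleave xs ys ≡ interleave xs′ ys′ → xs ≡ xs′ × ys ≡ ys′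
  interleave-injective []       []         ys       ys′        _  _  eq = refl , eq
  interleave-injective (x ∷ xs) (x′ ∷ xs′) []       []         _  _  eq = eq , refl
  interleave-injective (x ∷ xs) (x′ ∷ xs′) (y ∷ ys) (y′ ∷ ys′) lx ly eq
    with ∷-injective eq
  ... | refl , eq′ with ∷-injective eq′
  ... | refl , eq″ with interleave-injective xs xs′ ys ys′ (suc-injective lx) (suc-injective ly) eq″
  ... | refl , refl = refl , refl

  -- Cells are numbered along the rows but processed along the columns; a is the length of the top
  -- row.
  columnwise : ℕ → List A → List A
  columnwise a w = interleave (take a w) (drop a w)

  columnwise-↭ : ∀ a (w : List A) → columnwise a w ↭ w
  columnwise-↭ a w = subst (columnwise a w ↭_) (take++drop≡id a w) (interleave-↭ (take a w) (drop a w))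

  columnwise-injective : ∀ a {v w : List A} → columnwise a v ≡ columnwise a w → v ≡ w
  columnwise-injective a {v} {w} eq with interleave-injective (take a v) (take a w) (drop a v) (drop a w)
      (trans (length-take a v) (trans (cong (a ⊓_) length≡) (sym (length-take a w))))
      (trans (length-drop a v) (trans (cong (_∸ a) length≡) (sym (length-drop a w)))) eq
    where
    length≡ : length v ≡ length w
    length≡ = trans (sym (↭-length (columnwise-↭ a v))) (trans (cong length eq) (↭-length (columnwise-↭ a w)))
  ... | take≡ , drop≡ = trans (sym (take++drop≡id a v)) (trans (cong₂ _++_ take≡ drop≡) (take++drop≡id a w))

  -- The pigeonhole principle. It shows that `columnwise` permutes `words n` from injectivity alone,
  -- without an inverse.
  Unique-⊆-↭ : ∀ {xs ys : List A} → Unique xs → xs ⊆ ys → length ys ≤ length xs → xs ↭ ys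
  Unique-⊆-↭ {xs = []} {[]} _ _ _ = ↭-refl
  Unique-⊆-↭ {xs = x ∷ xs} (x∉xs ∷ xs!) xs⊆ys ys≤ with ∈-∃++ (xs⊆ys (here refl))
  ... | ps , qs , refl = ↭-trans (prep x (Unique-⊆-↭ xs! rest shorter)) (↭-sym (shift x ps qs))
    where
    rest : xs ⊆ ps ++ qs
    rest z∈xs with ∈-resp-↭ (shift x ps qs) (xs⊆ys (there z∈xs))
    ... | here refl = contradiction refl (All.lookup x∉xs z∈xs)
    ... | there z∈  = z∈
    shorter : length (ps ++ qs) ≤ length xs
    shorter = s≤s⁻¹ (≤-trans (≤-reflexive (sym (↭-length (shift x ps qs)))) ys≤)

  -- One-line notation by the recursion of `permutations`: lists can be compared by propositional
  -- equality, whereas permutations are compared pointwise.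
  words : ∀ n → List (List (Fin n))
  words zero    = [ [] ]
  words (suc n) = concatMap (λ j → map (λ w → j ∷ map (punchIn j) w) (words n)) (allFin (suc n))

  tabulate-injective : ∀ {f g : Fin n → A} → tabulate f ≡ tabulate g → ∀ i → f i ≡ g i
  tabulate-injective eq Fin.zero    = proj₁ (∷-injective eq)
  tabulate-injective eq (Fin.suc i) = tabulate-injective (proj₂ (∷-injective eq)) i

  word : Permutation′ n → List (Fin n)
  word π = tabulate (π ⟨$⟩ʳ_)

  word-insert : ∀ j (π : Permutation′ n) → word (insert 0F j π) ≡ j ∷ map (punchIn j) (word π)
  word-insert j π = cong (j ∷_) (trans (tabulate-cong (insert-punchIn 0F j π)) (sym (map-tabulate (π ⟨$⟩ʳ_) (punchIn j))))

  map-word : ∀ n → map word (permutations n) ≡ words n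
  map-word zero    = refl
  map-word (suc n) = trans (map-concatMap word _ (allFin (suc n))) (concatMap-cong block (allFin (suc n)))
    where
    block : ∀ j → map word (map (insert 0F j) (permutations n)) ≡ map (λ w → j ∷ map (punchIn j) w) (words n)
    block j = begin
      map word (map (insert 0F j) (permutations n))
        ≡⟨ map-∘ (permutations n) ⟨
      map (word ∘ insert 0F j) (permutations n)
        ≡⟨ map-cong (word-insert j) (permutations n) ⟩
      map ((λ w → j ∷ map (punchIn j) w) ∘ word) (permutations n)
        ≡⟨ map-∘ (permutations n) ⟩
      map (λ w → j ∷ map (punchIn j) w) (map word (permutations n))
        ≡⟨ cong (map _) (map-word n) ⟩
      map (λ w → j ∷ map (punchIn j) w) (words n) ∎

  words-unique : ∀ n → Unique (words n)
  words-unique n = subst Unique (map-word n)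
    (AllPairs.map⁺ (AllPairs.map (λ π≉ρ eq → π≉ρ (tabulate-injective eq)) (permutations-distinct n)))

  words-sound : ∀ n {w} → w ∈ words n → Unique w × length w ≡ n
  words-sound n w∈ with ∈-map⁻ word (subst (_ ∈_) (sym (map-word n)) w∈)
  ... | π , _ , refl = Unique.tabulate⁺ (λ {i} {j} eq → Injection.injective (↔⇒↣ π) eq) , length-tabulate _

  punchOut-all : ∀ {j : Fin (suc n)} {w} → All (j ≢_) w → ∃[ v ] w ≡ map (punchIn j) v
  punchOut-all []          = [] , refl
  punchOut-all (j≢x ∷ j≢w) with punchOut-all j≢w
  ... | v , refl = punchOut j≢x ∷ v , cong (_∷ _) (sym (Fin.punchIn-punchOut j≢x))

  words-complete : ∀ n {w} → Unique w → length w ≡ n → w ∈ words n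
  words-complete zero    {[]}    _            _  = here refl
  words-complete (suc n) {j ∷ w} (j≢w ∷ w!) len with punchOut-all j≢w
  ... | v , refl = Any.concatMap⁺ _ (Any.map (λ { refl → ∈-map⁺ _ v∈ }) (∈-allFin j))
    where
    v∈ : v ∈ words n
    v∈ = words-complete n (Unique.map⁻ w!) (trans (sym (length-map (punchIn j) v)) (suc-injective len))

  columnwise-words : ∀ a n → map (columnwise a) (words n) ↭ words n
  columnwise-words a n = Unique-⊆-↭
    (Unique.map⁺ (columnwise-injective a) (words-unique n))
    included
    (≤-reflexive (sym (length-map (columnwise a) (words n))))
    where
    included : map (columnwise a) (words n) ⊆ words n
    included v∈ with ∈-map⁻ (columnwise a) v∈
    ... | w , w∈ , refl with words-sound n w∈
    ... | w! , len = words-complete n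
      (Unique-resp-↭ (↭⇒↭ₛ (↭-sym (columnwise-↭ a w))) w!)
      (trans (↭-length (columnwise-↭ a w)) len)
      where open import Data.List.Relation.Binary.Permutation.Setoid.Properties (setoid (Fin n)) using (Unique-resp-↭)

  toℕ-punchIn : ∀ j (i : Fin n) → toℕ (punchIn j i) ≡ skip (toℕ j) (toℕ i)
  toℕ-punchIn Fin.zero    i           = refl
  toℕ-punchIn (Fin.suc j) Fin.zero    = refl
  toℕ-punchIn (Fin.suc j) (Fin.suc i) = cong suc (toℕ-punchIn j i)

  sum-tabulate : (f : Fin n → ℕ) → List.sum (tabulate f) ≡ sum f
  sum-tabulate {zero}  f = refl
  sum-tabulate {suc n} f = cong (f 0F +_) (sum-tabulate (f ∘ Fin.suc))

  sum-concatMap : (F : B → ℕ) (g : A → List B) (xs : List A) →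
    List.sum (map F (concatMap g xs)) ≡ List.sum (map (λ x → List.sum (map F (g x))) xs)
  sum-concatMap F g []       = refl
  sum-concatMap F g (x ∷ xs) = trans (cong List.sum (map-++ F (g x) (concatMap g xs)))
    (trans (sum-++ (map F (g x)) _) (cong (List.sum (map F (g x)) +_) (sum-concatMap F g xs)))

  sum-exchange : ∀ {m} (xs : List A) (f : A → Fin m → ℕ) →
    sum (λ j → List.sum (map (λ x → f x j) xs)) ≡ List.sum (map (λ x → sum (f x)) xs)
  sum-exchange {m = m} []       f = sum-replicate-zero m
  sum-exchange {m = m} (x ∷ xs) f = trans (∑-distrib-+ (f x) (λ j → List.sum (map (λ x → f x j) xs)))
    (cong (sum (f x) +_) (sum-exchange xs f))

  -- The first letter is summed outermost in `words` and innermost in `wordsSum`; `sum-exchange`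
  -- interchanges the sums.
  sum-words : ∀ n (F : List ℕ → ℕ) → List.sum (map (λ w → F (map toℕ w)) (words n)) ≡ wordsSum n F
  sum-words zero    F = +-identityʳ (F [])
  sum-words (suc n) F = begin
    List.sum (map F′ (concatMap block (allFin (suc n))))
      ≡⟨ sum-concatMap F′ block (allFin (suc n)) ⟩
    List.sum (map (λ j → List.sum (map F′ (block j))) (allFin (suc n)))
      ≡⟨ cong List.sum (map-tabulate id (λ j → List.sum (map F′ (block j)))) ⟩
    List.sum (tabulate (λ j → List.sum (map F′ (block j))))
      ≡⟨ sum-tabulate (λ j → List.sum (map F′ (block j))) ⟩
    sum {suc n} (λ j → List.sum (map F′ (block j)))
      ≡⟨ sum-cong-≗ {suc n} (λ j → cong List.sum (trans (sym (map-∘ {g = F′} {f = λ w → j ∷ map (punchIn j) w} (words n))) (map-cong (first j) (words n)))) ⟩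
    sum {suc n} (λ j → List.sum (map (λ w → F (toℕ j ∷ map (skip (toℕ j)) (map toℕ w))) (words n)))
      ≡⟨ sum-exchange {m = suc n} (words n) (λ w j → F (toℕ j ∷ map (skip (toℕ j)) (map toℕ w))) ⟩
    List.sum (map (λ w → sum {suc n} (λ j → F (toℕ j ∷ map (skip (toℕ j)) (map toℕ w)))) (words n))
      ≡⟨ sum-words n (λ w → sum {suc n} (λ j → F (toℕ j ∷ map (skip (toℕ j)) w))) ⟩
    wordsSum (suc n) F ∎
    where
    F′ : List (Fin (suc n)) → ℕ
    F′ w = F (map toℕ w)
    block : Fin (suc n) → List (List (Fin (suc n)))
    block j = map (λ w → j ∷ map (punchIn j) w) (words n)
    first : ∀ j w → F (toℕ j ∷ map toℕ (map (punchIn j) w)) ≡ F (toℕ j ∷ map (skip (toℕ j)) (map toℕ w))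
    first j w = cong (λ v → F (toℕ j ∷ v)) (trans (sym (map-∘ w)) (trans (map-cong (toℕ-punchIn j) w) (map-∘ w)))

  sum-permutations : ∀ a n (F : List ℕ → ℕ) →
    List.sum (map (λ π → F (map toℕ (columnwise a (word π)))) (permutations n)) ≡ wordsSum n F
  sum-permutations a n F = begin
    List.sum (map (λ π → F (map toℕ (columnwise a (word π)))) (permutations n))
      ≡⟨ cong List.sum (trans (map-∘ (permutations n)) (trans (cong (map (λ w → F (map toℕ (columnwise a w)))) (map-word n)) (map-∘ (words n)))) ⟩
    List.sum (map (λ w → F (map toℕ w)) (map (columnwise a) (words n)))
      ≡⟨ sum-↭ (↭-map⁺ _ (columnwise-words a n)) ⟩
    List.sum (map (λ w → F (map toℕ w)) (words n))
      ≡⟨ sum-words n F ⟩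
    wordsSum n F ∎

-- Agreement of the tableau algorithm with the algorithm on rows

module Simulation where

  open import Defs
  open ListAlgorithm
  open PermutationWords
  open import Data.Fin.Base as Fin using (Fin; toℕ; fromℕ<; _↑ˡ_; _↑ʳ_)
  import Data.Fin.Properties as Fin
  open import Data.Fin.Permutation using (Permutation′; _⟨$⟩ʳ_)
  import Data.Fin.Permutation.Components as PC
  open import Data.List.Base using (List; []; _∷_; map; foldl; length; tabulate; take; drop; catMaybes; cartesianProductWith; downFrom)
  open import Data.List.Properties using (map-tabulate; length-tabulate)
  open import Data.List.Relation.Unary.All using ([]; _∷_)
  open import Data.List.Relation.Unary.Any using (here)
  import Data.List.Extrema as Extrema
  open import Data.Maybe.Base using (just; nothing)
  open import Data.Nat.Base
  open import Data.Nat.Properties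
  open import Data.Product.Base using (_×_; _,_; proj₁; proj₂; ∃-syntax; map₁)
  open import Data.Sum.Base using (_⊎_; inj₁; inj₂)
  open import Function.Base using (_∘_)
  open import Function.Bundles using (module Inverse; module Injection)
  open import Function.Construct.Composition using (_↔-∘_)
  open import Function.Properties.Inverse using (↔⇒↣)
  open import Relation.Binary.PropositionalEquality hiding ([_])
  open import Relation.Nullary using (Dec; ¬_; yes; no; contradiction)
  open import Relation.Nullary.Decidable using (dec-true; dec-false)

  open Inverse using (to; from)
  open ≡-Reasoning

  module _ {n : ℕ} where
    open Extrema (Fin.≤-totalOrder n) using (min; argmin-sel; f[argmin]≤f[⊤]; f[argmin]≤f[xs])

    min-first : ∀ {x y : Fin n} → toℕ x < toℕ y → min x (y ∷ []) ≡ x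
    min-first {x} {y} x<y with argmin-sel (λ z → z) x (y ∷ [])
    ... | inj₁ ≡x        = ≡x
    ... | inj₂ (here ≡y) = contradiction x<y (≤⇒≯ (subst (Fin._≤ x) ≡y (f[argmin]≤f[⊤] {f = λ z → z} x (y ∷ []))))

    min-second : ∀ {x y : Fin n} → ¬ toℕ x < toℕ y → min x (y ∷ []) ≡ y
    min-second {x} {y} x≮y with argmin-sel (λ z → z) x (y ∷ []) | f[argmin]≤f[xs] {f = λ z → z} x (y ∷ [])
    ... | inj₁ ≡x        | m≤y ∷ [] = trans ≡x (Fin.toℕ-injective (≤-antisym (subst (Fin._≤ y) ≡x m≤y) (≮⇒≥ x≮y)))
    ... | inj₂ (here ≡y) | _        = ≡y

    transpose-second : ∀ (i j : Fin n) → PC.transpose i j j ≡ i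
    transpose-second i j with j Fin.≟ i
    ... | yes j≡i = j≡i
    ... | no  _ rewrite dec-true (j Fin.≟ j) refl = refl

    transpose-other : ∀ {i j k : Fin n} → k ≢ i → k ≢ j → PC.transpose i j k ≡ k
    transpose-other {i} {j} {k} k≢i k≢j rewrite dec-false (k Fin.≟ i) k≢i | dec-false (k Fin.≟ j) k≢j = refl

  module _ (Λ : Partition) where

    private
      rl : ℕ → ℕ
      rl = rowLength (parts Λ)

      N : ℕ
      N = size Λ

    cell?-just : ∀ {i j} (p : j < rl i) → cell? Λ (i , j) ≡ just ((i , j) , p)
    cell?-just {i} {j} p with j <? rl i
    ... | yes q = cong (λ q → just (_ , q)) (<-irrelevant q p)
    ... | no ¬p = contradiction p ¬p

    cell?-nothing : ∀ {i j} → ¬ j < rl i → cell? Λ (i , j) ≡ nothing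
    cell?-nothing {i} {j} ¬p with j <? rl i
    ... | yes p = contradiction p ¬p
    ... | no _  = refl

    module _ (T : Tableau Λ) (k : Fin N) where

      partner-0 : map (to T) (neighbours Λ (from T k)) ≡ [] → exchangePartner Λ T k ≡ nothing
      partner-0 eq rewrite eq = refl

      partner-1 : ∀ {x} → map (to T) (neighbours Λ (from T k)) ≡ x ∷ [] → toℕ x < toℕ k → exchangePartner Λ T k ≡ just x
      partner-1 {x} eq x<k rewrite eq with x Fin.<? k
      ... | yes _   = refl
      ... | no  x≮k = contradiction x<k x≮k

      partner-1-stop : ∀ {x} → map (to T) (neighbours Λ (from T k)) ≡ x ∷ [] → ¬ toℕ x < toℕ k → exchangePartner Λ T k ≡ nothing
      partner-1-stop {x} eq x≮k rewrite eq with x Fin.<? k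
      ... | yes x<k = contradiction x<k x≮k
      ... | no  _   = refl

      partner-first : ∀ {x y} → map (to T) (neighbours Λ (from T k)) ≡ x ∷ y ∷ [] →
        toℕ x < toℕ y → toℕ x < toℕ k → exchangePartner Λ T k ≡ just x
      partner-first {x} {y} eq x<y x<k rewrite eq | min-first x<y with x Fin.<? k
      ... | yes _   = refl
      ... | no  x≮k = contradiction x<k x≮k

      partner-second : ∀ {x y} → map (to T) (neighbours Λ (from T k)) ≡ x ∷ y ∷ [] →
        ¬ toℕ x < toℕ y → toℕ y < toℕ k → exchangePartner Λ T k ≡ just y
      partner-second {x} {y} eq x≮y y<k rewrite eq | min-second x≮y with y Fin.<? k
      ... | yes _   = refl
      ... | no  y≮k = contradiction y<k y≮k

      partner-2-stop : ∀ {x y} → map (to T) (neighbours Λ (from T k)) ≡ x ∷ y ∷ [] →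
        ¬ toℕ x < toℕ k → ¬ toℕ y < toℕ k → exchangePartner Λ T k ≡ nothing
      partner-2-stop {x} {y} eq x≮k y≮k with x Fin.<? y
      ... | yes x<y rewrite eq | min-first x<y with x Fin.<? k
      ...   | yes x<k = contradiction x<k x≮k
      ...   | no  _   = refl
      partner-2-stop {x} {y} eq x≮k y≮k | no x≮y rewrite eq | min-second x≮y with y Fin.<? k
      ...   | yes y<k = contradiction y<k y≮k
      ...   | no  _   = refl

      settle-stop : ∀ fuel → exchangePartner Λ T k ≡ nothing → settle Λ fuel k T ≡ (0 , T)
      settle-stop zero       eq = refl
      settle-stop (suc fuel) eq rewrite eq = refl

      settle-step : ∀ fuel {m} → exchangePartner Λ T k ≡ just m →
        settle Λ (suc fuel) k T ≡ map₁ suc (settle Λ fuel k (exchange Λ m k T))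
      settle-step fuel eq rewrite eq = refl

    module _ (T : Tableau Λ) where

      to-injective : ∀ {c d} → to T c ≡ to T d → c ≡ d
      to-injective = Injection.injective (↔⇒↣ T)

      swapped : Cell Λ → Cell Λ → Tableau Λ
      swapped c d = exchange Λ (to T d) (to T c) T

      swapped-first : ∀ c d → to (swapped c d) c ≡ to T d
      swapped-first c d = transpose-second (to T d) (to T c)

      swapped-second : ∀ c d → to (swapped c d) d ≡ to T c
      swapped-second c d = transpose-first Λ (to T d) (to T c)

      swapped-other : ∀ c d {c′} → proj₁ c′ ≢ proj₁ c → proj₁ c′ ≢ proj₁ d → to (swapped c d) c′ ≡ to T c′
      swapped-other c d ≢c ≢d = transpose-other (λ eq → ≢d (cong proj₁ (to-injective eq))) (λ eq → ≢c (cong proj₁ (to-injective eq)))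

      -- The entries of row i from column j on.
      data Row (i : ℕ) : ℕ → List ℕ → Set where
        end  : ∀ {j} → ¬ j < rl i → Row i j []
        next : ∀ {j vs v} (p : j < rl i) → toℕ (to T ((i , j) , p)) ≡ v → Row i (suc j) vs → Row i j (v ∷ vs)

      neighbours-entries : ∀ {i j} {p : j < rl i} {k} → to T ((i , j) , p) ≡ k →
        map (to T) (neighbours Λ (from T k)) ≡ map (to T) (catMaybes (cell? Λ (suc i , j) ∷ cell? Λ (i , suc j) ∷ []))
      neighbours-entries {i} {j} {p} refl = cong (map (to T) ∘ neighbours Λ) (Inverse.strictlyInverseʳ T ((i , j) , p))

    Row-cong : ∀ {T T′ i j vs} → (∀ l (q : l < rl i) → j ≤ l → to T′ ((i , l) , q) ≡ to T ((i , l) , q)) →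
      Row T i j vs → Row T′ i j vs
    Row-cong eq (end ¬p)       = end ¬p
    Row-cong eq (next p v row) = next p (trans (cong toℕ (eq _ p ≤-refl)) v) (Row-cong (λ l q j<l → eq l q (<⇒≤ j<l)) row)

    Row-unique : ∀ {T i j vs vs′} → Row T i j vs → Row T i j vs′ → vs ≡ vs′
    Row-unique (end _)       (end _)         = refl
    Row-unique (end ¬p)      (next p _ _)    = contradiction p ¬p
    Row-unique (next p _ _)  (end ¬p)        = contradiction p ¬p
    Row-unique {T} {i} {j} (next p v row) (next q v′ row′) = cong₂ _∷_
      (trans (sym v) (trans (cong (λ r → toℕ (to T ((i , j) , r))) (<-irrelevant p q)) v′)) (Row-unique row row′)

    Row-length : ∀ {T i j vs} → Row T i j vs → length vs ≤ rl i
    Row-length {i = i} {j} row = ≤-trans (bound row) (m∸n≤m (rl i) j)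
      where
      bound : ∀ {T i j vs} → Row T i j vs → length vs ≤ rl i ∸ j
      bound (end _) = z≤n
      bound {i = i} {j} (next p _ row) = ≤-trans (s≤s (bound row)) (≤-reflexive (sym (+-∸-assoc 1 p)))

    Agree : (ℕ → ℕ → Set) → Tableau Λ → Tableau Λ → Set
    Agree P T T′ = ∀ i l q → P i l → to T′ ((i , l) , q) ≡ to T ((i , l) , q)

    -- With no cell beneath row i from column j on, the right neighbour is the only candidate, and
    -- each exchange moves k one column, so the length of the rest of the row is fuel enough. The
    -- last component is a frame condition: it preserves what is known of the other row and of the
    -- unprocessed columns.
    settle-row : ∀ fuel T i j (p : j < rl i) {ys} → (∀ l → j ≤ l → ¬ l < rl (suc i)) → Row T i (suc j) ys →
      length ys ≤ fuel → let k = to T ((i , j) , p) in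
      ∃[ T′ ] settle Λ fuel k T ≡ (proj₁ (insertRow (toℕ k) ys) , T′)
        × Row T′ i j (proj₂ (insertRow (toℕ k) ys))
        × Agree (λ i′ l → i′ ≢ i ⊎ l < j) T T′
    settle-row fuel T i j p below (end ¬p) _ =
      T , settle-stop T k fuel (partner-0 T k entries) , next p refl (end ¬p) , λ _ _ _ _ → refl
      where
      k = to T ((i , j) , p)
      entries : map (to T) (neighbours Λ (from T k)) ≡ []
      entries = trans (neighbours-entries T refl)
        (cong₂ (λ c d → map (to T) (catMaybes (c ∷ d ∷ []))) (cell?-nothing (below j ≤-refl)) (cell?-nothing ¬p))
    settle-row (suc fuel) T i j p {y ∷ ys} below (next p′ refl row) (s≤s len) with toℕ (to T ((i , suc j) , p′)) <? toℕ (to T ((i , j) , p))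
    ... | no y≮k = T , settle-stop T k (suc fuel) (partner-1-stop T k entries y≮k)
                     , next p refl (next p′ refl row) , λ _ _ _ _ → refl
      where
      k = to T ((i , j) , p)
      entries : map (to T) (neighbours Λ (from T k)) ≡ to T ((i , suc j) , p′) ∷ []
      entries = trans (neighbours-entries T refl)
        (cong₂ (λ c d → map (to T) (catMaybes (c ∷ d ∷ []))) (cell?-nothing (below j ≤-refl)) (cell?-just p′))
    ... | yes y<k with settle-row fuel T₁ i (suc j) p′ (λ l sj≤l → below l (<⇒≤ sj≤l))
                         (Row-cong (λ l q lt → swapped-other T c d (λ eq → <⇒≢ (<⇒≤ lt) (sym (cong proj₂ eq))) (λ eq → <⇒≢ lt (sym (cong proj₂ eq)))) row) len
      where
      c d : Cell Λ
      c = (i , j) , p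
      d = (i , suc j) , p′
      T₁ = swapped T c d
    ... | T′ , eq , row′ , agree rewrite swapped-second T ((i , j) , p) ((i , suc j) , p′) =
        T′
      , trans (settle-step T k fuel (partner-1 T k entries y<k)) (cong (map₁ suc) eq)
      , next p (cong toℕ (trans (agree i j p (inj₂ ≤-refl)) (swapped-first T c d))) row′
      , λ { i′ l q (inj₁ i≢) → trans (agree i′ l q (inj₁ i≢)) (swapped-other T c d (λ eq → i≢ (cong proj₁ eq)) (λ eq → i≢ (cong proj₁ eq)))
          ; i′ l q (inj₂ l<j) → trans (agree i′ l q (inj₂ (m≤n⇒m≤1+n l<j)))
              (swapped-other T c d (λ eq → <⇒≢ l<j (cong proj₂ eq)) (λ eq → <⇒≢ (m≤n⇒m≤1+n l<j) (cong proj₂ eq))) }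
      where
      k = to T ((i , j) , p)
      c d : Cell Λ
      c = (i , j) , p
      d = (i , suc j) , p′
      entries : map (to T) (neighbours Λ (from T k)) ≡ to T ((i , suc j) , p′) ∷ []
      entries = trans (neighbours-entries T refl)
        (cong₂ (λ c d → map (to T) (catMaybes (c ∷ d ∷ []))) (cell?-nothing (below j ≤-refl)) (cell?-just p′))

  module _ (a b : ℕ) (a≥b : a ≥ b) (b≥1 : b ≥ 1) where

    private
      Λ : Partition
      Λ = twoRows a b a≥b b≥1

      rl : ℕ → ℕ
      rl = rowLength (parts Λ)

      Rowₜ : Tableau Λ → ℕ → ℕ → List ℕ → Set
      Rowₜ = Row Λ

    SettledTop : ℕ → Tableau Λ → (j : ℕ) → Fin (size Λ) → Rows → Set
    SettledTop fuel T j k (e , xs , ys) = ∃[ T′ ]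
      settle Λ fuel k T ≡ (e , T′) × Rowₜ T′ 0 j xs × Rowₜ T′ 1 j ys × Agree Λ (λ _ l → l < j) T T′

    bottom-last : ∀ {j} l → j ≤ l → ¬ l < rl 2
    bottom-last _ _ ()

    top-step : ∀ {fuel T} {c d : Cell Λ} {e} {T′ : Tableau Λ} →
      exchangePartner Λ T (to T c) ≡ just (to T d) →
      settle Λ fuel (to (swapped Λ T c d) d) (swapped Λ T c d) ≡ (e , T′) →
      settle Λ (suc fuel) (to T c) T ≡ (suc e , T′)
    top-step {fuel} {T} {c} {d} partner eq = trans (settle-step Λ T (to T c) fuel partner)
      (cong (map₁ suc) (trans (cong (λ k → settle Λ fuel k (swapped Λ T c d)) (sym (swapped-second Λ T c d))) eq))

    -- After the exchange with the entry beneath, k continues in the bottom row, where `settle-row`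
    -- takes over.
    settle-down : ∀ fuel T j (p : j < rl 0) (q : j < rl 1) {xs ys} → Rowₜ T 0 (suc j) xs → Rowₜ T 1 (suc j) ys →
      length ys ≤ fuel → let k = to T ((0 , j) , p); y = to T ((1 , j) , q) in
      exchangePartner Λ T k ≡ just y → SettledTop (suc fuel) T j k (moveDown (toℕ k) (toℕ y) xs ys)
    settle-down fuel T j p q {xs} {ys} top bottom len partner
      with settle-row Λ fuel (swapped Λ T ((0 , j) , p) ((1 , j) , q)) 1 j q bottom-last
        (Row-cong Λ (λ l r j<l → swapped-other Λ T _ _ (λ ()) (λ eq → <⇒≢ j<l (sym (cong proj₂ eq)))) bottom) len
    ... | T′ , eq , row , agree =
        T′
      , trans (top-step partner eq) (cong (λ m → suc (proj₁ (insertRow (toℕ m) ys)) , T′) (swapped-second Λ T c d))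
      , next p (cong toℕ (trans (agree 0 j p (inj₁ λ ())) (swapped-first Λ T c d)))
          (Row-cong Λ (λ l r j<l → trans (agree 0 l r (inj₁ λ ()))
            (swapped-other Λ T c d (λ eq → <⇒≢ j<l (sym (cong proj₂ eq))) (λ ()))) top)
      , subst (λ m → Rowₜ T′ 1 j (proj₂ (insertRow (toℕ m) ys))) (swapped-second Λ T c d) row
      , λ i l r l<j → trans (agree i l r (inj₂ l<j))
          (swapped-other Λ T c d (λ eq → <⇒≢ l<j (cong proj₂ eq)) (λ eq → <⇒≢ l<j (cong proj₂ eq)))
      where
      c d : Cell Λ
      c = (0 , j) , p
      d = (1 , j) , q

    settle-top : ∀ fuel T j (p : j < rl 0) {xs ys} → Rowₜ T 0 (suc j) xs → Rowₜ T 1 j ys →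
      length xs + length ys ≤ fuel → let k = to T ((0 , j) , p) in
      SettledTop fuel T j k (slideRows (toℕ k) xs ys)
    settle-top fuel T j p {xs} top (end ¬q) len
      with settle-row Λ fuel T 0 j p (λ l j≤l l<b → ¬q (≤-<-trans j≤l l<b)) top (≤-trans (m≤m+n _ 0) len)
    ... | T′ , eq , row , agree = T′ , eq , row , end ¬q , λ i l r l<j → agree i l r (inj₂ l<j)
    settle-top (suc fuel) T j p {[]} (end ¬p) (next q refl bottom) (s≤s len)
      with toℕ (to T ((1 , j) , q)) <? toℕ (to T ((0 , j) , p))
    ... | yes y<k = settle-down fuel T j p q (end ¬p) bottom len (partner-1 Λ T _ entries y<k)
      where
      entries = trans (neighbours-entries Λ T {p = p} refl)
        (cong₂ (λ c d → map (to T) (catMaybes (c ∷ d ∷ []))) (cell?-just Λ q) (cell?-nothing Λ {0} ¬p))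
    ... | no  y≮k = T , settle-stop Λ T _ (suc fuel) (partner-1-stop Λ T _ entries y≮k)
                      , next p refl (end ¬p) , next q refl bottom , λ _ _ _ _ → refl
      where
      entries = trans (neighbours-entries Λ T {p = p} refl)
        (cong₂ (λ c d → map (to T) (catMaybes (c ∷ d ∷ []))) (cell?-just Λ q) (cell?-nothing Λ {0} ¬p))
    settle-top (suc fuel) T j p {x ∷ xs} {y ∷ ys} (next p′ refl top) (next q refl bottom) (s≤s len)
      -- These are the comparisons of `slideRows` in the same order, so its value reduces along with
      -- the goal.
      with toℕ (to T ((1 , j) , q)) <? toℕ (to T ((0 , suc j) , p′))
         | toℕ (to T ((1 , j) , q)) <? toℕ (to T ((0 , j) , p))
         | toℕ (to T ((0 , suc j) , p′)) <? toℕ (to T ((0 , j) , p))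
         | trans (neighbours-entries Λ T {p = p} refl)
             (cong₂ (λ c d → map (to T) (catMaybes (c ∷ d ∷ []))) (cell?-just Λ q) (cell?-just Λ p′))
    ... | yes y<x | yes y<k | _       | entries = settle-down fuel T j p q (next p′ refl top) bottom
      (≤-trans (≤-trans (n≤1+n _) (m≤n+m (suc (length ys)) (length xs))) len) (partner-first Λ T _ entries y<x y<k)
    ... | yes y<x | no  y≮k | _       | entries =
      T , settle-stop Λ T _ (suc fuel) (partner-2-stop Λ T _ entries y≮k (λ x<k → y≮k (<-trans y<x x<k)))
        , next p refl (next p′ refl top) , next q refl bottom , λ _ _ _ _ → refl
    ... | no  y≮x | _       | no  x≮k | entries =
      T , settle-stop Λ T _ (suc fuel) (partner-2-stop Λ T _ entries (λ y<k → x≮k (≤-<-trans (≮⇒≥ y≮x) y<k)) x≮k)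
        , next p refl (next p′ refl top) , next q refl bottom , λ _ _ _ _ → refl
    ... | no  y≮x | _       | yes x<k | entries
      with settle-top fuel (swapped Λ T ((0 , j) , p) ((0 , suc j) , p′)) (suc j) p′
        (Row-cong Λ (λ l r lt → swapped-other Λ T _ _ (λ eq → <⇒≢ (<⇒≤ lt) (sym (cong proj₂ eq))) (λ eq → <⇒≢ lt (sym (cong proj₂ eq)))) top)
        (Row-cong Λ (λ l r lt → swapped-other Λ T _ _ (λ ()) (λ ())) bottom)
        (≤-trans (+-monoʳ-≤ (length xs) (n≤1+n _)) len)
    ... | T′ , eq , top′ , bottom′ , agree =
        T′
      , trans (top-step (partner-second Λ T _ entries y≮x x<k) eq)
          (cong (λ m → suc (proj₁ (slideRows (toℕ m) xs ys)) , T′) (swapped-second Λ T c d))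
      , next p (cong toℕ (trans (agree 0 j p ≤-refl) (swapped-first Λ T c d)))
          (subst (λ m → Rowₜ T′ 0 (suc j) (proj₁ (proj₂ (slideRows (toℕ m) xs ys)))) (swapped-second Λ T c d) top′)
      , next q (cong toℕ (trans (agree 1 j q ≤-refl) (swapped-other Λ T c d (λ ()) (λ ()))))
          (subst (λ m → Rowₜ T′ 1 (suc j) (proj₂ (proj₂ (slideRows (toℕ m) xs ys)))) (swapped-second Λ T c d) bottom′)
      , λ i l r l<j → trans (agree i l r (m≤n⇒m≤1+n l<j))
          (swapped-other Λ T c d (λ eq → <⇒≢ l<j (cong proj₂ eq)) (λ eq → <⇒≢ (m≤n⇒m≤1+n l<j) (cong proj₂ eq)))
      where
      c d : Cell Λ
      c = (0 , j) , p
      d = (0 , suc j) , p′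

    -- The columns still to be processed, in the order of processing; `cellsBefore a` reduces to
    -- `cellsDecreasing Λ`.
    cellsBefore : ℕ → List (Cell Λ)
    cellsBefore j = catMaybes (map (cell? Λ) (cartesianProductWith (λ j i → i , j) (downFrom j) (1 ∷ 0 ∷ [])))

    cellsBefore-both : ∀ {j} (p : j < rl 0) (q : j < rl 1) →
      cellsBefore (suc j) ≡ ((1 , j) , q) ∷ ((0 , j) , p) ∷ cellsBefore j
    cellsBefore-both {j} p q = cong₂ (λ c d → catMaybes (c ∷ d ∷ map (cell? Λ) (cartesianProductWith (λ j i → i , j) (downFrom j) (1 ∷ 0 ∷ []))))
      (cell?-just Λ q) (cell?-just Λ p)

    cellsBefore-top : ∀ {j} (p : j < rl 0) → ¬ j < rl 1 → cellsBefore (suc j) ≡ ((0 , j) , p) ∷ cellsBefore j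
    cellsBefore-top {j} p ¬q = cong₂ (λ c d → catMaybes (c ∷ d ∷ map (cell? Λ) (cartesianProductWith (λ j i → i , j) (downFrom j) (1 ∷ 0 ∷ []))))
      (cell?-nothing Λ {1} ¬q) (cell?-just Λ p)

    columns : List ℕ → List ℕ → Rows
    columns []       _        = 0 , [] , []
    columns (x ∷ xs) []       = insertTop x (columns xs [])
    columns (x ∷ xs) (y ∷ ys) = insertTop x (insertBottom y (columns xs ys))

    columns-run : ∀ xs ys → length ys ≤ length xs → columns xs ys ≡ run (length ys) (interleave xs ys)
    columns-run []       []       _        = refl
    columns-run (x ∷ xs) []       _        = cong (insertTop x) (trans (columns-run xs [] z≤n) (cong (run 0) (interleave-[] xs)))
      where
      interleave-[] : ∀ (xs : List ℕ) → interleave xs [] ≡ xs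
      interleave-[] []       = refl
      interleave-[] (x ∷ xs) = refl
    columns-run (x ∷ xs) (y ∷ ys) (s≤s le) = cong (λ s → insertTop x (insertBottom y s)) (columns-run xs ys le)

    enough : ∀ {T i j xs ys} → Rowₜ T 0 i xs → Rowₜ T 1 j ys → length xs + length ys ≤ enoughFuel Λ
    enough top bottom = ≤-trans (+-mono-≤ (Row-length Λ top) (≤-trans (Row-length Λ bottom) (m≤m+n b 0))) (m≤n+m _ 2)

    module _ (T₀ : Tableau Λ) where

      round-settle : ∀ e T {c e′ T′} → to T c ≡ to T₀ c → settle Λ (enoughFuel Λ) (to T c) T ≡ (e′ , T′) →
        round Λ T₀ (e , T) c ≡ (e + e′ , T′)
      round-settle e T same eq = cong (map₁ (e +_)) (trans (cong (λ k → settle Λ (enoughFuel Λ) k T) (sym same)) eq)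

      Swept : ℕ → ℕ × Tableau Λ → Set
      Swept j s = ∃[ X ] ∃[ Y ] Rowₜ T₀ 0 0 X × Rowₜ T₀ 1 0 Y ×
        proj₁ (foldl (round Λ T₀) s (cellsBefore j)) ≡ proj₁ (columns X Y)

      -- The loop invariant: X and Y are the initial entries of the columns from j on, T holds there
      -- the rows that `columns` makes of them, and the columns before j are untouched, so a round
      -- finds the same entry in T as in T₀.
      sweep : ∀ j {X Y e T xs ys} → j ≤ a → Rowₜ T₀ 0 j X → Rowₜ T₀ 1 j Y →
        columns X Y ≡ (e , xs , ys) → Rowₜ T 0 j xs → Rowₜ T 1 j ys → Agree Λ (λ _ l → l < j) T₀ T →
        Swept j (e , T)

      sweep-suc : ∀ j {X Y e T xs ys} → Dec (j < b) → suc j ≤ a → Rowₜ T₀ 0 (suc j) X → Rowₜ T₀ 1 (suc j) Y →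
        columns X Y ≡ (e , xs , ys) → Rowₜ T 0 (suc j) xs → Rowₜ T 1 (suc j) ys → Agree Λ (λ _ l → l < suc j) T₀ T →
        Swept (suc j) (e , T)

      sweep zero {X} {Y} _ top₀ bottom₀ eq _ _ _ = X , Y , top₀ , bottom₀ , cong proj₁ (sym eq)
      sweep (suc j) = sweep-suc j (j <? b)

      sweep-suc j {X} {Y} {e} {T} {xs} {ys} (yes q) j<a top₀ bottom₀ eq top bottom agree
        with settle-row Λ (enoughFuel Λ) T 1 j q bottom-last bottom (≤-trans (m≤n+m _ (length xs)) (enough top bottom))
      ... | T₁ , eq₁ , bottom₁ , agree₁
        with settle-top (enoughFuel Λ) T₁ j j<a (Row-cong Λ (λ l r _ → agree₁ 0 l r (inj₁ λ ())) top) bottom₁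
               (enough (Row-cong Λ (λ l r _ → agree₁ 0 l r (inj₁ λ ())) top) bottom₁)
      ... | T₂ , eq₂ , top₂ , bottom₂ , agree₂
        with sweep j {toℕ x₀ ∷ X} {toℕ y₀ ∷ Y} (<⇒≤ j<a) (next j<a refl top₀) (next q refl bottom₀) step top₂ bottom₂
               (λ i l r l<j → trans (agree₂ i l r l<j) (trans (agree₁ i l r (inj₂ l<j)) (agree i l r (m≤n⇒m≤1+n l<j))))
        where
        x₀ = to T₀ ((0 , j) , j<a)
        y₀ = to T₀ ((1 , j) , q)
        x≡ : to T₁ ((0 , j) , j<a) ≡ x₀
        x≡ = trans (agree₁ 0 j j<a (inj₁ λ ())) (agree 0 j j<a ≤-refl)
        y≡ : to T ((1 , j) , q) ≡ y₀
        y≡ = agree 1 j q ≤-refl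
        r₁ = insertRow (toℕ (to T ((1 , j) , q))) ys
        step : columns (toℕ x₀ ∷ X) (toℕ y₀ ∷ Y)
          ≡ map₁ (e + proj₁ r₁ +_) (slideRows (toℕ (to T₁ ((0 , j) , j<a))) xs (proj₂ r₁))
        step = begin
          insertTop (toℕ x₀) (insertBottom (toℕ y₀) (columns X Y))
            ≡⟨ cong (λ s → insertTop (toℕ x₀) (insertBottom (toℕ y₀) s)) eq ⟩
          insertTop (toℕ x₀) (insertBottom (toℕ y₀) (e , xs , ys))
            ≡⟨ cong₂ (λ x y → insertTop (toℕ x) (insertBottom (toℕ y) (e , xs , ys))) x≡ y≡ ⟨
          map₁ (e + proj₁ r₁ +_) (slideRows (toℕ (to T₁ ((0 , j) , j<a))) xs (proj₂ r₁)) ∎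
      ...   | X′ , Y′ , topX , bottomY , final = X′ , Y′ , topX , bottomY , trans (cong proj₁ unfold) final
        where
        r₁ = insertRow (toℕ (to T ((1 , j) , q))) ys
        r₂ = slideRows (toℕ (to T₁ ((0 , j) , j<a))) xs (proj₂ r₁)
        unfold : foldl (round Λ T₀) (e , T) (cellsBefore (suc j)) ≡ foldl (round Λ T₀) (e + proj₁ r₁ + proj₁ r₂ , T₂) (cellsBefore j)
        unfold = begin
          foldl (round Λ T₀) (e , T) (cellsBefore (suc j))
            ≡⟨ cong (foldl (round Λ T₀) (e , T)) (cellsBefore-both j<a q) ⟩
          foldl (round Λ T₀) (round Λ T₀ (round Λ T₀ (e , T) ((1 , j) , q)) ((0 , j) , j<a)) (cellsBefore j)
            ≡⟨ cong (λ s → foldl (round Λ T₀) (round Λ T₀ s ((0 , j) , j<a)) (cellsBefore j))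
                 (round-settle e T (agree 1 j q ≤-refl) eq₁) ⟩
          foldl (round Λ T₀) (round Λ T₀ (e + proj₁ r₁ , T₁) ((0 , j) , j<a)) (cellsBefore j)
            ≡⟨ cong (λ s → foldl (round Λ T₀) s (cellsBefore j)) (round-settle (e + proj₁ r₁) T₁
                 (trans (agree₁ 0 j j<a (inj₁ λ ())) (agree 0 j j<a ≤-refl)) eq₂) ⟩
          foldl (round Λ T₀) (e + proj₁ r₁ + proj₁ r₂ , T₂) (cellsBefore j) ∎
      sweep-suc j {X} {Y} {e} {T} {xs} {ys} (no ¬q) j<a top₀ bottom₀ eq top bottom agree
        -- A column without a bottom cell has none to its right either, so Y and ys are empty.
        with Row-unique Λ bottom₀ (end λ q → ¬q (<⇒≤ q)) | Row-unique Λ bottom (end λ q → ¬q (<⇒≤ q))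
      ... | refl | refl
        with settle-top (enoughFuel Λ) T j j<a top (end ¬q) (enough top (end ¬q))
      ... | T₂ , eq₂ , top₂ , bottom₂ , agree₂
        with sweep j {toℕ (to T₀ ((0 , j) , j<a)) ∷ X} {[]} (<⇒≤ j<a) (next j<a refl top₀) (end ¬q) step top₂ bottom₂
               (λ i l r l<j → trans (agree₂ i l r l<j) (agree i l r (m≤n⇒m≤1+n l<j)))
        where
        step : columns (toℕ (to T₀ ((0 , j) , j<a)) ∷ X) []
          ≡ map₁ (e +_) (slideRows (toℕ (to T ((0 , j) , j<a))) xs [])
        step = begin
          insertTop (toℕ (to T₀ ((0 , j) , j<a))) (columns X [])
            ≡⟨ cong (insertTop (toℕ (to T₀ ((0 , j) , j<a)))) eq ⟩
          insertTop (toℕ (to T₀ ((0 , j) , j<a))) (e , xs , [])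
            ≡⟨ cong (λ x → insertTop (toℕ x) (e , xs , [])) (agree 0 j j<a ≤-refl) ⟨
          map₁ (e +_) (slideRows (toℕ (to T ((0 , j) , j<a))) xs []) ∎
      ...   | X′ , Y′ , topX , bottomY , final = X′ , Y′ , topX , bottomY , trans (cong proj₁ unfold) final
        where
        r = slideRows (toℕ (to T ((0 , j) , j<a))) xs []
        unfold : foldl (round Λ T₀) (e , T) (cellsBefore (suc j)) ≡ foldl (round Λ T₀) (e + proj₁ r , T₂) (cellsBefore j)
        unfold = begin
          foldl (round Λ T₀) (e , T) (cellsBefore (suc j))
            ≡⟨ cong (foldl (round Λ T₀) (e , T)) (cellsBefore-top j<a ¬q) ⟩
          foldl (round Λ T₀) (round Λ T₀ (e , T) ((0 , j) , j<a)) (cellsBefore j)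
            ≡⟨ cong (λ s → foldl (round Λ T₀) s (cellsBefore j)) (round-settle e T (agree 0 j j<a ≤-refl) eq₂) ⟩
          foldl (round Λ T₀) (e + proj₁ r , T₂) (cellsBefore j) ∎

      exchanges-columns : ∀ {X Y} → Rowₜ T₀ 0 0 X → Rowₜ T₀ 1 0 Y → exchanges Λ T₀ ≡ proj₁ (columns X Y)
      exchanges-columns top bottom with sweep a {[]} {[]} ≤-refl (end (<-irrefl refl)) (end (≤⇒≯ a≥b)) refl
        (end (<-irrefl refl)) (end (≤⇒≯ a≥b)) (λ _ _ _ _ → refl)
      ... | X′ , Y′ , top′ , bottom′ , eq =
        trans eq (cong₂ (λ X Y → proj₁ (columns X Y)) (Row-unique Λ top′ top) (Row-unique Λ bottom′ bottom))

    Row-tabulate : ∀ {T i} m j (g : Fin m → ℕ) → j + m ≡ rl i →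
      (∀ l (q : l < rl i) r → l ≡ j + toℕ r → toℕ (to T ((i , l) , q)) ≡ g r) → Rowₜ T i j (tabulate g)
    Row-tabulate zero    j g j≡ values = end λ j< → <-irrefl (trans (sym (+-identityʳ j)) j≡) j<
    Row-tabulate {T} {i} (suc m) j g j≡ values = next p (values j p Fin.zero (sym (+-identityʳ j)))
      (Row-tabulate m (suc j) (g ∘ Fin.suc) (trans (sym (+-suc j m)) j≡)
        λ l q r l≡ → values l q (Fin.suc r) (trans l≡ (sym (+-suc j (toℕ r)))))
      where
      p : j < rl i
      p = subst (j <_) j≡ (m<m+n j z<s)

    take-tabulate : ∀ {A : Set} m n (f : Fin (m + n) → A) → take m (tabulate f) ≡ tabulate (λ i → f (i ↑ˡ n))
    take-tabulate zero    n f = refl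
    take-tabulate (suc m) n f = cong (f Fin.zero ∷_) (take-tabulate m n (f ∘ Fin.suc))

    drop-tabulate : ∀ {A : Set} m n (f : Fin (m + n) → A) → drop m (tabulate f) ≡ tabulate (λ i → f (m ↑ʳ i))
    drop-tabulate zero    n f = refl
    drop-tabulate (suc m) n f = drop-tabulate m n (f ∘ Fin.suc)

    map-interleave : ∀ {A B : Set} (f : A → B) xs ys → map f (interleave xs ys) ≡ interleave (map f xs) (map f ys)
    map-interleave f []       ys       = refl
    map-interleave f (x ∷ xs) []       = refl
    map-interleave f (x ∷ xs) (y ∷ ys) = cong (λ v → f x ∷ f y ∷ v) (map-interleave f xs ys)

    -- `numbering` runs through the top row first, so the first a letters of `word π` form the top
    -- row and the others the bottom row.
    exchanges-run : ∀ (π : Permutation′ (size Λ)) →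
      exchanges Λ (π ↔-∘ numbering (parts Λ)) ≡ proj₁ (run b (map toℕ (columnwise a (word π))))
    exchanges-run π = begin
      exchanges Λ (π ↔-∘ numbering (parts Λ))
        ≡⟨ exchanges-columns _ top bottom ⟩
      proj₁ (columns X Y)
        ≡⟨ cong proj₁ (columns-run X Y (subst₂ _≤_ (sym (trans (length-tabulate g₁) (+-identityʳ b))) (sym (length-tabulate g₀)) a≥b)) ⟩
      proj₁ (run (length Y) (interleave X Y))
        ≡⟨ cong (λ m → proj₁ (run m (interleave X Y))) (trans (length-tabulate g₁) (+-identityʳ b)) ⟩
      proj₁ (run b (interleave X Y))
        ≡⟨ cong₂ (λ X Y → proj₁ (run b (interleave X Y))) (row (take a) (take-tabulate a (b + 0) (π ⟨$⟩ʳ_)))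
             (row (drop a) (drop-tabulate a (b + 0) (π ⟨$⟩ʳ_))) ⟩
      proj₁ (run b (interleave (map toℕ (take a (word π))) (map toℕ (drop a (word π)))))
        ≡⟨ cong (λ w → proj₁ (run b w)) (map-interleave toℕ (take a (word π)) (drop a (word π))) ⟨
      proj₁ (run b (map toℕ (columnwise a (word π)))) ∎
      where
      g₀ : Fin a → ℕ
      g₀ r = toℕ (π ⟨$⟩ʳ (r ↑ˡ (b + 0)))
      g₁ : Fin (b + 0) → ℕ
      g₁ r = toℕ (π ⟨$⟩ʳ (a ↑ʳ r))
      X Y : List ℕ
      X = tabulate g₀
      Y = tabulate g₁
      row : ∀ {m} (f : List (Fin (size Λ)) → List (Fin (size Λ))) {h : Fin m → Fin (size Λ)} → f (word π) ≡ tabulate h →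
        tabulate (λ r → toℕ (h r)) ≡ map toℕ (f (word π))
      row f {h} eq = trans (sym (map-tabulate h toℕ)) (cong (map toℕ) (sym eq))
      top : Rowₜ (π ↔-∘ numbering (parts Λ)) 0 0 X
      top = Row-tabulate a 0 g₀ refl λ l q r l≡ → cong (λ i → toℕ (π ⟨$⟩ʳ (i ↑ˡ (b + 0))))
        (Fin.toℕ-injective (trans (Fin.toℕ-fromℕ< q) l≡))
      bottom : Rowₜ (π ↔-∘ numbering (parts Λ)) 1 0 Y
      bottom = Row-tabulate (b + 0) 0 g₁ (+-identityʳ b) λ l q r l≡ → cong (λ i → toℕ (π ⟨$⟩ʳ (a ↑ʳ i)))
        (Fin.toℕ-injective (trans (Fin.toℕ-↑ˡ (fromℕ< q) 0) (trans (Fin.toℕ-fromℕ< q) l≡)))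

-- Averages, alternating sums and beta integrals

module Rationals where

  open import Defs using (pochhammer; pochhammer≢0; ∑₁)
  open Fibres using (cancel)
  open PathCounts
  open Outcomes
  open import Data.Integer.Base as ℤ using (ℤ; +_; -1ℤ)
  import Data.Integer.Properties as ℤ
  open import Data.Nat.Base as ℕ using (ℕ; zero; suc; _∸_; _!; NonZero)
  import Data.Nat.Properties as ℕ
  open import Data.Nat.Combinatorics using (_C_; nC1≡n; nCk+nC[k+1]≡[n+1]C[k+1])
  open import Data.Nat.Tactic.RingSolver using (solve-∀)
  open import Data.Rational.Base using (ℚ; 0ℚ; 1ℚ; _/_; _+_; _-_; _*_; -_)
  open import Data.Rational.Properties hiding (_≟_)
  open import Data.Rational.Solver using (module +-*-Solver)
  open import Data.Rational.Unnormalised.Base as ℚᵘ using (mkℚᵘ; *≡*)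
  import Data.Rational.Unnormalised.Properties as ℚᵘ
  open import Relation.Binary.PropositionalEquality using (_≡_; refl; sym; trans; cong; cong₂; subst; module ≡-Reasoning)
  open +-*-Solver using (Polynomial; solve; _:=_; _:+_; _:*_; _:-_; :-_; con)

  open ≡-Reasoning

  κ : ℤ → ℚ
  κ i = i / 1

  ι : ℕ → ℚ
  ι n = κ (+ n)

  κ-+ : ∀ i j → κ (i ℤ.+ j) ≡ κ i + κ j
  κ-+ i j = toℚᵘ-injective (ℚᵘ.≃-trans (toℚᵘ-fromℚᵘ (mkℚᵘ (i ℤ.+ j) 0)) (ℚᵘ.≃-trans
    (*≡* (cong (ℤ._* + 1) (sym (cong₂ ℤ._+_ (ℤ.*-identityʳ i) (ℤ.*-identityʳ j)))))
    (ℚᵘ.≃-sym (ℚᵘ.≃-trans (toℚᵘ-homo-+ (κ i) (κ j))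
      (ℚᵘ.+-cong (toℚᵘ-fromℚᵘ (mkℚᵘ i 0)) (toℚᵘ-fromℚᵘ (mkℚᵘ j 0)))))))

  κ-* : ∀ i j → κ (i ℤ.* j) ≡ κ i * κ j
  κ-* i j = toℚᵘ-injective (ℚᵘ.≃-trans (toℚᵘ-fromℚᵘ (mkℚᵘ (i ℤ.* j) 0)) 
    (ℚᵘ.≃-sym (ℚᵘ.≃-trans (toℚᵘ-homo-* (κ i) (κ j))
      (ℚᵘ.*-cong (toℚᵘ-fromℚᵘ (mkℚᵘ i 0)) (toℚᵘ-fromℚᵘ (mkℚᵘ j 0))))))

  κ-neg : ∀ i → κ (ℤ.- i) ≡ - κ i
  κ-neg i = toℚᵘ-injective (ℚᵘ.≃-trans (toℚᵘ-fromℚᵘ (mkℚᵘ (ℤ.- i) 0))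
    (ℚᵘ.≃-sym (ℚᵘ.≃-trans (toℚᵘ-homo‿- (κ i)) (ℚᵘ.-‿cong (toℚᵘ-fromℚᵘ (mkℚᵘ i 0))))))

  ι-+ : ∀ m n → ι (m ℕ.+ n) ≡ ι m + ι n
  ι-+ m n = κ-+ (+ m) (+ n)

  ι-suc : ∀ n → ι (suc n) ≡ ι n + 1ℚ
  ι-suc n = trans (ι-+ 1 n) (+-comm 1ℚ (ι n))

  ι-* : ∀ m n → ι (m ℕ.* n) ≡ ι m * ι n
  ι-* m n = trans (cong κ (ℤ.pos-* m n)) (κ-* (+ m) (+ n))

  fraction : ∀ i n .{{_ : NonZero n}} → (i / n) * ι n ≡ κ i
  fraction i n@(suc m) = toℚᵘ-injective (ℚᵘ.≃-trans (toℚᵘ-homo-* (i / n) (ι n)) (ℚᵘ.≃-trans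
    (ℚᵘ.*-cong (toℚᵘ-fromℚᵘ (mkℚᵘ i m)) (toℚᵘ-fromℚᵘ (mkℚᵘ (+ n) 0))) (ℚᵘ.≃-trans
    (*≡* (ℤ.*-assoc i (+ n) (+ 1)))
    (ℚᵘ.≃-sym (toℚᵘ-fromℚᵘ (mkℚᵘ i 0))))))

  -- Total, with value 0 at 0, so that formulas can be stated without `NonZero` instances; these
  -- enter only where a product with the reciprocal is simplified.
  recip : ℕ → ℚ
  recip zero    = 0ℚ
  recip (suc n) = + 1 / suc n

  recip-inverse : ∀ n .{{_ : NonZero n}} → recip n * ι n ≡ 1ℚ
  recip-inverse n@(suc _) = fraction (+ 1) n

  ι-cancel : ∀ n .{{_ : NonZero n}} {p q} → p * ι n ≡ q * ι n → p ≡ q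
  ι-cancel n {p} {q} eq = begin
    p                   ≡⟨ expand p ⟩
    p * ι n * recip n   ≡⟨ cong (_* recip n) eq ⟩
    q * ι n * recip n   ≡⟨ expand q ⟨
    q                   ∎
    where
    expand : ∀ p → p ≡ p * ι n * recip n
    expand p = begin
      p                   ≡⟨ *-identityʳ p ⟨
      p * 1ℚ              ≡⟨ cong (p *_) (recip-inverse n) ⟨
      p * (recip n * ι n) ≡⟨ cong (p *_) (*-comm (recip n) (ι n)) ⟩
      p * (ι n * recip n) ≡⟨ *-assoc p (ι n) (recip n) ⟨
      p * ι n * recip n   ∎

  /-recip : ∀ i n .{{_ : NonZero n}} → i / n ≡ κ i * recip n
  /-recip i n = ι-cancel n (begin
    (i / n) * ι n         ≡⟨ fraction i n ⟩
    κ i                   ≡⟨ *-identityʳ (κ i) ⟨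
    κ i * 1ℚ              ≡⟨ cong (κ i *_) (recip-inverse n) ⟨
    κ i * (recip n * ι n) ≡⟨ *-assoc (κ i) (recip n) (ι n) ⟨
    κ i * recip n * ι n   ∎)

  recip-extend : ∀ m n .{{_ : NonZero m}} .{{_ : NonZero n}} → recip m ≡ recip (m ℕ.* n) * ι n
  recip-extend m n = ι-cancel m (begin
    recip m * ι m                   ≡⟨ recip-inverse m ⟩
    1ℚ                              ≡⟨ recip-inverse (m ℕ.* n) ⟨
    recip (m ℕ.* n) * ι (m ℕ.* n)   ≡⟨ cong (recip (m ℕ.* n) *_) (trans (ι-* m n) (*-comm (ι m) (ι n))) ⟩
    recip (m ℕ.* n) * (ι n * ι m)   ≡⟨ *-assoc (recip (m ℕ.* n)) (ι n) (ι m) ⟨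
    recip (m ℕ.* n) * ι n * ι m     ∎)
    where instance _ = ℕ.m*n≢0 m n

  -- The m-th alternating difference at 0. If s k is the integral of t²ᵏ against a weight, each
  -- difference multiplies the integrand by 1 - t².
  difference : ℕ → (ℕ → ℚ) → ℚ
  difference zero    s = s 0
  difference (suc m) s = difference m (λ k → s k - s (suc k))

  difference-cong : ∀ m {s t : ℕ → ℚ} → (∀ k → s k ≡ t k) → difference m s ≡ difference m t
  difference-cong zero    eq = eq 0
  difference-cong (suc m) eq = difference-cong m λ k → cong₂ _-_ (eq k) (eq (suc k))

  difference-linear : ∀ m c (s t : ℕ → ℚ) → difference m (λ k → c * s k - t k) ≡ c * difference m s - difference m t
  difference-linear zero    c s t = refl
  difference-linear (suc m) c s t = trans
    (difference-cong m λ k → solve 5 (λ c s s′ t t′ →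
      (c :* s :- t) :- (c :* s′ :- t′) := c :* (s :- s′) :- (t :- t′)) refl c (s k) (s (suc k)) (t k) (t (suc k)))
    (difference-linear m c (λ k → s k - s (suc k)) (λ k → t k - t (suc k)))

  difference-suc : ∀ m s → difference (suc m) s ≡ difference m s - difference m (λ k → s (suc k))
  difference-suc m s = trans
    (difference-cong m λ k → cong (_- s (suc k)) (sym (*-identityˡ (s k))))
    (trans (difference-linear m 1ℚ s (λ k → s (suc k)))
           (cong (_- difference m (λ k → s (suc k))) (*-identityˡ (difference m s))))

  ∑₁-cong : ∀ n {f g : ℕ → ℚ} → (∀ k → f (suc k) ≡ g (suc k)) → ∑₁ n f ≡ ∑₁ n g
  ∑₁-cong zero    eq = refl
  ∑₁-cong (suc n) eq = cong₂ _+_ (∑₁-cong n eq) (eq n)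

  sign : ℕ → ℚ
  sign k = κ (-1ℤ ℤ.^ k)

  sign-suc : ∀ k → sign (suc k) ≡ - sign k
  sign-suc k = trans (cong κ (ℤ.-1*i≡-i (-1ℤ ℤ.^ k))) (κ-neg (-1ℤ ℤ.^ k))

  binomial-term : ℕ → (ℕ → ℚ) → ℕ → ℚ
  binomial-term b s k = ι (b C k) * sign k * s k

  -- The upper limit n is free because Pascal's rule splits the sum for b + 1 into two sums for b
  -- whose limits differ by one. The term k = 0 stands apart, as `∑₁` starts at 1.
  difference-binomial : ∀ b n s → b ℕ.≤ n → s 0 + ∑₁ n (binomial-term b s) ≡ difference b s
  difference-binomial zero n s _ = trans (cong (λ y → s 0 + y) (vanish n)) (+-identityʳ (s 0))
    where
    vanish : ∀ n → ∑₁ n (binomial-term 0 s) ≡ 0ℚ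
    vanish zero    = refl
    vanish (suc n) = trans (cong₂ _+_ (vanish n)
      (trans (cong (_* s (suc n)) (*-zeroˡ (sign (suc n)))) (*-zeroˡ (s (suc n))))) (+-identityˡ 0ℚ)
  difference-binomial (suc b) (suc n) s (ℕ.s≤s b≤n) = begin
    s 0 + ∑₁ (suc n) (binomial-term (suc b) s)
      ≡⟨ cong (λ y → s 0 + y) (split n) ⟩
    s 0 + (∑₁ (suc n) (binomial-term b s) - (s 1 + ∑₁ n (binomial-term b (λ k → s (suc k)))))
      ≡⟨ +-assoc (s 0) _ _ ⟨
    s 0 + ∑₁ (suc n) (binomial-term b s) - (s 1 + ∑₁ n (binomial-term b (λ k → s (suc k))))
      ≡⟨ cong₂ _-_ (difference-binomial b (suc n) s (ℕ.m≤n⇒m≤1+n b≤n)) (difference-binomial b n (λ k → s (suc k)) b≤n) ⟩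
    difference b s - difference b (λ k → s (suc k))
      ≡⟨ difference-suc b s ⟨
    difference (suc b) s ∎
    where
    term : ∀ k → binomial-term (suc b) s (suc k) ≡ binomial-term b s (suc k) - binomial-term b (λ k → s (suc k)) k
    term k = begin
      ι (suc b C suc k) * sign (suc k) * s (suc k)
        ≡⟨ cong₂ (λ c ε → c * ε * s (suc k)) (trans (cong ι (sym (nCk+nC[k+1]≡[n+1]C[k+1] b k))) (ι-+ (b C k) _)) (sign-suc k) ⟩
      (ι (b C k) + ι (b C suc k)) * (- sign k) * s (suc k)
        ≡⟨ solve 4 (λ x y ε t → (x :+ y) :* (:- ε) :* t := y :* (:- ε) :* t :- x :* ε :* t) refl
             (ι (b C k)) (ι (b C suc k)) (sign k) (s (suc k)) ⟩
      ι (b C suc k) * (- sign k) * s (suc k) - ι (b C k) * sign k * s (suc k)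
        ≡⟨ cong (λ ε → ι (b C suc k) * ε * s (suc k) - ι (b C k) * sign k * s (suc k)) (sign-suc k) ⟨
      binomial-term b s (suc k) - binomial-term b (λ k → s (suc k)) k ∎
    s′ : ℕ → ℚ
    s′ k = s (suc k)
    split : ∀ n → ∑₁ (suc n) (binomial-term (suc b) s)
      ≡ ∑₁ (suc n) (binomial-term b s) - (s 1 + ∑₁ n (binomial-term b s′))
    split zero = trans (cong (λ y → 0ℚ + y) (term 0)) (solve 2 (λ x y →
      con 0ℚ :+ (x :- con (ι 1) :* con (κ (+ 1)) :* y) := con 0ℚ :+ x :- (y :+ con 0ℚ)) refl (binomial-term b s 1) (s 1))
    split (suc n) = trans (cong₂ _+_ (split n) (term (suc n))) (solve 5 (λ a z c x y →
      a :- (z :+ c) :+ (x :- y) := a :+ x :- (z :+ (c :+ y))) refl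
      (∑₁ (suc n) (binomial-term b s)) (s 1) (∑₁ n (binomial-term b s′)) (binomial-term b s (2 ℕ.+ n)) (binomial-term b s′ (suc n)))

  -- The values of the integrals of t²ʲ (1 - t)ˣ⁻¹ over [0,1].
  beta : ℕ → ℕ → ℚ
  beta x j = ι ((2 ℕ.* j) !) * recip (pochhammer x (suc (2 ℕ.* j)))

  pochhammer-front : ∀ x k → pochhammer x (suc k) ≡ x ℕ.* pochhammer (suc x) k
  pochhammer-front x zero    = trans (ℕ.+-identityʳ (x ℕ.+ 0)) (trans (ℕ.+-identityʳ x) (sym (ℕ.*-identityʳ x)))
  pochhammer-front x (suc k) = trans (cong (ℕ._* (x ℕ.+ suc k)) (pochhammer-front x k)) (trans
    (ℕ.*-assoc x _ _) (cong (λ y → x ℕ.* (pochhammer (suc x) k ℕ.* y)) (ℕ.+-suc x k)))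

  -- Under the integral this is 1 - t² = 2 (1 - t) - (1 - t)². The proof brings all four values to
  -- the denominator P, whose reciprocal is q.
  beta-step : ∀ x j → beta (suc x) j - beta (suc x) (suc j) ≡ ι 2 * beta (2 ℕ.+ x) j - beta (3 ℕ.+ x) j
  beta-step x j = begin
    beta (suc x) j - beta (suc x) (suc j)
      ≡⟨ cong₂ _-_ (cong (ι F *_) first) (cong₂ _*_ factorial last) ⟩
    ι F * (q * (X + ι 2 * J + 1ℚ) * (X + ι 2 * J + ι 2)) - ι F * ((ι 2 * J + 1ℚ) * (ι 2 * J + ι 2)) * q
      ≡⟨ solve 4 (λ q X J F →
           F :* (q :* (X :+ two :* J :+ one) :* (X :+ two :* J :+ two)) :- F :* ((two :* J :+ one) :* (two :* J :+ two)) :* q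
           := two :* (F :* (q :* X :* (X :+ two :* J :+ two))) :- F :* (q :* X :* (X :+ one))) refl q X J (ι F) ⟩
    ι 2 * (ι F * (q * X * (X + ι 2 * J + ι 2))) - ι F * (q * X * (X + 1ℚ))
      ≡⟨ cong₂ _-_ (cong (λ y → ι 2 * (ι F * y)) second) (cong (ι F *_) third) ⟨
    ι 2 * beta (2 ℕ.+ x) j - beta (3 ℕ.+ x) j ∎
    where
    two one : ∀ {n} → Polynomial n
    two = con (ι 2)
    one = con 1ℚ
    F = (2 ℕ.* j) !
    k = 2 ℕ.* j
    P = pochhammer (suc x) (3 ℕ.+ k)
    q = recip P
    X = ι (suc x)
    J = ι j
    instance
      _ = pochhammer≢0 (suc x) (suc k)
      _ = pochhammer≢0 (2 ℕ.+ x) (suc k)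
      _ = pochhammer≢0 (3 ℕ.+ x) (suc k)

    ι-k : ι k ≡ ι 2 * J
    ι-k = ι-* 2 j
    ι-2 : ∀ n → ι (2 ℕ.+ n) ≡ ι n + ι 2
    ι-2 n = trans (ι-+ 2 n) (+-comm (ι 2) (ι n))
    ι-1+k : ι (suc x ℕ.+ suc k) ≡ X + ι 2 * J + 1ℚ
    ι-1+k = trans (ι-+ (suc x) (suc k)) (trans (cong (λ y → X + y) (trans (ι-suc k) (cong (_+ 1ℚ) ι-k))) (sym (+-assoc X _ _)))
    ι-2+k : ι (suc x ℕ.+ (2 ℕ.+ k)) ≡ X + ι 2 * J + ι 2
    ι-2+k = trans (ι-+ (suc x) (2 ℕ.+ k)) (trans (cong (λ y → X + y) (trans (ι-2 k) (cong (_+ ι 2) ι-k))) (sym (+-assoc X _ _)))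

    k≡ : 2 ℕ.* suc j ≡ 2 ℕ.+ k
    k≡ = step j
      where
      step : ∀ j → 2 ℕ.* suc j ≡ 2 ℕ.+ 2 ℕ.* j
      step = solve-∀

    factorial : ι ((2 ℕ.* suc j) !) ≡ ι F * ((ι 2 * J + 1ℚ) * (ι 2 * J + ι 2))
    factorial = begin
      ι ((2 ℕ.* suc j) !)
        ≡⟨ cong (λ m → ι (m !)) k≡ ⟩
      ι ((2 ℕ.+ k) ℕ.* (suc k ℕ.* F))
        ≡⟨ trans (ι-* (2 ℕ.+ k) (suc k ℕ.* F)) (cong₂ _*_ (ι-2 k) (trans (ι-* (suc k) F) (cong (_* ι F) (ι-suc k)))) ⟩
      (ι k + ι 2) * ((ι k + 1ℚ) * ι F)
        ≡⟨ cong (λ y → (y + ι 2) * ((y + 1ℚ) * ι F)) ι-k ⟩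
      (ι 2 * J + ι 2) * ((ι 2 * J + 1ℚ) * ι F)
        ≡⟨ solve 2 (λ J F → (two :* J :+ two) :* ((two :* J :+ one) :* F) := F :* ((two :* J :+ one) :* (two :* J :+ two))) refl J (ι F) ⟩
      ι F * ((ι 2 * J + 1ℚ) * (ι 2 * J + ι 2)) ∎

    last : recip (pochhammer (suc x) (suc (2 ℕ.* suc j))) ≡ q
    last = cong (λ m → recip (pochhammer (suc x) (suc m))) k≡

    first : recip (pochhammer (suc x) (suc k)) ≡ q * (X + ι 2 * J + 1ℚ) * (X + ι 2 * J + ι 2)
    first = begin
      recip A
        ≡⟨ recip-extend A ((suc x ℕ.+ suc k) ℕ.* (suc x ℕ.+ (2 ℕ.+ k))) ⟩
      recip (A ℕ.* ((suc x ℕ.+ suc k) ℕ.* (suc x ℕ.+ (2 ℕ.+ k)))) * ι ((suc x ℕ.+ suc k) ℕ.* (suc x ℕ.+ (2 ℕ.+ k)))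
        ≡⟨ cong₂ _*_ (cong recip (sym (ℕ.*-assoc A (suc x ℕ.+ suc k) (suc x ℕ.+ (2 ℕ.+ k)))))
             (trans (ι-* (suc x ℕ.+ suc k) (suc x ℕ.+ (2 ℕ.+ k))) (cong₂ _*_ ι-1+k ι-2+k)) ⟩
      q * ((X + ι 2 * J + 1ℚ) * (X + ι 2 * J + ι 2))
        ≡⟨ *-assoc q _ _ ⟨
      q * (X + ι 2 * J + 1ℚ) * (X + ι 2 * J + ι 2) ∎
      where
      A = pochhammer (suc x) (suc k)

    second : recip (pochhammer (2 ℕ.+ x) (suc k)) ≡ q * X * (X + ι 2 * J + ι 2)
    second = begin
      recip A
        ≡⟨ recip-extend A (suc x ℕ.* (suc x ℕ.+ (2 ℕ.+ k))) ⟩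
      recip (A ℕ.* (suc x ℕ.* (suc x ℕ.+ (2 ℕ.+ k)))) * ι (suc x ℕ.* (suc x ℕ.+ (2 ℕ.+ k)))
        ≡⟨ cong₂ _*_ (cong recip (trans (shuffle A (suc x) (suc x ℕ.+ (2 ℕ.+ k))) (cong (ℕ._* (suc x ℕ.+ (2 ℕ.+ k))) (sym (pochhammer-front (suc x) (suc k))))))
             (trans (ι-* (suc x) (suc x ℕ.+ (2 ℕ.+ k))) (cong (X *_) ι-2+k)) ⟩
      q * (X * (X + ι 2 * J + ι 2))
        ≡⟨ *-assoc q _ _ ⟨
      q * X * (X + ι 2 * J + ι 2) ∎
      where
      A = pochhammer (2 ℕ.+ x) (suc k)
      shuffle : ∀ a b c → a ℕ.* (b ℕ.* c) ≡ b ℕ.* a ℕ.* c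
      shuffle = solve-∀

    third : recip (pochhammer (3 ℕ.+ x) (suc k)) ≡ q * X * (X + 1ℚ)
    third = begin
      recip A
        ≡⟨ recip-extend A (suc x ℕ.* (2 ℕ.+ x)) ⟩
      recip (A ℕ.* (suc x ℕ.* (2 ℕ.+ x))) * ι (suc x ℕ.* (2 ℕ.+ x))
        ≡⟨ cong₂ _*_ (cong recip (trans (shuffle A (suc x) (2 ℕ.+ x))
               (trans (cong (suc x ℕ.*_) (sym (pochhammer-front (2 ℕ.+ x) (suc k)))) (sym (pochhammer-front (suc x) (2 ℕ.+ k))))))
             (trans (ι-* (suc x) (2 ℕ.+ x)) (cong (X *_) (ι-suc (suc x)))) ⟩
      q * (X * (X + 1ℚ))
        ≡⟨ *-assoc q _ _ ⟨
      q * X * (X + 1ℚ) ∎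
      where
      A = pochhammer (3 ℕ.+ x) (suc k)
      shuffle : ∀ a b c → a ℕ.* (b ℕ.* c) ≡ b ℕ.* (c ℕ.* a)
      shuffle = solve-∀

  C≢0 : ∀ {n k} → k ℕ.≤ n → NonZero (n C k)
  C≢0 {n} {k} k≤n = ℕ.≢-nonZero λ eq → ℕ.≢-nonZero⁻¹ (n !) {{n ℕ.!≢0}}
    (trans (sym (C*factorials k≤n)) (cong (ℕ._* (k ! ℕ.* (n ∸ k) !)) eq))

  -- The H of the overview for b = m + 1 and a + b = n, hence the integral of (1 - t²)ᵐ (1 -
  -- t)ⁿ⁻²ᵐ⁻¹.
  binomialTail : ℕ → ℕ → ℚ
  binomialTail m n = ι (lowerSum n (suc m)) * recip (suc m ℕ.* (n C suc m))

  binomialTail-value : ∀ m n → suc m ℕ.≤ n → binomialTail m n * ι (suc m ℕ.* (n C suc m)) ≡ ι (lowerSum n (suc m))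
  binomialTail-value m n m<n = begin
    ι (lowerSum n (suc m)) * recip d * ι d   ≡⟨ *-assoc (ι (lowerSum n (suc m))) (recip d) (ι d) ⟩
    ι (lowerSum n (suc m)) * (recip d * ι d) ≡⟨ cong (ι (lowerSum n (suc m)) *_) (recip-inverse d) ⟩
    ι (lowerSum n (suc m)) * 1ℚ              ≡⟨ *-identityʳ _ ⟩
    ι (lowerSum n (suc m))                   ∎
    where
    d = suc m ℕ.* (n C suc m)
    instance
      _ = C≢0 m<n
      _ = ℕ.m*n≢0 (suc m) (n C suc m)

  -- The counterpart of `beta-step` for binomial sums. E is a common multiple of the three
  -- denominators, E = (m + 1) D₁ = (n + 1) D₂ = y D₃ with y = n - m; once it is cleared, `sumsℕ`
  -- remains.
  binomialTail-step : ∀ m x → let n = x ℕ.+ m ℕ.+ suc m in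
    binomialTail (suc m) (suc n) ≡ ι 2 * binomialTail m n - binomialTail m (suc n)
  binomialTail-step m x = ι-cancel E {{E≢0}} (begin
    binomialTail (suc m) (suc n) * ι E
      ≡⟨ cong (binomialTail (suc m) (suc n) *_) (ι-* (suc m) D₁) ⟩
    binomialTail (suc m) (suc n) * (ι (suc m) * ι D₁)
      ≡⟨ solve 3 (λ t m d → t :* (m :* d) := m :* (t :* d)) refl (binomialTail (suc m) (suc n)) (ι (suc m)) (ι D₁) ⟩
    ι (suc m) * (binomialTail (suc m) (suc n) * ι D₁)
      ≡⟨ cong (ι (suc m) *_) (binomialTail-value (suc m) (suc n) (ℕ.s≤s m<n)) ⟩
    ι (suc m) * ι S₁
      ≡⟨ solve 2 (λ a b → a := (a :+ b) :- b) refl (ι (suc m) * ι S₁) (ι y * ι S₃) ⟩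
    (ι (suc m) * ι S₁ + ι y * ι S₃) - ι y * ι S₃
      ≡⟨ cong (_- ι y * ι S₃) sums ⟩
    ι 2 * (ι (suc n) * ι S₂) - ι y * ι S₃
      ≡⟨ cong₂ (λ p q → ι 2 * (ι (suc n) * p) - ι y * q) (binomialTail-value m n m<n) (binomialTail-value m (suc n) (ℕ.m≤n⇒m≤1+n m<n)) ⟨
    ι 2 * (ι (suc n) * (binomialTail m n * ι D₂)) - ι y * (binomialTail m (suc n) * ι D₃)
      ≡⟨ solve 7 (λ w n t d y t′ d′ → w :* (n :* (t :* d)) :- y :* (t′ :* d′) := w :* t :* (n :* d) :- t′ :* (y :* d′)) refl
           (ι 2) (ι (suc n)) (binomialTail m n) (ι D₂) (ι y) (binomialTail m (suc n)) (ι D₃) ⟩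
    ι 2 * binomialTail m n * (ι (suc n) * ι D₂) - binomialTail m (suc n) * (ι y * ι D₃)
      ≡⟨ cong₂ (λ p q → ι 2 * binomialTail m n * p - binomialTail m (suc n) * q) E₂ E₃ ⟨
    ι 2 * binomialTail m n * ι E - binomialTail m (suc n) * ι E
      ≡⟨ solve 3 (λ a b e → a :* e :- b :* e := (a :- b) :* e) refl (ι 2 * binomialTail m n) (binomialTail m (suc n)) (ι E) ⟩
    (ι 2 * binomialTail m n - binomialTail m (suc n)) * ι E ∎)
    where
    n = x ℕ.+ m ℕ.+ suc m
    y = suc (x ℕ.+ m)
    c = n C m
    p = n C suc m
    r = suc n C suc m
    D₁ = suc (suc m) ℕ.* (suc n C suc (suc m))
    D₂ = suc m ℕ.* p
    D₃ = suc m ℕ.* r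
    E = suc m ℕ.* D₁
    S₁ = lowerSum (suc n) (suc (suc m))
    S₂ = lowerSum n (suc m)
    S₃ = lowerSum (suc n) (suc m)

    m<n : suc m ℕ.≤ n
    m<n = ℕ.m≤n+m (suc m) (x ℕ.+ m)

    E≢0 : NonZero E
    E≢0 = ℕ.m*n≢0 (suc m) D₁ {{_}} {{ℕ.m*n≢0 (suc (suc m)) _ {{_}} {{C≢0 (ℕ.s≤s m<n)}}}}

    p≡ : suc m ℕ.* p ≡ y ℕ.* c
    p≡ = sym (C-absorb (x ℕ.+ m) m)

    r≡ : suc m ℕ.* r ≡ suc n ℕ.* c
    r≡ = begin
      suc m ℕ.* r                   ≡⟨ cong (suc m ℕ.*_) (pascal n (suc m)) ⟩
      suc m ℕ.* (p ℕ.+ c)           ≡⟨ ℕ.*-distribˡ-+ (suc m) p c ⟩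
      suc m ℕ.* p ℕ.+ suc m ℕ.* c   ≡⟨ cong (ℕ._+ suc m ℕ.* c) p≡ ⟩
      y ℕ.* c ℕ.+ suc m ℕ.* c       ≡⟨ ℕ.*-distribʳ-+ c y (suc m) ⟨
      suc n ℕ.* c                   ∎

    D₁≡ : D₁ ≡ y ℕ.* r
    D₁≡ = subst (λ k → suc (suc m) ℕ.* (k C suc (suc m)) ≡ y ℕ.* (k C suc m)) (ℕ.+-suc (x ℕ.+ m) (suc m))
      (sym (C-absorb (x ℕ.+ m) (suc m)))

    E₃ : ι E ≡ ι y * ι D₃
    E₃ = trans (cong ι (trans (cong (suc m ℕ.*_) D₁≡) (swap (suc m) y r))) (ι-* y D₃)
      where
      swap : ∀ a b c → a ℕ.* (b ℕ.* c) ≡ b ℕ.* (a ℕ.* c)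
      swap = solve-∀

    E₂ : ι E ≡ ι (suc n) * ι D₂
    E₂ = trans (cong ι (begin
      suc m ℕ.* D₁             ≡⟨ cong (suc m ℕ.*_) D₁≡ ⟩
      suc m ℕ.* (y ℕ.* r)      ≡⟨ swap (suc m) y r ⟩
      y ℕ.* (suc m ℕ.* r)      ≡⟨ cong (y ℕ.*_) r≡ ⟩
      y ℕ.* (suc n ℕ.* c)      ≡⟨ swap y (suc n) c ⟩
      suc n ℕ.* (y ℕ.* c)      ≡⟨ cong (suc n ℕ.*_) p≡ ⟨
      suc n ℕ.* D₂             ∎)) (ι-* (suc n) D₂)
      where
      swap : ∀ a b c → a ℕ.* (b ℕ.* c) ≡ b ℕ.* (a ℕ.* c)
      swap = solve-∀

    sumsℕ : suc m ℕ.* S₁ ℕ.+ y ℕ.* S₃ ≡ 2 ℕ.* (suc n ℕ.* S₂)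
    -- Pascal's rule expresses S₁ and S₃ through row n, and the absorption identity `p≡` accounts
    -- for the leftover terms.
    sumsℕ = trans (cong₂ (λ a b → suc m ℕ.* a ℕ.+ y ℕ.* b) (lowerSum-pascal n (suc m)) (lowerSum-pascal n m))
      (cancel _ _ p≡ (step (lowerSum n m) c p m x))
      where
      step : ∀ l c p m x →
        (suc m ℕ.* ((l ℕ.+ c ℕ.+ p) ℕ.+ (l ℕ.+ c)) ℕ.+ suc (x ℕ.+ m) ℕ.* ((l ℕ.+ c) ℕ.+ l)) ℕ.+ suc (x ℕ.+ m) ℕ.* c
          ≡ 2 ℕ.* (suc (x ℕ.+ m ℕ.+ suc m) ℕ.* (l ℕ.+ c)) ℕ.+ suc m ℕ.* p
      step = solve-∀

    sums : ι (suc m) * ι S₁ + ι y * ι S₃ ≡ ι 2 * (ι (suc n) * ι S₂)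
    sums = begin
      ι (suc m) * ι S₁ + ι y * ι S₃       ≡⟨ cong₂ _+_ (ι-* (suc m) S₁) (ι-* y S₃) ⟨
      ι (suc m ℕ.* S₁) + ι (y ℕ.* S₃)     ≡⟨ ι-+ (suc m ℕ.* S₁) (y ℕ.* S₃) ⟨
      ι (suc m ℕ.* S₁ ℕ.+ y ℕ.* S₃)       ≡⟨ cong ι sumsℕ ⟩
      ι (2 ℕ.* (suc n ℕ.* S₂))            ≡⟨ ι-* 2 (suc n ℕ.* S₂) ⟩
      ι 2 * ι (suc n ℕ.* S₂)              ≡⟨ cong (ι 2 *_) (ι-* (suc n) S₂) ⟩
      ι 2 * (ι (suc n) * ι S₂)            ∎

  -- Both sides obey the recursion that trades one factor 1 - t² for powers of 1 - t, so the
  -- induction on m needs all x at once. At m = 0 both are 1 / (x + 1).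
  difference-beta : ∀ m x → difference m (beta (suc x)) ≡ binomialTail m (suc x ℕ.+ 2 ℕ.* m)
  difference-beta zero x = cong (λ d → 1ℚ * recip d) (begin
    suc x ℕ.+ 0 ℕ.+ 0           ≡⟨ ℕ.+-identityʳ (suc x ℕ.+ 0) ⟩
    suc x ℕ.+ 0                 ≡⟨ nC1≡n (suc x ℕ.+ 0) ⟨
    (suc x ℕ.+ 0) C 1             ≡⟨ ℕ.+-identityʳ _ ⟨
    1 ℕ.* ((suc x ℕ.+ 0) C 1)     ∎)
  difference-beta (suc m) x = begin
    difference m (λ k → beta (suc x) k - beta (suc x) (suc k))
      ≡⟨ difference-cong m (beta-step x) ⟩
    difference m (λ k → ι 2 * beta (2 ℕ.+ x) k - beta (3 ℕ.+ x) k)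
      ≡⟨ difference-linear m (ι 2) (beta (2 ℕ.+ x)) (beta (3 ℕ.+ x)) ⟩
    ι 2 * difference m (beta (2 ℕ.+ x)) - difference m (beta (3 ℕ.+ x))
      ≡⟨ cong₂ (λ p q → ι 2 * p - q) (difference-beta m (suc x)) (difference-beta m (2 ℕ.+ x)) ⟩
    ι 2 * binomialTail m (2 ℕ.+ x ℕ.+ 2 ℕ.* m) - binomialTail m (3 ℕ.+ x ℕ.+ 2 ℕ.* m)
      ≡⟨ cong (λ n → ι 2 * binomialTail m n - binomialTail m (suc n)) (size m x) ⟨
    ι 2 * binomialTail m (suc x ℕ.+ m ℕ.+ suc m) - binomialTail m (suc (suc x ℕ.+ m ℕ.+ suc m))
      ≡⟨ binomialTail-step m (suc x) ⟨
    binomialTail (suc m) (suc (suc x ℕ.+ m ℕ.+ suc m))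
      ≡⟨ cong (binomialTail (suc m)) (size′ m x) ⟩
    binomialTail (suc m) (suc x ℕ.+ 2 ℕ.* suc m) ∎
    where
    size : ∀ m x → suc x ℕ.+ m ℕ.+ suc m ≡ 2 ℕ.+ x ℕ.+ 2 ℕ.* m
    size = solve-∀
    size′ : ∀ m x → suc (suc x ℕ.+ m ℕ.+ suc m) ≡ suc x ℕ.+ 2 ℕ.* suc m
    size′ = solve-∀

  average : ℕ → ℕ → ℚ
  average δ b = ι (total δ b) * recip (len δ b !)

  average-value : ∀ δ b → average δ b * ι (len δ b !) ≡ ι (total δ b)
  average-value δ b = begin
    ι (total δ b) * recip (len δ b !) * ι (len δ b !)
      ≡⟨ *-assoc (ι (total δ b)) (recip (len δ b !)) (ι (len δ b !)) ⟩
    ι (total δ b) * (recip (len δ b !) * ι (len δ b !))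
      ≡⟨ cong (ι (total δ b) *_) (recip-inverse (len δ b !) {{len δ b ℕ.!≢0}}) ⟩
    ι (total δ b) * 1ℚ
      ≡⟨ *-identityʳ _ ⟩
    ι (total δ b) ∎

  -- This is `total-suc` divided by N !, which is W P by the hook length formula. With A = δ + b + 1
  -- and B = b + 1, the constant is (A + B - 3) / 2 = (2 δ + 4 b - 2) / 4.
  average-suc : ∀ δ b → average δ (suc b)
    ≡ average δ b + (ι 2 * ι δ + ι 4 * ι b - ι 2) * recip 4 + ι 2 * binomialTail b (len δ (suc b))
  average-suc δ b = ι-cancel (N !) {{N ℕ.!≢0}} (begin
    average δ (suc b) * M
      ≡⟨ average-value δ (suc b) ⟩
    ι (total δ (suc b))
      ≡⟨ cong ι (total-suc δ b) ⟩
    ι ((2 ℕ.+ n) ℕ.* (1 ℕ.+ n) ℕ.* total δ b ℕ.+ W ℕ.* K)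
      ≡⟨ trans (ι-+ ((2 ℕ.+ n) ℕ.* (1 ℕ.+ n) ℕ.* total δ b) (W ℕ.* K)) (cong₂ _+_ (sym old) (trans (ι-* W K) (cong (ι W *_) K≡))) ⟩
    Y * M + ι W * (recip 2 * (ι P * (ι δ + (ι b + 1ℚ) + (ι b + 1ℚ)) + ι 4 * ι R - ι 3 * ι P))
      ≡⟨ solve 6 (λ u w p δ b r →
           u :+ w :* (con (recip 2) :* (p :* (δ :+ (b :+ con 1ℚ) :+ (b :+ con 1ℚ)) :+ con (ι 4) :* r :- con (ι 3) :* p))
           := u :+ (con (ι 2) :* δ :+ con (ι 4) :* b :- con (ι 2)) :* con (recip 4) :* (w :* p) :+ con (ι 2) :* (w :* r))
           refl (Y * M) (ι W) (ι P) (ι δ) (ι b) (ι R) ⟩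
    Y * M + (ι 2 * ι δ + ι 4 * ι b - ι 2) * recip 4 * (ι W * ι P) + ι 2 * (ι W * ι R)
      ≡⟨ cong₂ (λ x y → Y * M + (ι 2 * ι δ + ι 4 * ι b - ι 2) * recip 4 * x + ι 2 * y) (sym M≡) (sym new) ⟩
    Y * M + (ι 2 * ι δ + ι 4 * ι b - ι 2) * recip 4 * M + ι 2 * (T * M)
      ≡⟨ solve 4 (λ y e t m → y :* m :+ e :* m :+ con (ι 2) :* (t :* m) := (y :+ e :+ con (ι 2) :* t) :* m) refl
           Y ((ι 2 * ι δ + ι 4 * ι b - ι 2) * recip 4) T M ⟩
    (Y + (ι 2 * ι δ + ι 4 * ι b - ι 2) * recip 4 + ι 2 * T) * M ∎)
    where
    n = len δ b
    N = len δ (suc b)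
    B = suc b
    A = δ ℕ.+ suc b
    f = count δ N
    W = weight δ b
    K = columnCost δ b
    P = B ℕ.* suc A ℕ.* f
    R = suc δ ℕ.* lowerSum N B
    M = ι (N !)
    Y = average δ b
    T = binomialTail b N

    old : Y * M ≡ ι ((2 ℕ.+ n) ℕ.* (1 ℕ.+ n) ℕ.* total δ b)
    old = begin
      Y * ι ((2 ℕ.+ n) ℕ.* ((1 ℕ.+ n) ℕ.* n !))
        ≡⟨ cong (λ m → Y * ι m) (ℕ.*-assoc (2 ℕ.+ n) (1 ℕ.+ n) (n !)) ⟨
      Y * ι ((2 ℕ.+ n) ℕ.* (1 ℕ.+ n) ℕ.* n !)
        ≡⟨ cong (Y *_) (ι-* ((2 ℕ.+ n) ℕ.* (1 ℕ.+ n)) (n !)) ⟩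
      Y * (ι ((2 ℕ.+ n) ℕ.* (1 ℕ.+ n)) * ι (n !))
        ≡⟨ solve 3 (λ y a m → y :* (a :* m) := a :* (y :* m)) refl Y (ι ((2 ℕ.+ n) ℕ.* (1 ℕ.+ n))) (ι (n !)) ⟩
      ι ((2 ℕ.+ n) ℕ.* (1 ℕ.+ n)) * (Y * ι (n !))
        ≡⟨ cong (ι ((2 ℕ.+ n) ℕ.* (1 ℕ.+ n)) *_) (average-value δ b) ⟩
      ι ((2 ℕ.+ n) ℕ.* (1 ℕ.+ n)) * ι (total δ b)
        ≡⟨ ι-* ((2 ℕ.+ n) ℕ.* (1 ℕ.+ n)) (total δ b) ⟨
      ι ((2 ℕ.+ n) ℕ.* (1 ℕ.+ n) ℕ.* total δ b) ∎

    N!≡ : N ! ≡ W ℕ.* P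
    N!≡ = trans (sym (weight*count δ (suc b))) (step b δ W f)
      where
      step : ∀ b δ w f → suc b ℕ.* (2 ℕ.+ δ ℕ.+ b) ℕ.* w ℕ.* f ≡ w ℕ.* (suc b ℕ.* suc (δ ℕ.+ suc b) ℕ.* f)
      step = solve-∀

    M≡ : M ≡ ι W * ι P
    M≡ = trans (cong ι N!≡) (ι-* W P)

    K≡ : ι K ≡ recip 2 * (ι P * (ι δ + (ι b + 1ℚ) + (ι b + 1ℚ)) + ι 4 * ι R - ι 3 * ι P)
    K≡ = begin
      ι K
        ≡⟨ solve 2 (λ k p → k := con (recip 2) :* (con (ι 2) :* k :+ con (ι 3) :* p :- con (ι 3) :* p)) refl (ι K) (ι P) ⟩
      recip 2 * (ι 2 * ι K + ι 3 * ι P - ι 3 * ι P)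
        ≡⟨ cong (λ x → recip 2 * (x - ι 3 * ι P)) (begin
             ι 2 * ι K + ι 3 * ι P
               ≡⟨ cong₂ _+_ (ι-* 2 K) (ι-* 3 P) ⟨
             ι (2 ℕ.* K) + ι (3 ℕ.* P)
               ≡⟨ ι-+ (2 ℕ.* K) (3 ℕ.* P) ⟨
             ι (2 ℕ.* K ℕ.+ 3 ℕ.* P)
               ≡⟨ cong ι (columnCost-closed δ b) ⟩
             ι (P ℕ.* (A ℕ.+ B) ℕ.+ 4 ℕ.* R)
               ≡⟨ trans (ι-+ (P ℕ.* (A ℕ.+ B)) (4 ℕ.* R)) (cong₂ _+_ (ι-* P (A ℕ.+ B)) (ι-* 4 R)) ⟩
             ι P * ι (A ℕ.+ B) + ι 4 * ι R
               ≡⟨ cong (λ x → ι P * x + ι 4 * ι R) (trans (ι-+ A B) (cong₂ _+_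
                    (trans (ι-+ δ B) (cong (λ x → ι δ + x) (ι-suc b))) (ι-suc b))) ⟩
             ι P * (ι δ + (ι b + 1ℚ) + (ι b + 1ℚ)) + ι 4 * ι R ∎) ⟩
      recip 2 * (ι P * (ι δ + (ι b + 1ℚ) + (ι b + 1ℚ)) + ι 4 * ι R - ι 3 * ι P) ∎

    B≤N : B ℕ.≤ N
    B≤N = subst (B ℕ.≤_) (sym (len≡ δ B)) (ℕ.≤-trans (ℕ.m≤m+n B _) (ℕ.m≤n+m (2 ℕ.* B) δ))

    new : T * M ≡ ι W * ι R
    new = begin
      T * ι (N !)
        ≡⟨ cong (λ m → T * ι m) (begin
             N !                                       ≡⟨ N!≡ ⟩
             W ℕ.* (B ℕ.* suc A ℕ.* f)                 ≡⟨ cong (W ℕ.*_) (ℕ.*-assoc B (suc A) f) ⟩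
             W ℕ.* (B ℕ.* (suc A ℕ.* f))               ≡⟨ cong (λ x → W ℕ.* (B ℕ.* x)) (count-binomial N δ B (len≡ δ B)) ⟩
             W ℕ.* (B ℕ.* (suc δ ℕ.* (N C B)))         ≡⟨ step W B (suc δ) (N C B) ⟩
             W ℕ.* suc δ ℕ.* (B ℕ.* (N C B))           ∎) ⟩
      T * ι (W ℕ.* suc δ ℕ.* (B ℕ.* (N C B)))
        ≡⟨ cong (T *_) (ι-* (W ℕ.* suc δ) (B ℕ.* (N C B))) ⟩
      T * (ι (W ℕ.* suc δ) * ι (B ℕ.* (N C B)))
        ≡⟨ solve 3 (λ t a m → t :* (a :* m) := a :* (t :* m)) refl T (ι (W ℕ.* suc δ)) (ι (B ℕ.* (N C B))) ⟩
      ι (W ℕ.* suc δ) * (T * ι (B ℕ.* (N C B)))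
        ≡⟨ cong (ι (W ℕ.* suc δ) *_) (binomialTail-value b N B≤N) ⟩
      ι (W ℕ.* suc δ) * ι (lowerSum N B)
        ≡⟨ trans (sym (ι-* (W ℕ.* suc δ) (lowerSum N B))) (trans (cong ι (ℕ.*-assoc W (suc δ) (lowerSum N B))) (ι-* W R)) ⟩
      ι W * ι R ∎
      where
      step : ∀ w b d c → w ℕ.* (b ℕ.* (d ℕ.* c)) ≡ w ℕ.* d ℕ.* (b ℕ.* c)
      step = solve-∀

  -- Prefixed by 0, so that the sum over k ≥ 1 in the theorem is a full binomial sum.
  betas : ℕ → ℕ → ℚ
  betas x zero    = 0ℚ
  betas x (suc j) = beta x j

  -- All columns share the same δ, hence the same sequence `beta (2 + δ)`, whose b-th difference is
  -- the tail contributed by the step from b to b + 1. Since `beta` is `betas` shifted by one, that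
  -- is also the amount by which the difference of `betas` drops in this step, and the sum over the
  -- columns telescopes into a single difference.
  average-closed : ∀ δ b → average δ b
    ≡ ι (δ ℕ.+ b) * (ι (δ ℕ.+ b) - 1ℚ) * recip 4 + ι b * (ι b - ι 3) * recip 4 - ι 2 * difference b (betas (2 ℕ.+ δ))
  average-closed δ zero = ι-cancel (δ !) {{δ ℕ.!≢0}} (begin
    average δ 0 * M
      ≡⟨ average-value δ 0 ⟩
    ι (total δ 0)
      ≡⟨ solve 2 (λ t x → t := con (recip 4) :* ((con (ι 4) :* t :+ x) :- x)) refl (ι (total δ 0)) (M * ι δ) ⟩
    recip 4 * ((ι 4 * ι (total δ 0) + M * ι δ) - M * ι δ)
      ≡⟨ cong (λ x → recip 4 * (x - M * ι δ)) (begin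
           ι 4 * ι (total δ 0) + M * ι δ             ≡⟨ cong₂ _+_ (ι-* 4 (total δ 0)) (ι-* (δ !) δ) ⟨
           ι (4 ℕ.* total δ 0) + ι (δ ! ℕ.* δ)       ≡⟨ ι-+ (4 ℕ.* total δ 0) (δ ! ℕ.* δ) ⟨
           ι (4 ℕ.* total δ 0 ℕ.+ δ ! ℕ.* δ)         ≡⟨ cong ι (total-0 δ) ⟩
           ι (δ ! ℕ.* (δ ℕ.* δ))                     ≡⟨ trans (ι-* (δ !) (δ ℕ.* δ)) (cong (M *_) (ι-* δ δ)) ⟩
           M * (ι δ * ι δ)                           ∎) ⟩
    recip 4 * (M * (ι δ * ι δ) - M * ι δ)
      ≡⟨ solve 2 (λ m d → con (recip 4) :* (m :* (d :* d) :- m :* d)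
           := (d :* (d :- con 1ℚ) :* con (recip 4) :+ con (ι 0) :* (con (ι 0) :- con (ι 3)) :* con (recip 4) :- con (ι 2) :* con 0ℚ) :* m) refl M (ι δ) ⟩
    (ι δ * (ι δ - 1ℚ) * recip 4 + ι 0 * (ι 0 - ι 3) * recip 4 - ι 2 * 0ℚ) * M
      ≡⟨ cong (λ a → (ι a * (ι a - 1ℚ) * recip 4 + ι 0 * (ι 0 - ι 3) * recip 4 - ι 2 * 0ℚ) * M) (ℕ.+-identityʳ δ) ⟨
    (ι (δ ℕ.+ 0) * (ι (δ ℕ.+ 0) - 1ℚ) * recip 4 + ι 0 * (ι 0 - ι 3) * recip 4 - ι 2 * 0ℚ) * M ∎)
    where
    M = ι (δ !)
  average-closed δ (suc b) = begin
    average δ (suc b)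
      ≡⟨ average-suc δ b ⟩
    average δ b + (ι 2 * ι δ + ι 4 * ι b - ι 2) * recip 4 + ι 2 * binomialTail b (len δ (suc b))
      ≡⟨ cong₂ (λ x y → x + (ι 2 * ι δ + ι 4 * ι b - ι 2) * recip 4 + ι 2 * y) (average-closed δ b) binomialTail≡ ⟩
    ι (δ ℕ.+ b) * (ι (δ ℕ.+ b) - 1ℚ) * recip 4 + ι b * (ι b - ι 3) * recip 4 - ι 2 * D
      + (ι 2 * ι δ + ι 4 * ι b - ι 2) * recip 4 + ι 2 * d
      ≡⟨ cong (λ a → a * (a - 1ℚ) * recip 4 + ι b * (ι b - ι 3) * recip 4 - ι 2 * D
                    + (ι 2 * ι δ + ι 4 * ι b - ι 2) * recip 4 + ι 2 * d) (ι-+ δ b) ⟩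
    (ι δ + ι b) * ((ι δ + ι b) - 1ℚ) * recip 4 + ι b * (ι b - ι 3) * recip 4 - ι 2 * D
      + (ι 2 * ι δ + ι 4 * ι b - ι 2) * recip 4 + ι 2 * d
      ≡⟨ solve 4 (λ δ b D d → 
           (δ :+ b) :* ((δ :+ b) :- con 1ℚ) :* con (recip 4) :+ b :* (b :- con (ι 3)) :* con (recip 4) :- con (ι 2) :* D
             :+ (con (ι 2) :* δ :+ con (ι 4) :* b :- con (ι 2)) :* con (recip 4) :+ con (ι 2) :* d
           := (δ :+ (b :+ con 1ℚ)) :* ((δ :+ (b :+ con 1ℚ)) :- con 1ℚ) :* con (recip 4)
             :+ (b :+ con 1ℚ) :* ((b :+ con 1ℚ) :- con (ι 3)) :* con (recip 4) :- con (ι 2) :* (D :- d)) refl (ι δ) (ι b) D d ⟩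
    (ι δ + (ι b + 1ℚ)) * ((ι δ + (ι b + 1ℚ)) - 1ℚ) * recip 4
      + (ι b + 1ℚ) * ((ι b + 1ℚ) - ι 3) * recip 4 - ι 2 * (D - d)
      ≡⟨ cong₂ (λ x y → (ι δ + x) * ((ι δ + x) - 1ℚ) * recip 4 + x * (x - ι 3) * recip 4 - ι 2 * y)
           (ι-suc b) (difference-suc b (betas (2 ℕ.+ δ))) ⟨
    (ι δ + ι (suc b)) * ((ι δ + ι (suc b)) - 1ℚ) * recip 4
      + ι (suc b) * (ι (suc b) - ι 3) * recip 4 - ι 2 * difference (suc b) (betas (2 ℕ.+ δ))
      ≡⟨ cong (λ a → a * (a - 1ℚ) * recip 4
              + ι (suc b) * (ι (suc b) - ι 3) * recip 4 - ι 2 * difference (suc b) (betas (2 ℕ.+ δ))) (ι-+ δ (suc b)) ⟨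
    ι (δ ℕ.+ suc b) * (ι (δ ℕ.+ suc b) - 1ℚ) * recip 4
      + ι (suc b) * (ι (suc b) - ι 3) * recip 4 - ι 2 * difference (suc b) (betas (2 ℕ.+ δ)) ∎
    where
    D = difference b (betas (2 ℕ.+ δ))
    d = difference b (beta (2 ℕ.+ δ))
    binomialTail≡ : binomialTail b (len δ (suc b)) ≡ d
    binomialTail≡ = trans (cong (binomialTail b) (cong (2 ℕ.+_) (len≡ δ b))) (sym (difference-beta b (suc δ)))

-- Assembly of the formula

module Conclusion where

  open Outcomes
  open ListAlgorithm
  open PermutationWords
  open Simulation
  open Rationals
  open import Defs
  open import Data.Integer.Base as ℤ using (+_; -1ℤ)
  import Data.Integer.Properties as ℤ
  open import Data.List.Base using (map)
  open import Data.List.Properties using (map-∘; map-cong)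
  open import Data.Nat.Base as ℕ using (ℕ; suc; _∸_; _!; _≥_)
  open import Data.Nat.Combinatorics using (_C_)
  import Data.Nat.ListAction as List
  import Data.Nat.Properties as ℕ
  open import Data.Product.Base using (proj₁)
  open import Data.Rational.Base using (ℚ; 0ℚ; _/_; _+_; _-_; _*_)
  open import Data.Rational.Properties using (+-identityˡ; *-assoc)
  open import Function.Construct.Composition using (_↔-∘_)
  open import Relation.Binary.PropositionalEquality
  open ≡-Reasoning

  module _ (a b : ℕ) (a≥b : a ≥ b) (b≥1 : b ≥ 1) where

    private
      Λ : Partition
      Λ = twoRows a b a≥b b≥1

      δ : ℕ
      δ = a ∸ b

    size≡len : size Λ ≡ len δ b
    size≡len = begin
      a ℕ.+ (b ℕ.+ 0)         ≡⟨ cong (ℕ._+ (b ℕ.+ 0)) (ℕ.m∸n+n≡m a≥b) ⟨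
      δ ℕ.+ b ℕ.+ (b ℕ.+ 0)   ≡⟨ ℕ.+-assoc δ b (b ℕ.+ 0) ⟩
      δ ℕ.+ 2 ℕ.* b           ≡⟨ len≡ δ b ⟨
      len δ b                 ∎

    sum-exchanges : List.sum (map (exchanges Λ) (tableaux Λ)) ≡ total δ b
    sum-exchanges = begin
      List.sum (map (exchanges Λ) (map (_↔-∘ numbering (parts Λ)) (permutations (size Λ))))
        ≡⟨ cong List.sum (trans (sym (map-∘ (permutations (size Λ)))) (map-cong (exchanges-run a b a≥b b≥1) (permutations (size Λ)))) ⟩
      List.sum (map _ (permutations (size Λ)))
        ≡⟨ sum-permutations a (size Λ) (λ w → proj₁ (run b w)) ⟩
      wordsSum (size Λ) (λ w → proj₁ (run b w))
        ≡⟨ cong (λ n → wordsSum n (λ w → proj₁ (run b w))) size≡len ⟩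
      wordsSum (len δ b) (λ w → proj₁ (run b w))
        ≡⟨ wordsSum-run δ b proj₁ ⟩
      total δ b ∎

    averageComplexity≡average : averageComplexity Λ ≡ average δ b
    averageComplexity≡average = trans
      (/-recip (+ List.sum (map (exchanges Λ) (tableaux Λ))) (size Λ !) {{size Λ ℕ.!≢0}})
      (cong₂ (λ s n → ι s * recip (n !)) sum-exchanges size≡len)

  quarter : ∀ x c → (+ x ℤ.* (+ x ℤ.- + c)) / 4 ≡ ι x * (ι x - ι c) * recip 4
  quarter x c = trans (/-recip (+ x ℤ.* (+ x ℤ.- + c)) 4) (cong (_* recip 4) (trans (κ-* (+ x) (+ x ℤ.- + c))
    (cong (ι x *_) (trans (κ-+ (+ x) (ℤ.- + c)) (cong (λ y → ι x + y) (κ-neg (+ c)))))))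

  module _ (x b : ℕ) .{{_ : ℕ.NonZero x}} where

    -- Written as in the theorem, instance included, so that `formula` has the required type by
    -- computation.
    summand : ℕ → ℚ
    summand k = let instance _ = pochhammer≢0 x (2 ℕ.* k ∸ 1) in
      (+ (b C k) ℤ.* -1ℤ ℤ.^ k ℤ.* + ((2 ℕ.* k ∸ 2) !)) / pochhammer x (2 ℕ.* k ∸ 1)

    -- At k = j + 1 the truncated 2 k ∸ 2 and 2 k ∸ 1 are 2 j and 2 j + 1, the indices of
    -- `beta x j`.
    summand-suc : ∀ j → summand (suc j) ≡ binomial-term b (betas x) (suc j)
    summand-suc j = begin
      summand (suc j)
        ≡⟨ /-recip (+ (b C suc j) ℤ.* -1ℤ ℤ.^ suc j ℤ.* + ((2 ℕ.* suc j ∸ 2) !)) (pochhammer x (2 ℕ.* suc j ∸ 1)) {{pochhammer≢0 x (2 ℕ.* suc j ∸ 1)}} ⟩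
      κ (+ (b C suc j) ℤ.* -1ℤ ℤ.^ suc j ℤ.* + ((2 ℕ.* suc j ∸ 2) !)) * recip (pochhammer x (2 ℕ.* suc j ∸ 1))
        ≡⟨ cong (λ m → κ (+ (b C suc j) ℤ.* -1ℤ ℤ.^ suc j ℤ.* + ((m ∸ 2) !)) * recip (pochhammer x (m ∸ 1)))
             (cong suc (ℕ.+-suc j (j ℕ.+ 0))) ⟩
      κ (+ (b C suc j) ℤ.* -1ℤ ℤ.^ suc j ℤ.* + ((2 ℕ.* j) !)) * recip (pochhammer x (suc (2 ℕ.* j)))
        ≡⟨ cong (_* recip (pochhammer x (suc (2 ℕ.* j)))) (trans
             (κ-* (+ (b C suc j) ℤ.* -1ℤ ℤ.^ suc j) (+ ((2 ℕ.* j) !)))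
             (cong (_* ι ((2 ℕ.* j) !)) (κ-* (+ (b C suc j)) (-1ℤ ℤ.^ suc j)))) ⟩
      ι (b C suc j) * sign (suc j) * ι ((2 ℕ.* j) !) * recip (pochhammer x (suc (2 ℕ.* j)))
        ≡⟨ *-assoc (ι (b C suc j) * sign (suc j)) (ι ((2 ℕ.* j) !)) _ ⟩
      binomial-term b (betas x) (suc j) ∎

    ∑-summand : ∑₁ b summand ≡ difference b (betas x)
    ∑-summand = begin
      ∑₁ b summand                               ≡⟨ ∑₁-cong b summand-suc ⟩
      ∑₁ b (binomial-term b (betas x))           ≡⟨ +-identityˡ _ ⟨
      0ℚ + ∑₁ b (binomial-term b (betas x))      ≡⟨ difference-binomial b b (betas x) ℕ.≤-refl ⟩
      difference b (betas x)                     ∎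

  formula : ∀ a b (a≥b : a ≥ b) (b≥1 : b ≥ 1) → averageComplexity (twoRows a b a≥b b≥1)
    ≡ (+ a ℤ.* (+ a ℤ.- + 1)) / 4 + (+ b ℤ.* (+ b ℤ.- + 3)) / 4
      - (+ 2 / 1) * ∑₁ b (summand (2 ℕ.+ (a ∸ b)) b)
  formula a b a≥b b≥1 = begin
    averageComplexity (twoRows a b a≥b b≥1)
      ≡⟨ averageComplexity≡average a b a≥b b≥1 ⟩
    average δ b
      ≡⟨ average-closed δ b ⟩
    ι (δ ℕ.+ b) * (ι (δ ℕ.+ b) - ι 1) * recip 4 + ι b * (ι b - ι 3) * recip 4 - ι 2 * difference b (betas (2 ℕ.+ δ))
      ≡⟨ cong (λ x → ι x * (ι x - ι 1) * recip 4 + ι b * (ι b - ι 3) * recip 4 - ι 2 * difference b (betas (2 ℕ.+ δ)))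
           (ℕ.m∸n+n≡m a≥b) ⟩
    ι a * (ι a - ι 1) * recip 4 + ι b * (ι b - ι 3) * recip 4 - ι 2 * difference b (betas (2 ℕ.+ δ))
      ≡⟨ cong₂ _-_ (cong₂ _+_ (quarter a 1) (quarter b 3)) (cong (ι 2 *_) (∑-summand (2 ℕ.+ δ) b)) ⟨
    (+ a ℤ.* (+ a ℤ.- + 1)) / 4 + (+ b ℤ.* (+ b ℤ.- + 3)) / 4 - ι 2 * ∑₁ b (summand (2 ℕ.+ δ) b) ∎
    where
    δ = a ∸ b

open import Defs
open import Data.Integer.Base as ℤ using (+_; -1ℤ)
open import Data.Nat.Base using (ℕ; _≥_; _∸_; _!)
open import Data.Nat.Combinatorics using (_C_)
open import Data.Rational.Base using (_/_; _+_; _-_; _*_)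
open import Relation.Binary.PropositionalEquality using (_≡_)
import Data.Nat.Base as ℕ

theorem6p1 : (λ₁ λ₂ : ℕ) (λ₁≥λ₂ : λ₁ ≥ λ₂) (λ₂≥1 : λ₂ ≥ 1) →
    averageComplexity (twoRows λ₁ λ₂ λ₁≥λ₂ λ₂≥1)
      ≡ (+ λ₁ ℤ.* (+ λ₁ ℤ.- + 1)) / 4
        + (+ λ₂ ℤ.* (+ λ₂ ℤ.- + 3)) / 4
        - (+ 2 / 1) * (∑[1≤ k ≤ λ₂ ]
            (let instance _ = pochhammer≢0 (2 ℕ.+ (λ₁ ∸ λ₂)) (2 ℕ.* k ∸ 1) in
             (+ (λ₂ C k) ℤ.* -1ℤ ℤ.^ k ℤ.* + ((2 ℕ.* k ∸ 2) !))
               / pochhammer (2 ℕ.+ (λ₁ ∸ λ₂)) (2 ℕ.* k ∸ 1)))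
theorem6p1 = Conclusion.formula
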